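{- Let $d \ge 1$ be a fixed integer. There exists a real constant $\delta_d > \log 2$ such that, with $$\alpha_d = \frac{d+1}{((d+1)!)^{1/(d+1)}}\cdot \delta_d, \qquad \beta_d = (d+1)\,\zeta(d+1)^{1/(d+1)},$$ for all sufficiently large integers $n$ we have $$\alpha_d\, n^{d/(d+1)} \le \log \mathsf{p}_d(n) \le \beta_d\, n^{d/(d+1)} + d\log n .$$
   Context: A $d$-dimensional partition is an array $\pi = (\pi_{i_1,\ldots,i_d})_{i_1,\ldots,i_d\ge 1}$ of nonnegative integers with only finitely many nonzero entries such that $\pi_{i_1,\ldots,i_d}\ge \pi_{j_1,\ldots,j_d}$ whenever $i_1\le j_1,\ldots,i_d\le j_d$. Its volume is $|\pi| = \sum_{i_1,\ldots,i_d}\pi_{i_1,\ldots,i_d}$. $\mathsf{p}_d(n)$ denotes the number of $d$-dimensional partitions of volume $n$. $\zeta(s)=\sum_{n\ge1}n^{ -s}$ is the Riemann zeta function, and $\log$ is the natural logarithm. -}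

module Defs where

open import Data.Integer.Base as ℤ using (ℤ; +_; +[1+_]; -[1+_]; +0)
import Data.Integer.Properties as ℤ
open import Data.List.Base using (List; []; _∷_; length; map; mapMaybe; upTo; cartesianProductWith; deduplicate)
open import Data.Maybe.Base using (Maybe; just; nothing)
open import Data.Nat.Base as ℕ using (ℕ; zero; suc)
import Data.Nat.Properties as ℕ
open import Data.Product.Base using (Σ; ∃; ∃-syntax; _×_; _,_; proj₁; proj₂)
open import Data.Rational.Base
open import Data.Rational.Properties hiding (_≟_)
open import Data.Rational.Solver using (module +-*-Solver)
import Data.Rational.Unnormalised.Base as ℚᵘ
import Data.Rational.Unnormalised.Properties as ℚᵘ
open import Data.List.Membership.Propositional.Properties using (∈-upTo⁺)
open import Data.List.Relation.Unary.Any as Any using (Any; here)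
import Data.List.Relation.Unary.Any.Properties as Any
open import Data.List.Relation.Unary.Enumerates.Setoid using (IsEnumeration)
import Data.List.Relation.Unary.Enumerates.Setoid.Properties as Enumerates
open import Data.List.Relation.Unary.Unique.DecSetoid.Properties using (deduplicate-!)
open import Data.List.Relation.Unary.Unique.Setoid using (Unique)
import Data.Maybe.Relation.Unary.Any as Maybe
open Maybe.Any using (just)
open import Data.Vec.Base using (Vec; []; _∷_)
open import Data.Vec.Relation.Binary.Pointwise.Inductive as Pointwise using (Pointwise; []; _∷_)
open import Data.Vec.Relation.Unary.All as All using (All; []; _∷_)
open import Relation.Binary.Bundles using (Setoid; DecSetoid)
open import Relation.Nullary.Decidable using (_→-dec_)
open import Data.Sum.Base using (inj₁; inj₂)
open import Function.Base using (_∘_; case_of_)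
open import Level using (0ℓ)
open import Relation.Binary.PropositionalEquality
open import Relation.Nullary using (¬_; Dec; yes; no; contradiction)
open import Relation.Unary using (Decidable)

open import Algebra.Definitions.RawSemiring +-*-rawSemiring using (_^_)

fromℕ : ℕ → ℚ
fromℕ n = + n / 1

inv : ℕ → ℚ
inv m = + 1 / suc m

fromℕ-suc : ∀ n → fromℕ (suc n) ≡ 1ℚ + fromℕ n
fromℕ-suc n = toℚᵘ-injective (begin
  toℚᵘ (fromℕ (suc n))            ≈⟨ toℚᵘ-fromℚᵘ (ℚᵘ.mkℚᵘ (+ suc n) 0) ⟩
  ℚᵘ.mkℚᵘ (+ suc n) 0             ≈⟨ ℚᵘ.*≡* (cong (λ z → (+ 1 ℤ.+ z) ℤ.* + 1) (sym (ℤ.*-identityʳ (+ n)))) ⟩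
  ℚᵘ.1ℚᵘ ℚᵘ.+ ℚᵘ.mkℚᵘ (+ n) 0     ≈⟨ ℚᵘ.+-congʳ ℚᵘ.1ℚᵘ (ℚᵘ.≃-sym (toℚᵘ-fromℚᵘ (ℚᵘ.mkℚᵘ (+ n) 0))) ⟩
  ℚᵘ.1ℚᵘ ℚᵘ.+ toℚᵘ (fromℕ n)      ≈⟨ toℚᵘ-homo-+ 1ℚ (fromℕ n) ⟨
  toℚᵘ (1ℚ + fromℕ n)             ∎)
  where open ℚᵘ.≃-Reasoning

inv-inverse : ∀ m → inv m * fromℕ (suc m) ≡ 1ℚ
inv-inverse m = toℚᵘ-injective (begin
  toℚᵘ (inv m * fromℕ (suc m))               ≈⟨ toℚᵘ-homo-* (inv m) (fromℕ (suc m)) ⟩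
  toℚᵘ (inv m) ℚᵘ.* toℚᵘ (fromℕ (suc m))     ≈⟨ ℚᵘ.*-cong (toℚᵘ-fromℚᵘ (ℚᵘ.mkℚᵘ (+ 1) m)) (toℚᵘ-fromℚᵘ (ℚᵘ.mkℚᵘ (+ suc m) 0)) ⟩
  ℚᵘ.mkℚᵘ (+ 1) m ℚᵘ.* ℚᵘ.mkℚᵘ (+ suc m) 0   ≈⟨ ℚᵘ.*≡* (cong +_ (trans (ℕ.*-identityʳ _) (cong suc (trans (ℕ.+-identityʳ m) (sym (trans (ℕ.+-identityʳ _) (ℕ.*-identityʳ m))))))) ⟩
  ℚᵘ.1ℚᵘ                                     ∎)
  where open ℚᵘ.≃-Reasoning

*-mono₂ : ∀ {p q r s} → 0ℚ ≤ p → 0ℚ ≤ r → p ≤ q → r ≤ s → p * r ≤ q * s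
*-mono₂ {p} {q} {r} {s} 0≤p 0≤r p≤q r≤s =
  ≤-trans (*-monoʳ-≤-nonNeg r {{nonNegative 0≤r}} p≤q)
          (*-monoˡ-≤-nonNeg q {{nonNegative (≤-trans 0≤p p≤q)}} r≤s)

*-monoˡ : ∀ {p r s} → 0ℚ ≤ p → r ≤ s → p * r ≤ p * s
*-monoˡ {p} 0≤p = *-monoˡ-≤-nonNeg p {{nonNegative 0≤p}}

*-monoʳ : ∀ {p r s} → 0ℚ ≤ p → r ≤ s → r * p ≤ s * p
*-monoʳ {p} 0≤p = *-monoʳ-≤-nonNeg p {{nonNegative 0≤p}}

0≤* : ∀ {p q} → 0ℚ ≤ p → 0ℚ ≤ q → 0ℚ ≤ p * q
0≤* {p} {q} 0≤p 0≤q = subst (_≤ p * q) (*-zeroˡ q) (*-monoʳ 0≤q 0≤p)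

0<* : ∀ {p q} → 0ℚ < p → 0ℚ < q → 0ℚ < p * q
0<* {p} {q} 0<p 0<q = subst (_< p * q) (*-zeroˡ q) (*-monoˡ-<-pos q {{positive 0<q}} 0<p)

p≤p+q : ∀ p {q} → 0ℚ ≤ q → p ≤ p + q
p≤p+q p {q} 0≤q = subst (_≤ p + q) (+-identityʳ p) (+-monoʳ-≤ p 0≤q)

p≤q+p : ∀ p {q} → 0ℚ ≤ q → p ≤ q + p
p≤q+p p {q} 0≤q = subst (_≤ q + p) (+-identityˡ p) (+-monoˡ-≤ p 0≤q)

0≤+ : ∀ {p q} → 0ℚ ≤ p → 0ℚ ≤ q → 0ℚ ≤ p + q
0≤+ {p} 0≤p 0≤q = ≤-trans 0≤p (p≤p+q p 0≤q)

0<+ : ∀ {p q} → 0ℚ ≤ p → 0ℚ < q → 0ℚ < p + q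
0<+ {p} {q} 0≤p 0<q = <-≤-trans 0<q (p≤q+p q 0≤p)

0≤1 : 0ℚ ≤ 1ℚ
0≤1 = *≤* (ℤ.+≤+ ℕ.z≤n)

0<1 : 0ℚ < 1ℚ
0<1 = *<* (ℤ.+<+ (ℕ.s≤s ℕ.z≤n))

0<½ : 0ℚ < ½
0<½ = *<* (ℤ.+<+ (ℕ.s≤s ℕ.z≤n))

half : ∀ p → ½ * p + ½ * p ≡ p
half = solve 1 (λ p → con ½ :* p :+ con ½ :* p := p) refl
  where open +-*-Solver

0<half : ∀ {p} → 0ℚ < p → 0ℚ < ½ * p
0<half = 0<* 0<½

sub-≤ : ∀ {p q r} → p ≤ q + r → p - q ≤ r
sub-≤ {p} {q} {r} h = subst (p - q ≤_) (lem q r) (+-monoˡ-≤ (- q) h)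
  where
  open +-*-Solver
  lem : ∀ q r → (q + r) - q ≡ r
  lem = solve 2 (λ q r → (q :+ r) :+ (:- q) := r) refl

≤-sub : ∀ {p q r} → p - q ≤ r → p ≤ q + r
≤-sub {p} {q} {r} h = subst (_≤ q + r) (lem p q) (+-monoʳ-≤ q h)
  where
  open +-*-Solver
  lem : ∀ p q → q + (p - q) ≡ p
  lem = solve 2 (λ p q → q :+ (p :+ (:- q)) := p) refl

neg-sub : ∀ p q → - (p - q) ≡ q - p
neg-sub = solve 2 (λ p q → :- (p :+ (:- q)) := q :+ (:- p)) refl
  where open +-*-Solver

p≤∣p∣ : ∀ p → p ≤ ∣ p ∣
p≤∣p∣ p with ≤-total 0ℚ p
... | inj₁ 0≤p = ≤-reflexive (sym (0≤p⇒∣p∣≡p 0≤p))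
... | inj₂ p≤0 = ≤-trans p≤0 (0≤∣p∣ p)

∣∣-≤ : ∀ {p r} → p ≤ r → - p ≤ r → ∣ p ∣ ≤ r
∣∣-≤ {p} p≤r -p≤r with ∣p∣≡p∨∣p∣≡-p p
... | inj₁ eq = subst (_≤ _) (sym eq) p≤r
... | inj₂ eq = subst (_≤ _) (sym eq) -p≤r

∣-∣-≤ : ∀ {p q r} → p ≤ q + r → q ≤ p + r → ∣ p - q ∣ ≤ r
∣-∣-≤ {p} {q} p≤q+r q≤p+r =
  ∣∣-≤ (sub-≤ p≤q+r) (subst (_≤ _) (sym (neg-sub p q)) (sub-≤ q≤p+r))

∣-∣-≥ : ∀ {p q r} → ∣ p - q ∣ ≤ r → p ≤ q + r
∣-∣-≥ {p} {q} h = ≤-sub (≤-trans (p≤∣p∣ (p - q)) h)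

0≤fromℕ : ∀ n → 0ℚ ≤ fromℕ n
0≤fromℕ zero    = ≤-refl
0≤fromℕ (suc n) = subst (0ℚ ≤_) (sym (fromℕ-suc n)) (0≤+ 0≤1 (0≤fromℕ n))

1≤fromℕ : ∀ n → 1ℚ ≤ fromℕ (suc n)
1≤fromℕ n = subst (1ℚ ≤_) (sym (fromℕ-suc n)) (p≤p+q 1ℚ (0≤fromℕ n))

0<fromℕ : ∀ n → 0ℚ < fromℕ (suc n)
0<fromℕ n = <-≤-trans 0<1 (1≤fromℕ n)

fromℕ-+ : ∀ m n → fromℕ (m ℕ.+ n) ≡ fromℕ m + fromℕ n
fromℕ-+ zero    n = sym (+-identityˡ (fromℕ n))
fromℕ-+ (suc m) n = begin
  fromℕ (suc (m ℕ.+ n))       ≡⟨ fromℕ-suc (m ℕ.+ n) ⟩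
  1ℚ + fromℕ (m ℕ.+ n)        ≡⟨ cong (λ x → 1ℚ + x) (fromℕ-+ m n) ⟩
  1ℚ + (fromℕ m + fromℕ n)    ≡⟨ +-assoc 1ℚ (fromℕ m) (fromℕ n) ⟨
  (1ℚ + fromℕ m) + fromℕ n    ≡⟨ cong (_+ fromℕ n) (fromℕ-suc m) ⟨
  fromℕ (suc m) + fromℕ n     ∎
  where open ≡-Reasoning

fromℕ-mono : ∀ {m n} → m ℕ.≤ n → fromℕ m ≤ fromℕ n
fromℕ-mono {m} {n} m≤n = subst (fromℕ m ≤_)
  (trans (sym (fromℕ-+ m (n ℕ.∸ m))) (cong fromℕ (ℕ.m+[n∸m]≡n m≤n)))
  (p≤p+q (fromℕ m) (0≤fromℕ (n ℕ.∸ m)))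

0<inv : ∀ m → 0ℚ < inv m
0<inv m = positive⁻¹ (inv m) {{normalize-pos 1 (suc m)}}

0≤inv : ∀ m → 0ℚ ≤ inv m
0≤inv m = <⇒≤ (0<inv m)

inv-≤ : ∀ m {p q} → p ≤ fromℕ (suc m) * q → inv m * p ≤ q
inv-≤ m {p} {q} h = begin
  inv m * p                     ≤⟨ *-monoˡ (0≤inv m) h ⟩
  inv m * (fromℕ (suc m) * q)   ≡⟨ *-assoc (inv m) (fromℕ (suc m)) q ⟨
  inv m * fromℕ (suc m) * q     ≡⟨ cong (_* q) (inv-inverse m) ⟩
  1ℚ * q                        ≡⟨ *-identityˡ q ⟩
  q                             ∎
  where open ≤-Reasoning

inv≤1 : ∀ m → inv m ≤ 1ℚ
inv≤1 m = subst (_≤ 1ℚ) (*-identityʳ (inv m))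
  (inv-≤ m (subst (1ℚ ≤_) (sym (*-identityʳ (fromℕ (suc m)))) (1≤fromℕ m)))

archimedean : ∀ {ε} → 0ℚ < ε → ∃[ N ] ∀ m → N ℕ.≤ m → inv m ≤ ε
archimedean {mkℚ +[1+ p ] q c} _ = q , λ m q≤m → toℚᵘ-cancel-≤
  (ℚᵘ.≤-respˡ-≃ (ℚᵘ.≃-sym (toℚᵘ-fromℚᵘ (ℚᵘ.mkℚᵘ (+ 1) m)))
    (ℚᵘ.*≤* (ℤ.+≤+ (ℕ.*-mono-≤ (ℕ.s≤s (ℕ.z≤n {p})) (ℕ.s≤s q≤m)))))
archimedean {mkℚ +0 q c} (*<* (ℤ.+<+ ()))
archimedean {mkℚ -[1+ p ] q c} (*<* ())

bound : ∀ q → q ≤ fromℕ ℤ.∣ ↥ q ∣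
bound (mkℚ (+ n) d c) = toℚᵘ-cancel-≤
  (ℚᵘ.≤-respʳ-≃ (ℚᵘ.≃-sym (toℚᵘ-fromℚᵘ (ℚᵘ.mkℚᵘ (+ n) 0)))
    (ℚᵘ.*≤* (ℤ.*-monoˡ-≤-nonNeg (+ n) (ℤ.+≤+ (ℕ.s≤s (ℕ.z≤n {d}))))))
bound q@(mkℚ -[1+ n ] d c) = ≤-trans (nonPositive⁻¹ q) (0≤fromℕ (suc n))

0≤^ : ∀ {p} → 0ℚ ≤ p → ∀ k → 0ℚ ≤ p ^ k
0≤^ 0≤p zero    = 0≤1
0≤^ 0≤p (suc k) = 0≤* 0≤p (0≤^ 0≤p k)

0<^ : ∀ {p} → 0ℚ < p → ∀ k → 0ℚ < p ^ k
0<^ 0<p zero    = 0<1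
0<^ 0<p (suc k) = 0<* 0<p (0<^ 0<p k)

^-mono : ∀ {p q} → 0ℚ ≤ p → p ≤ q → ∀ k → p ^ k ≤ q ^ k
^-mono 0≤p p≤q zero    = ≤-refl
^-mono 0≤p p≤q (suc k) = *-mono₂ 0≤p (0≤^ 0≤p k) p≤q (^-mono 0≤p p≤q k)

^≤1 : ∀ {p} → 0ℚ ≤ p → p ≤ 1ℚ → ∀ k → p ^ k ≤ 1ℚ
^≤1 0≤p p≤1 zero    = ≤-refl
^≤1 0≤p p≤1 (suc k) = *-mono₂ 0≤p (0≤^ 0≤p k) p≤1 (^≤1 0≤p p≤1 k)

1≤^ : ∀ {p} → 1ℚ ≤ p → ∀ k → 1ℚ ≤ p ^ k
1≤^ 1≤p zero    = ≤-refl
1≤^ 1≤p (suc k) = *-mono₂ 0≤1 0≤1 1≤p (1≤^ 1≤p k)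

^-superadditive : ∀ {p q} → 0ℚ ≤ p → 0ℚ ≤ q → ∀ k →
                  p ^ suc k + q ^ suc k ≤ (p + q) ^ suc k
^-superadditive {p} {q} 0≤p 0≤q k = begin
  p * p ^ k + q * q ^ k               ≤⟨ +-mono-≤ (*-monoˡ 0≤p (^-mono 0≤p (p≤p+q p 0≤q) k))
                                                  (*-monoˡ 0≤q (^-mono 0≤q (p≤q+p q 0≤p) k)) ⟩
  p * (p + q) ^ k + q * (p + q) ^ k   ≡⟨ *-distribʳ-+ ((p + q) ^ k) p q ⟨
  (p + q) * (p + q) ^ k               ∎
  where open ≤-Reasoning

-- Real numbers are Cauchy sequences of rationals; two sequences denote the
-- same number when each is _≤ᵣ_ the other.

IsCauchy : (ℕ → ℚ) → Set
IsCauchy f = ∀ ε → 0ℚ < ε → ∃[ N ] ∀ m n → N ℕ.≤ m → N ℕ.≤ n → ∣ f m - f n ∣ ≤ ε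

record ℝ : Set where
  constructor mkℝ
  field
    seq    : ℕ → ℚ
    cauchy : IsCauchy seq

open ℝ public

infix 4 _<ᵣ_ _≤ᵣ_

-- A strict inequality of limits needs a gap that persists along the tails.

_<ᵣ_ : ℝ → ℝ → Set
x <ᵣ y = ∃[ ε ] 0ℚ < ε × ∃[ N ] ∀ n → N ℕ.≤ n → seq x n + ε ≤ seq y n

_≤ᵣ_ : ℝ → ℝ → Set
x ≤ᵣ y = ∀ ε → 0ℚ < ε → ∃[ N ] ∀ n → N ℕ.≤ n → seq x n ≤ seq y n + ε

0<2 : 0ℚ < 1ℚ + 1ℚ
0<2 = 0<+ {1ℚ} {1ℚ} 0≤1 0<1

double : ∀ p → p + p ≡ (1ℚ + 1ℚ) * p
double p = sym (trans (*-distribʳ-+ p 1ℚ 1ℚ) (cong₂ _+_ (*-identityˡ p) (*-identityˡ p)))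

divide : ∀ {c ε} → 0ℚ < c → 0ℚ < ε → ∃[ δ ] 0ℚ < δ × c * δ ≡ ε
divide {c} {ε} 0<c 0<ε =
  c⁻¹ * ε , 0<* (positive⁻¹ c⁻¹ {{1/pos⇒pos c {{positive 0<c}}}}) 0<ε , (begin
    c * (c⁻¹ * ε)   ≡⟨ *-assoc c c⁻¹ ε ⟨
    c * c⁻¹ * ε     ≡⟨ cong (_* ε) (*-inverseʳ c {{>-nonZero 0<c}}) ⟩
    1ℚ * ε          ≡⟨ *-identityˡ ε ⟩
    ε               ∎)
  where
  open ≡-Reasoning
  c⁻¹ = (1/ c) {{>-nonZero 0<c}}

cauchy-≤ : ∀ x ε → 0ℚ < ε →
           ∃[ N ] ∀ m n → N ℕ.≤ m → N ℕ.≤ n → seq x m ≤ seq x n + ε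
cauchy-≤ x ε 0<ε = let N , h = cauchy x ε 0<ε in
  N , λ m n N≤m N≤n → ∣-∣-≥ (h m n N≤m N≤n)

cauchy-scaled : ∀ {f} c → 0ℚ < c →
                (∀ ε → 0ℚ < ε → ∃[ N ] ∀ m n → N ℕ.≤ m → N ℕ.≤ n → f m ≤ f n + c * ε) →
                IsCauchy f
cauchy-scaled {f} c 0<c h ε 0<ε =
  let δ , 0<δ , cδ≡ε = divide 0<c 0<ε
      N , hN = h δ 0<δ
  in N , λ m n N≤m N≤n →
  ∣-∣-≤ (subst (λ e → f m ≤ f n + e) cδ≡ε (hN m n N≤m N≤n))
        (subst (λ e → f n ≤ f m + e) cδ≡ε (hN n m N≤n N≤m))

bounded : ∀ x → ∃[ b ] 0ℚ < b × ∃[ N ] ∀ n → N ℕ.≤ n → ∣ seq x n ∣ ≤ b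
bounded x = let N , h = cauchy x 1ℚ 0<1 in
  ∣ seq x N ∣ + 1ℚ , 0<+ (0≤∣p∣ (seq x N)) 0<1 , N , λ n N≤n → begin
  ∣ seq x n ∣                             ≡⟨ cong ∣_∣ (split (seq x N) (seq x n)) ⟩
  ∣ seq x N + (seq x n - seq x N) ∣       ≤⟨ ∣p+q∣≤∣p∣+∣q∣ (seq x N) (seq x n - seq x N) ⟩
  ∣ seq x N ∣ + ∣ seq x n - seq x N ∣     ≤⟨ +-monoʳ-≤ ∣ seq x N ∣ (h n N N≤n ℕ.≤-refl) ⟩
  ∣ seq x N ∣ + 1ℚ                        ∎
  where
  open ≤-Reasoning
  split : ∀ p q → q ≡ p + (q - p)
  split = solve 2 (λ p q → q := p :+ (q :+ (:- p))) refl
    where open +-*-Solver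

fromℚ : ℚ → ℝ
fromℚ q = mkℝ (λ _ → q) (λ ε 0<ε → 0 , λ _ _ _ _ →
  subst (λ p → ∣ p ∣ ≤ ε) (sym (+-inverseʳ q)) (<⇒≤ 0<ε))

fromℕᵣ : ℕ → ℝ
fromℕᵣ n = fromℚ (fromℕ n)

infixl 6 _+ᵣ_
infixl 7 _*ᵣ_

_+ᵣ_ : ℝ → ℝ → ℝ
x +ᵣ y = mkℝ (λ n → seq x n + seq y n) (cauchy-scaled (1ℚ + 1ℚ) 0<2 close)
  where
  open ≤-Reasoning
  regroup : ∀ p q ε → (p + ε) + (q + ε) ≡ (p + q) + (ε + ε)
  regroup = solve 3 (λ p q ε → (p :+ ε) :+ (q :+ ε) := (p :+ q) :+ (ε :+ ε)) refl
    where open +-*-Solver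
  close : ∀ ε → 0ℚ < ε → ∃[ N ] ∀ m n → N ℕ.≤ m → N ℕ.≤ n →
          seq x m + seq y m ≤ seq x n + seq y n + (1ℚ + 1ℚ) * ε
  close ε 0<ε =
    let M , hx = cauchy-≤ x ε 0<ε
        N , hy = cauchy-≤ y ε 0<ε
    in M ℕ.⊔ N , λ m n m≥ n≥ → begin
    seq x m + seq y m                       ≤⟨ +-mono-≤ (hx m n (ℕ.m⊔n≤o⇒m≤o M N m≥) (ℕ.m⊔n≤o⇒m≤o M N n≥))
                                                        (hy m n (ℕ.m⊔n≤o⇒n≤o M N m≥) (ℕ.m⊔n≤o⇒n≤o M N n≥)) ⟩
    (seq x n + ε) + (seq y n + ε)           ≡⟨ trans (regroup (seq x n) (seq y n) ε) (cong (λ t → seq x n + seq y n + t) (double ε)) ⟩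
    seq x n + seq y n + (1ℚ + 1ℚ) * ε       ∎

_*ᵣ_ : ℝ → ℝ → ℝ
x *ᵣ y = mkℝ (λ n → seq x n * seq y n) (cauchy-scaled (a + b) (0<+ (<⇒≤ 0<a) 0<b) close)
  where
  open ≤-Reasoning
  a b : ℚ
  a = proj₁ (bounded x)
  b = proj₁ (bounded y)
  0<a = proj₁ (proj₂ (bounded x))
  0<b = proj₁ (proj₂ (bounded y))
  M₁ = proj₁ (proj₂ (proj₂ (bounded x)))
  M₂ = proj₁ (proj₂ (proj₂ (bounded y)))
  hx = proj₂ (proj₂ (proj₂ (bounded x)))
  hy = proj₂ (proj₂ (proj₂ (bounded y)))
  split : ∀ p q r s → p * q ≡ r * s + (p * (q - s) + (p - r) * s)
  split = solve 4 (λ p q r s → p :* q :=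
                     r :* s :+ (p :* (q :+ (:- s)) :+ (p :+ (:- r)) :* s)) refl
    where open +-*-Solver
  product : ∀ {p q c e} → ∣ p ∣ ≤ c → ∣ q ∣ ≤ e → p * q ≤ c * e
  product {p} {q} {c} {e} hp hq = begin
    p * q           ≤⟨ p≤∣p∣ (p * q) ⟩
    ∣ p * q ∣       ≡⟨ ∣p*q∣≡∣p∣*∣q∣ p q ⟩
    ∣ p ∣ * ∣ q ∣   ≤⟨ *-mono₂ (0≤∣p∣ p) (0≤∣p∣ q) hp hq ⟩
    c * e           ∎
  close : ∀ ε → 0ℚ < ε → ∃[ N ] ∀ m n → N ℕ.≤ m → N ℕ.≤ n →
          seq x m * seq y m ≤ seq x n * seq y n + (a + b) * ε
  close ε 0<ε =
    let N₁ , cx = cauchy x ε 0<ε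
        N₂ , cy = cauchy y ε 0<ε
    in (M₁ ℕ.⊔ M₂) ℕ.⊔ (N₁ ℕ.⊔ N₂) , λ m n m≥ n≥ →
    let M₁≤m = ℕ.m⊔n≤o⇒m≤o M₁ M₂ (ℕ.m⊔n≤o⇒m≤o (M₁ ℕ.⊔ M₂) (N₁ ℕ.⊔ N₂) m≥)
        M₂≤n = ℕ.m⊔n≤o⇒n≤o M₁ M₂ (ℕ.m⊔n≤o⇒m≤o (M₁ ℕ.⊔ M₂) (N₁ ℕ.⊔ N₂) n≥)
        N≤m = ℕ.m⊔n≤o⇒n≤o (M₁ ℕ.⊔ M₂) (N₁ ℕ.⊔ N₂) m≥
        N≤n = ℕ.m⊔n≤o⇒n≤o (M₁ ℕ.⊔ M₂) (N₁ ℕ.⊔ N₂) n≥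
        xmn = cx m n (ℕ.m⊔n≤o⇒m≤o N₁ N₂ N≤m) (ℕ.m⊔n≤o⇒m≤o N₁ N₂ N≤n)
        ymn = cy m n (ℕ.m⊔n≤o⇒n≤o N₁ N₂ N≤m) (ℕ.m⊔n≤o⇒n≤o N₁ N₂ N≤n)
    in begin
      seq x m * seq y m
        ≡⟨ split (seq x m) (seq y m) (seq x n) (seq y n) ⟩
      seq x n * seq y n + (seq x m * (seq y m - seq y n) + (seq x m - seq x n) * seq y n)
        ≤⟨ +-monoʳ-≤ (seq x n * seq y n) (+-mono-≤ (product (hx m M₁≤m) ymn) (product xmn (hy n M₂≤n))) ⟩
      seq x n * seq y n + (a * ε + ε * b)
        ≡⟨ cong (λ t → seq x n * seq y n + (a * ε + t)) (*-comm ε b) ⟩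
      seq x n * seq y n + (a * ε + b * ε)
        ≡⟨ cong (λ t → seq x n * seq y n + t) (*-distribʳ-+ ε a b) ⟨
      seq x n * seq y n + (a + b) * ε ∎

⊔-shift : ∀ p q c {ε} → 0ℚ ≤ ε → p ≤ q + ε → p ⊔ c ≤ (q ⊔ c) + ε
⊔-shift p q c {ε} 0≤ε h = ⊔-lub (≤-trans h (+-monoˡ-≤ ε (p≤p⊔q q c)))
                                    (≤-trans (p≤q⊔p q c) (p≤p+q (q ⊔ c) 0≤ε))

-- 1/x for x > 0.  The proof of positivity bounds the tail of x below by ε, so
-- the maximum with ε alters finitely many terms only.

recip : (x : ℝ) → fromℕᵣ 0 <ᵣ x → ℝ
recip x (ε , 0<ε , _) = mkℝ (λ n → r n) (cauchy-scaled (ε⁻¹ * ε⁻¹) (0<* 0<ε⁻¹ 0<ε⁻¹) close)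
  where
  open ≤-Reasoning
  a : ℕ → ℚ
  a n = seq x n ⊔ ε
  0<a : ∀ n → 0ℚ < a n
  0<a n = <-≤-trans 0<ε (p≤q⊔p (seq x n) ε)
  r : ℕ → ℚ
  r n = (1/ a n) {{>-nonZero (0<a n)}}
  ε⁻¹ = (1/ ε) {{>-nonZero 0<ε}}
  0<ε⁻¹ : 0ℚ < ε⁻¹
  0<ε⁻¹ = positive⁻¹ ε⁻¹ {{1/pos⇒pos ε {{positive 0<ε}}}}
  0≤r : ∀ n → 0ℚ ≤ r n
  0≤r n = <⇒≤ (positive⁻¹ (r n) {{1/pos⇒pos (a n) {{positive (0<a n)}}}})
  ar : ∀ n → a n * r n ≡ 1ℚ
  ar n = *-inverseʳ (a n) {{>-nonZero (0<a n)}}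
  r≤ε⁻¹ : ∀ n → r n ≤ ε⁻¹
  r≤ε⁻¹ n = begin
    r n                 ≡⟨ *-identityʳ (r n) ⟨
    r n * 1ℚ            ≡⟨ cong (r n *_) (*-inverseʳ ε {{>-nonZero 0<ε}}) ⟨
    r n * (ε * ε⁻¹)     ≤⟨ *-monoˡ (0≤r n) (*-monoʳ (<⇒≤ 0<ε⁻¹) (p≤q⊔p (seq x n) ε)) ⟩
    r n * (a n * ε⁻¹)   ≡⟨ swap (r n) (a n) ε⁻¹ ⟩
    a n * r n * ε⁻¹     ≡⟨ cong (_* ε⁻¹) (ar n) ⟩
    1ℚ * ε⁻¹            ≡⟨ *-identityˡ ε⁻¹ ⟩
    ε⁻¹                 ∎
    where
    swap : ∀ p q s → p * (q * s) ≡ q * p * s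
    swap = solve 3 (λ p q s → p :* (q :* s) := q :* p :* s) refl
      where open +-*-Solver
  expand : ∀ p q s η → p * ((q + η) * s) ≡ q * s * p + p * s * η
  expand = solve 4 (λ p q s η → p :* ((q :+ η) :* s) := q :* s :* p :+ p :* s :* η) refl
    where open +-*-Solver
  close : ∀ η → 0ℚ < η → ∃[ N ] ∀ m n → N ℕ.≤ m → N ℕ.≤ n → r m ≤ r n + ε⁻¹ * ε⁻¹ * η
  close η 0<η = let N , h = cauchy-≤ x η 0<η in N , λ m n N≤m N≤n → begin
    r m                               ≡⟨ *-identityʳ (r m) ⟨
    r m * 1ℚ                          ≡⟨ cong (r m *_) (ar n) ⟨
    r m * (a n * r n)                 ≤⟨ *-monoˡ (0≤r m) (*-monoʳ (0≤r n) (⊔-shift (seq x n) (seq x m) ε (<⇒≤ 0<η) (h n m N≤n N≤m))) ⟩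
    r m * ((a m + η) * r n)           ≡⟨ expand (r m) (a m) (r n) η ⟩
    a m * r n * r m + r m * r n * η   ≡⟨ cong (_+ r m * r n * η) (trans (swap (a m) (r n) (r m)) (trans (cong (_* r n) (ar m)) (*-identityˡ (r n)))) ⟩
    r n + r m * r n * η               ≤⟨ +-monoʳ-≤ (r n) (*-monoʳ (<⇒≤ 0<η) (*-mono₂ (0≤r m) (0≤r n) (r≤ε⁻¹ m) (r≤ε⁻¹ n))) ⟩
    r n + ε⁻¹ * ε⁻¹ * η               ∎
    where
    swap : ∀ p q s → p * q * s ≡ p * s * q
    swap = solve 3 (λ p q s → p :* q :* s := p :* s :* q) refl
      where open +-*-Solver

-- The greatest j ≤ b satisfying P, or 0 if there is none.

search : {P : ℕ → Set} → Decidable P → ℕ → ℕ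
search P? zero = 0
search P? (suc b) with P? (suc b)
... | yes _ = suc b
... | no  _ = search P? b

search-spec : {P : ℕ → Set} (P? : Decidable P) → P 0 → ∀ b → ¬ P (suc b) →
              P (search P? b) × ¬ P (suc (search P? b))
search-spec P? p₀ zero    ¬p = p₀ , ¬p
search-spec P? p₀ (suc b) ¬p with P? (suc b)
... | yes p  = p , ¬p
... | no ¬p′ = search-spec P? p₀ b ¬p′

-- The greatest multiple of 1/(m+1) whose k-th power is at most q, for q ≥ 0
-- and k ≥ 1.  The cut-off lies above the k-th root because q ≤ ∣ ↥ q ∣.

rootℚ : ℕ → ℚ → ℕ → ℚ
rootℚ k q m = fromℕ (search (λ j → (fromℕ j * inv m) ^ k ≤? q) (suc m ℕ.* suc ℤ.∣ ↥ q ∣)) * inv m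

one-more : ∀ p q → (1ℚ + p) * q ≡ p * q + q
one-more p q = trans (*-distribʳ-+ q 1ℚ p)
                     (trans (cong (_+ p * q) (*-identityˡ q)) (+-comm q (p * q)))

grid-suc : ∀ m j → fromℕ (suc j) * inv m ≡ fromℕ j * inv m + inv m
grid-suc m j = trans (cong (_* inv m) (fromℕ-suc j)) (one-more (fromℕ j) (inv m))

rootℚ-spec : ∀ k q m → 0ℚ ≤ q →
             0ℚ ≤ rootℚ (suc k) q m × rootℚ (suc k) q m ^ suc k ≤ q ×
             q < (rootℚ (suc k) q m + inv m) ^ suc k
rootℚ-spec k q m 0≤q = 0≤* {fromℕ j} {inv m} (0≤fromℕ j) (0≤inv m) , proj₁ found ,
  subst (λ t → q < t ^ suc k) (grid-suc m j) (≰⇒> (proj₂ found))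
  where
  open ≤-Reasoning
  c = ℤ.∣ ↥ q ∣
  b = suc m ℕ.* suc c
  P : ℕ → Set
  P j = (fromℕ j * inv m) ^ suc k ≤ q
  P? : Decidable P
  P? j = (fromℕ j * inv m) ^ suc k ≤? q
  p₀ : P 0
  p₀ = subst (_≤ q) (sym (trans (cong (_^ suc k) (*-zeroˡ (inv m))) (*-zeroˡ (0ℚ ^ k)))) 0≤q
  fromℕ-* : ∀ m n → fromℕ (m ℕ.* n) ≡ fromℕ m * fromℕ n
  fromℕ-* zero    n = sym (*-zeroˡ (fromℕ n))
  fromℕ-* (suc m) n = trans (fromℕ-+ n (m ℕ.* n))
    (trans (cong (λ t → fromℕ n + t) (fromℕ-* m n))
    (trans (+-comm (fromℕ n) (fromℕ m * fromℕ n))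
    (trans (sym (one-more (fromℕ m) (fromℕ n))) (cong (_* fromℕ n) (sym (fromℕ-suc m))))))
  value : fromℕ b * inv m ≡ fromℕ (suc c)
  value = trans (cong (_* inv m) (fromℕ-* (suc m) (suc c)))
          (trans (lem (fromℕ (suc m)) (fromℕ (suc c)) (inv m))
          (trans (cong (_* fromℕ (suc c)) (inv-inverse m)) (*-identityˡ _)))
    where
    open +-*-Solver
    lem : ∀ p r i → p * r * i ≡ i * p * r
    lem = solve 3 (λ p r i → p :* r :* i := i :* p :* r) refl
  big : fromℕ (suc c) ≤ fromℕ (suc b) * inv m
  big = ≤-trans (≤-reflexive (sym value)) (*-monoʳ (0≤inv m) (fromℕ-mono (ℕ.n≤1+n b)))
  above : q < (fromℕ (suc b) * inv m) ^ suc k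
  above = begin-strict
    q                                  ≤⟨ bound q ⟩
    fromℕ c                            ≡⟨ +-identityˡ (fromℕ c) ⟨
    0ℚ + fromℕ c                       <⟨ +-monoˡ-< (fromℕ c) 0<1 ⟩
    1ℚ + fromℕ c                       ≡⟨ fromℕ-suc c ⟨
    fromℕ (suc c)                      ≡⟨ *-identityʳ (fromℕ (suc c)) ⟨
    fromℕ (suc c) * 1ℚ                 ≤⟨ *-monoˡ (0≤fromℕ (suc c)) (1≤^ (1≤fromℕ c) k) ⟩
    fromℕ (suc c) ^ suc k              ≤⟨ ^-mono (0≤fromℕ (suc c)) big (suc k) ⟩
    (fromℕ (suc b) * inv m) ^ suc k    ∎
  j = search P? b
  found : P j × ¬ P (suc j)
  found = search-spec P? p₀ b (λ p≤q → <-irrefl refl (<-≤-trans above p≤q))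

root-close : ∀ k {p q r s h ε} → 0ℚ ≤ r + h → 0ℚ ≤ ε →
             p < (r + h) ^ suc k → s ^ suc k ≤ q → q ≤ p + ε ^ suc k → s ≤ r + h + ε
root-close k {p} {q} {r} {s} {h} {ε} 0≤r+h 0≤ε p< s≤ q≤ = ≮⇒≥ λ far → <-irrefl refl (begin-strict
  (r + h) ^ suc k + ε ^ suc k   ≤⟨ ^-superadditive 0≤r+h 0≤ε k ⟩
  (r + h + ε) ^ suc k           ≤⟨ ^-mono (0≤+ 0≤r+h 0≤ε) (<⇒≤ far) (suc k) ⟩
  s ^ suc k                     ≤⟨ s≤ ⟩
  q                             ≤⟨ q≤ ⟩
  p + ε ^ suc k                 <⟨ +-monoˡ-< (ε ^ suc k) p< ⟩
  (r + h) ^ suc k + ε ^ suc k   ∎)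
  where open ≤-Reasoning

-- r is a sequence of approximate (k+1)-th roots of the terms of a.

IsRoot : ℕ → (ℕ → ℚ) → (ℕ → ℚ) → Set
IsRoot k a r = ∀ m → 0ℚ ≤ r m × r m ^ suc k ≤ a m × a m < (r m + inv m) ^ suc k

root-cauchy : ∀ k a r → IsRoot k a r →
              (∀ ε → 0ℚ < ε → ∃[ N ] ∀ m n → N ℕ.≤ m → N ℕ.≤ n → a m ≤ a n + ε) →
              IsCauchy r
root-cauchy k a r spec ha = cauchy-scaled (1ℚ + 1ℚ) 0<2 close
  where
  open ≤-Reasoning
  close : ∀ ε → 0ℚ < ε → ∃[ N ] ∀ m n → N ℕ.≤ m → N ℕ.≤ n → r m ≤ r n + (1ℚ + 1ℚ) * ε
  close ε 0<ε =
    let M , hM = archimedean {ε} 0<ε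
        N , hN = ha (ε ^ suc k) (0<^ {ε} 0<ε (suc k))
    in M ℕ.⊔ N , λ m n m≥ n≥ → begin
    r m                   ≤⟨ root-close k {a n} {a m} {r n} {r m} {inv n} {ε}
                               (0≤+ {r n} {inv n} (proj₁ (spec n)) (0≤inv n)) (<⇒≤ 0<ε)
                               (proj₂ (proj₂ (spec n))) (proj₁ (proj₂ (spec m)))
                               (hN m n (ℕ.m⊔n≤o⇒n≤o M N m≥) (ℕ.m⊔n≤o⇒n≤o M N n≥)) ⟩
    (r n + inv n) + ε     ≤⟨ +-monoˡ-≤ ε (+-monoʳ-≤ (r n) (hM n (ℕ.m⊔n≤o⇒m≤o M N n≥))) ⟩
    (r n + ε) + ε         ≡⟨ +-assoc (r n) ε ε ⟩
    r n + (ε + ε)         ≡⟨ cong (λ t → r n + t) (double ε) ⟩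
    r n + (1ℚ + 1ℚ) * ε   ∎

root-bounded-below : ∀ k a r → IsRoot k a r → ∀ η → 0ℚ < η → η ≤ 1ℚ →
                     ∀ n → η ≤ a n → inv n ≤ ½ * η → ½ * η ≤ r n
root-bounded-below k a r spec η 0<η η≤1 n η≤a small = begin
  ½ * η                     ≡⟨ split (½ * η) ⟩
  (½ * η + ½ * η) - ½ * η   ≡⟨ cong (_- ½ * η) (half η) ⟩
  η - ½ * η                 ≤⟨ sub-≤ {η} {½ * η} {r n} (≤-trans below (≤-trans (+-monoʳ-≤ (r n) small)
                                 (≤-reflexive (+-comm (r n) (½ * η))))) ⟩
  r n                       ∎
  where
  open ≤-Reasoning
  split : ∀ p → p ≡ (p + p) - p
  split = solve 1 (λ p → p := (p :+ p) :+ (:- p)) refl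
    where open +-*-Solver
  below : η ≤ r n + inv n
  below = ≮⇒≥ λ r+h<η → <-irrefl refl (begin-strict
    a n                     <⟨ proj₂ (proj₂ (spec n)) ⟩
    (r n + inv n) ^ suc k   ≤⟨ ^-mono {r n + inv n} {η} (0≤+ {r n} {inv n} (proj₁ (spec n)) (0≤inv n)) (<⇒≤ r+h<η) (suc k) ⟩
    η * η ^ k               ≤⟨ *-monoˡ {η} {η ^ k} {1ℚ} (<⇒≤ 0<η) (^≤1 (<⇒≤ 0<η) η≤1 k) ⟩
    η * 1ℚ                  ≡⟨ *-identityʳ η ⟩
    η                       ≤⟨ η≤a ⟩
    a n                     ∎)

positivePart : ℝ → ℕ → ℚ
positivePart x m = seq x m ⊔ 0ℚ

positivePart-cauchy : ∀ x ε → 0ℚ < ε →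
  ∃[ N ] ∀ m n → N ℕ.≤ m → N ℕ.≤ n → positivePart x m ≤ positivePart x n + ε
positivePart-cauchy x ε 0<ε = let N , h = cauchy-≤ x ε 0<ε in
  N , λ m n N≤m N≤n → ⊔-shift (seq x m) (seq x n) 0ℚ (<⇒≤ 0<ε) (h m n N≤m N≤n)

root-spec : ∀ k x → IsRoot k (positivePart x) (λ m → rootℚ (suc k) (seq x m ⊔ 0ℚ) m)
root-spec k x m = rootℚ-spec k (seq x m ⊔ 0ℚ) m (p≤q⊔p (seq x m) 0ℚ)

-- The nonnegative k-th root of max(x, 0).

root : (k : ℕ) .{{_ : ℕ.NonZero k}} → ℝ → ℝ
root (suc k) x = mkℝ (λ m → rootℚ (suc k) (seq x m ⊔ 0ℚ) m)
  (root-cauchy k (positivePart x) _ (root-spec k x) (positivePart-cauchy x))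

fromℕᵣ-positive : ∀ n .{{_ : ℕ.NonZero n}} → fromℕᵣ 0 <ᵣ fromℕᵣ n
fromℕᵣ-positive (suc n) = 1ℚ , 0<1 , 0 , λ _ _ → 1≤fromℕ n

root-positive : ∀ k .{{_ : ℕ.NonZero k}} x → fromℕᵣ 0 <ᵣ x → fromℕᵣ 0 <ᵣ root k x
root-positive (suc k) x (ε , 0<ε , M , hM) = ½ * η , 0<half {η} 0<η , M ℕ.⊔ N , λ n n≥ →
  subst (_≤ seq (root (suc k) x) n) (sym (+-identityˡ (½ * η)))
    (root-bounded-below k (positivePart x) _ (root-spec k x) η 0<η (p⊓q≤q ε 1ℚ) n
      (≤-trans (below-x n (ℕ.m⊔n≤o⇒m≤o M N n≥)) (p≤p⊔q (seq x n) 0ℚ))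
      (hN n (ℕ.m⊔n≤o⇒n≤o M N n≥)))
  where
  η = ε ⊓ 1ℚ
  0<η : 0ℚ < η
  0<η with ⊓-sel ε 1ℚ
  ... | inj₁ eq = subst (0ℚ <_) (sym eq) 0<ε
  ... | inj₂ eq = subst (0ℚ <_) (sym eq) 0<1
  N  = proj₁ (archimedean {½ * η} (0<half {η} 0<η))
  hN = proj₂ (archimedean {½ * η} (0<half {η} 0<η))
  below-x : ∀ n → M ℕ.≤ n → η ≤ seq x n
  below-x n M≤n = ≤-trans (p⊓q≤p ε 1ℚ) (subst (_≤ seq x n) (+-identityˡ ε) (hM n M≤n))

sumℚ : (ℕ → ℚ) → ℕ → ℚ
sumℚ a zero    = 0ℚ
sumℚ a (suc m) = sumℚ a m + a m

inv-step : ∀ m → inv m ≡ inv (suc m) + inv m * inv (suc m)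
inv-step m = begin
  i                            ≡⟨ *-identityʳ i ⟨
  i * 1ℚ                       ≡⟨ cong (i *_) (inv-inverse (suc m)) ⟨
  i * (j * fromℕ (suc (suc m)))   ≡⟨ cong (λ t → i * (j * t)) (fromℕ-suc (suc m)) ⟩
  i * (j * (1ℚ + b))           ≡⟨ cong (λ t → i * t) (trans (*-comm j (1ℚ + b)) (one-more b j)) ⟩
  i * (b * j + j)              ≡⟨ lem i j b ⟩
  (i * b) * j + i * j          ≡⟨ cong (λ t → t * j + i * j) (inv-inverse m) ⟩
  1ℚ * j + i * j               ≡⟨ cong (_+ i * j) (*-identityˡ j) ⟩
  j + i * j                    ∎
  where
  open ≡-Reasoning
  i = inv m
  j = inv (suc m)
  b = fromℕ (suc m)
  lem : ∀ i j b → i * (b * j + j) ≡ (i * b) * j + i * j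
  lem = solve 3 (λ i j b → i :* (b :* j :+ j) := (i :* b) :* j :+ i :* j) refl
    where open +-*-Solver

-- Comparison with the telescoping series Σ c/((i+1)(i+2)).

sum-cauchy : ∀ {a} c → 0ℚ < c → (∀ i → 0ℚ ≤ a i) →
             (∀ i → a i ≤ c * (inv i * inv (suc i))) → IsCauchy (sumℚ a)
sum-cauchy {a} c 0<c 0≤a a≤ = cauchy-scaled c 0<c close
  where
  open ≤-Reasoning
  S : ℕ → ℚ
  S = sumℚ a
  mono : ∀ m k → S m ≤ S (k ℕ.+ m)
  mono m zero    = ≤-refl
  mono m (suc k) = ≤-trans (mono m k) (p≤p+q (S (k ℕ.+ m)) (0≤a (k ℕ.+ m)))
  step : ∀ m → S (suc m) + c * inv (suc m) ≤ S m + c * inv m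
  step m = begin
    S m + a m + c * inv (suc m)
      ≤⟨ +-monoˡ-≤ (c * inv (suc m)) (+-monoʳ-≤ (S m) (a≤ m)) ⟩
    S m + c * (inv m * inv (suc m)) + c * inv (suc m)
      ≡⟨ lem (S m) c (inv m * inv (suc m)) (inv (suc m)) ⟩
    S m + c * (inv (suc m) + inv m * inv (suc m))
      ≡⟨ cong (λ t → S m + c * t) (inv-step m) ⟨
    S m + c * inv m ∎
    where
    lem : ∀ s c p q → s + c * p + c * q ≡ s + c * (q + p)
    lem = solve 4 (λ s c p q → s :+ c :* p :+ c :* q := s :+ c :* (q :+ p)) refl
      where open +-*-Solver
  upper : ∀ m k → S (k ℕ.+ m) + c * inv (k ℕ.+ m) ≤ S m + c * inv m
  upper m zero    = ≤-refl
  upper m (suc k) = ≤-trans (step (k ℕ.+ m)) (upper m k)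
  0≤c* : ∀ {p} → 0ℚ ≤ p → 0ℚ ≤ c * p
  0≤c* = 0≤* (<⇒≤ 0<c)
  close : ∀ ε → 0ℚ < ε → ∃[ N ] ∀ m n → N ℕ.≤ m → N ℕ.≤ n → S m ≤ S n + c * ε
  close ε 0<ε = let N , hN = archimedean 0<ε in N , λ m n N≤m N≤n → case ℕ.≤-total m n of λ where
    (inj₁ m≤n) → begin
      S m                      ≤⟨ mono m (n ℕ.∸ m) ⟩
      S (n ℕ.∸ m ℕ.+ m)        ≡⟨ cong S (ℕ.m∸n+n≡m m≤n) ⟩
      S n                      ≤⟨ p≤p+q (S n) (0≤c* (<⇒≤ 0<ε)) ⟩
      S n + c * ε              ∎
    (inj₂ n≤m) → begin
      S m                      ≤⟨ p≤p+q (S m) (0≤c* (0≤inv m)) ⟩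
      S m + c * inv m          ≡⟨ cong (λ k → S k + c * inv k) (ℕ.m∸n+n≡m n≤m) ⟨
      S (m ℕ.∸ n ℕ.+ n) + c * inv (m ℕ.∸ n ℕ.+ n)
                               ≤⟨ upper n (m ℕ.∸ n) ⟩
      S n + c * inv n          ≤⟨ +-monoʳ-≤ (S n) (*-monoˡ (<⇒≤ 0<c) (hN n N≤n)) ⟩
      S n + c * ε              ∎

-- inv i = 1/(i+1), so the sum over i ≥ 0 is the usual sum over n = i+1 ≥ 1.

ζ : (s : ℕ) → 1 ℕ.< s → ℝ
ζ s 1<s = mkℝ (sumℚ (λ i → inv i ^ s))
  (sum-cauchy (1ℚ + 1ℚ) 0<2 (λ i → 0≤^ (0≤inv i) s) (decay s 1<s))
  where
  open ≤-Reasoning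
  ratio : ∀ i → inv i ≤ (1ℚ + 1ℚ) * inv (suc i)
  ratio i = begin
    inv i                                       ≡⟨ inv-step i ⟩
    inv (suc i) + inv i * inv (suc i)           ≤⟨ +-monoʳ-≤ (inv (suc i)) (*-monoʳ (0≤inv (suc i)) (inv≤1 i)) ⟩
    inv (suc i) + 1ℚ * inv (suc i)              ≡⟨ cong (λ t → inv (suc i) + t) (*-identityˡ (inv (suc i))) ⟩
    inv (suc i) + inv (suc i)                   ≡⟨ double (inv (suc i)) ⟩
    (1ℚ + 1ℚ) * inv (suc i)                     ∎
  decay : ∀ s → 1 ℕ.< s → ∀ i → inv i ^ s ≤ (1ℚ + 1ℚ) * (inv i * inv (suc i))
  decay (suc zero) (ℕ.s≤s ()) i
  decay (suc (suc s)) _ i = begin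
    inv i * (inv i * inv i ^ s)                 ≤⟨ *-monoˡ (0≤inv i) (*-monoˡ (0≤inv i) (^≤1 (0≤inv i) (inv≤1 i) s)) ⟩
    inv i * (inv i * 1ℚ)                        ≡⟨ cong (inv i *_) (*-identityʳ (inv i)) ⟩
    inv i * inv i                               ≤⟨ *-monoˡ (0≤inv i) (ratio i) ⟩
    inv i * ((1ℚ + 1ℚ) * inv (suc i))           ≡⟨ lem (inv i) (1ℚ + 1ℚ) (inv (suc i)) ⟩
    (1ℚ + 1ℚ) * (inv i * inv (suc i))           ∎
    where
    lem : ∀ p c q → p * (c * q) ≡ c * (p * q)
    lem = solve 3 (λ p c q → p :* (c :* q) := c :* (p :* q)) refl
      where open +-*-Solver

-- The natural logarithm of n ≥ 1, by the Taylor series of the logarithm at 1: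
-- log n = -log(1 - u) = Σ_{i≥0} u^(i+1)/(i+1) with u = 1 - 1/n, 0 ≤ u < 1.  The
-- value at n = 0 is arbitrary.

log : ℕ → ℝ
log zero    = fromℕᵣ 0
log (suc k) = mkℝ (sumℚ (λ i → u ^ suc i * inv i))
  (sum-cauchy b (0<fromℕ k) (λ i → 0≤* (0≤^ 0≤u (suc i)) (0≤inv i)) decay)
  where
  open ≤-Reasoning
  u b : ℚ
  u = 1ℚ - inv k
  b = fromℕ (suc k)
  0≤u : 0ℚ ≤ u
  0≤u = subst (_≤ u) (+-inverseʳ (inv k)) (+-monoˡ-≤ (- inv k) (inv≤1 k))
  shrink : ∀ m → u * fromℕ (suc m ℕ.+ suc k) ≤ fromℕ (m ℕ.+ suc k)
  shrink m = begin
    (1ℚ - inv k) * fromℕ (suc m ℕ.+ suc k)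
      ≡⟨ lem (inv k) (fromℕ (suc m ℕ.+ suc k)) ⟩
    fromℕ (suc m ℕ.+ suc k) - inv k * fromℕ (suc m ℕ.+ suc k)
      ≤⟨ +-monoʳ-≤ (fromℕ (suc m ℕ.+ suc k)) (neg-antimono-≤ 1≤) ⟩
    fromℕ (suc m ℕ.+ suc k) - 1ℚ
      ≡⟨ cong (_- 1ℚ) (fromℕ-suc (m ℕ.+ suc k)) ⟩
    (1ℚ + fromℕ (m ℕ.+ suc k)) - 1ℚ
      ≡⟨ lem′ 1ℚ (fromℕ (m ℕ.+ suc k)) ⟩
    fromℕ (m ℕ.+ suc k) ∎
    where
    open +-*-Solver
    lem : ∀ i p → (1ℚ - i) * p ≡ p - i * p
    lem i p = trans (*-distribʳ-+ p 1ℚ (- i))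
                    (cong₂ _+_ (*-identityˡ p) (sym (neg-distribˡ-* i p)))
    lem′ : ∀ c p → (c + p) - c ≡ p
    lem′ = solve 2 (λ c p → (c :+ p) :+ (:- c) := p) refl
    1≤ : 1ℚ ≤ inv k * fromℕ (suc m ℕ.+ suc k)
    1≤ = ≤-trans (≤-reflexive (sym (inv-inverse k)))
                 (*-monoˡ (0≤inv k) (fromℕ-mono (ℕ.m≤n+m (suc k) (suc m))))
  power : ∀ m → u ^ m * fromℕ (m ℕ.+ suc k) ≤ b
  power zero    = ≤-reflexive (*-identityˡ b)
  power (suc m) = begin
    u * u ^ m * fromℕ (suc m ℕ.+ suc k)     ≡⟨ lem u (u ^ m) (fromℕ (suc m ℕ.+ suc k)) ⟩
    u ^ m * (u * fromℕ (suc m ℕ.+ suc k))   ≤⟨ *-monoˡ (0≤^ 0≤u m) (shrink m) ⟩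
    u ^ m * fromℕ (m ℕ.+ suc k)             ≤⟨ power m ⟩
    b                                       ∎
    where
    lem : ∀ p q r → p * q * r ≡ q * (p * r)
    lem = solve 3 (λ p q r → p :* q :* r := q :* (p :* r)) refl
      where open +-*-Solver
  power′ : ∀ i → u ^ suc i ≤ b * inv (suc i)
  power′ i = begin
    u ^ suc i                                       ≡⟨ *-identityʳ (u ^ suc i) ⟨
    u ^ suc i * 1ℚ                                  ≡⟨ cong (u ^ suc i *_) (inv-inverse (suc i)) ⟨
    u ^ suc i * (inv (suc i) * fromℕ (suc (suc i)))   ≡⟨ lem (u ^ suc i) (inv (suc i)) (fromℕ (suc (suc i))) ⟩
    u ^ suc i * fromℕ (suc (suc i)) * inv (suc i)   ≤⟨ *-monoʳ (0≤inv (suc i))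
                                                         (≤-trans (*-monoˡ (0≤^ 0≤u (suc i)) (fromℕ-mono fits)) (power (suc i))) ⟩
    b * inv (suc i)                                 ∎
    where
    lem : ∀ p q r → p * (q * r) ≡ p * r * q
    lem = solve 3 (λ p q r → p :* (q :* r) := p :* r :* q) refl
      where open +-*-Solver
    fits : suc (suc i) ℕ.≤ suc i ℕ.+ suc k
    fits = subst (suc (suc i) ℕ.≤_) (sym (ℕ.+-suc (suc i) k)) (ℕ.s≤s (ℕ.m≤m+n (suc i) k))
  decay : ∀ i → u ^ suc i * inv i ≤ b * (inv i * inv (suc i))
  decay i = begin
    u ^ suc i * inv i               ≤⟨ *-monoʳ (0≤inv i) (power′ i) ⟩
    b * inv (suc i) * inv i         ≡⟨ lem b (inv (suc i)) (inv i) ⟩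
    b * (inv i * inv (suc i))       ∎
    where
    lem : ∀ p q r → p * q * r ≡ p * (r * q)
    lem = solve 3 (λ p q r → p :* q :* r := p :* (r :* q)) refl
      where open +-*-Solver

-- Positions are counted from 0 rather than from 1.

Position : ℕ → Set
Position d = Vec ℕ d

_≼_ : ∀ {d} → Position d → Position d → Set
_≼_ = Pointwise ℕ._≤_

Within : ∀ {d} → ℕ → Position d → Set
Within N = All (ℕ._< N)

-- Having finitely many nonzero entries means vanishing outside some cube.

record Partition (d : ℕ) : Set where
  field
    entry    : Position d → ℕ
    antitone : ∀ {i j} → i ≼ j → entry j ℕ.≤ entry i
    size     : ℕ
    support  : ∀ i → entry i ≢ 0 → Within size i

open Partition public

∑< : ℕ → (ℕ → ℕ) → ℕ
∑< zero    g = 0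
∑< (suc N) g = ∑< N g ℕ.+ g N

∑Within : ∀ d → ℕ → (Position d → ℕ) → ℕ
∑Within zero    N f = f []
∑Within (suc d) N f = ∑< N (λ i → ∑Within d N (λ is → f (i ∷ is)))

-- Independent of the choice of size, by ∑Within-unique.

volume : ∀ {d} → Partition d → ℕ
volume {d} π = ∑Within d (size π) (entry π)

PartitionOf : ℕ → ℕ → Set
PartitionOf d n = Σ (Partition d) (λ π → volume π ≡ n)

_≈_ : ∀ {d n} → PartitionOf d n → PartitionOf d n → Set
(π , _) ≈ (ρ , _) = ∀ i → entry π i ≡ entry ρ i

∑<-cong : ∀ N {f g} → (∀ i → i ℕ.< N → f i ≡ g i) → ∑< N f ≡ ∑< N g
∑<-cong zero    h = refl
∑<-cong (suc N) h = cong₂ ℕ._+_ (∑<-cong N (λ i i<N → h i (ℕ.m<n⇒m<1+n i<N))) (h N ℕ.≤-refl)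

∑Within-cong : ∀ d N {f g} → (∀ i → Within N i → f i ≡ g i) → ∑Within d N f ≡ ∑Within d N g
∑Within-cong zero    N h = h [] []
∑Within-cong (suc d) N h = ∑<-cong N (λ i i<N → ∑Within-cong d N (λ is w → h (i ∷ is) (i<N ∷ w)))

∑<-extend : ∀ K M {g} → (∀ i → M ℕ.≤ i → g i ≡ 0) → ∑< (K ℕ.+ M) g ≡ ∑< M g
∑<-extend zero    M h = refl
∑<-extend (suc K) M h = trans (cong₂ ℕ._+_ (∑<-extend K M h) (h (K ℕ.+ M) (ℕ.m≤n+m M K))) (ℕ.+-identityʳ _)

∑<-zero : ∀ N {g} → (∀ i → g i ≡ 0) → ∑< N g ≡ 0
∑<-zero zero    h = refl
∑<-zero (suc N) h = cong₂ ℕ._+_ (∑<-zero N h) (h N)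

∑Within-zero : ∀ d N {f} → (∀ i → f i ≡ 0) → ∑Within d N f ≡ 0
∑Within-zero zero    N h = h []
∑Within-zero (suc d) N h = ∑<-zero N (λ i → ∑Within-zero d N (λ is → h (i ∷ is)))

vanishes : ∀ {d M} {f : Position d → ℕ} → (∀ i → f i ≢ 0 → Within M i) →
           ∀ i → ¬ Within M i → f i ≡ 0
vanishes {f = f} supp i ¬w with f i ℕ.≟ 0
... | yes fi≡0 = fi≡0
... | no  fi≢0 = contradiction (supp i fi≢0) ¬w

∑Within-extend : ∀ d K M {f} → (∀ i → f i ≢ 0 → Within M i) →
                 ∑Within d (K ℕ.+ M) f ≡ ∑Within d M f
∑Within-extend zero    K M supp = refl
∑Within-extend (suc d) K M {f} supp = trans
  (∑<-cong (K ℕ.+ M) (λ i _ → ∑Within-extend d K M (λ is ≢0 → All.tail (supp (i ∷ is) ≢0))))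
  (∑<-extend K M (λ i M≤i → ∑Within-zero d M
    (λ is → vanishes {f = f} supp (i ∷ is) (λ w → ℕ.<⇒≱ (All.head w) M≤i))))

∑Within-unique : ∀ d M N {f} → (∀ i → f i ≢ 0 → Within M i) → (∀ i → f i ≢ 0 → Within N i) →
                 ∑Within d M f ≡ ∑Within d N f
∑Within-unique d M N {f} sM sN = begin
  ∑Within d M f            ≡⟨ ∑Within-extend d N M sM ⟨
  ∑Within d (N ℕ.+ M) f    ≡⟨ cong (λ K → ∑Within d K f) (ℕ.+-comm N M) ⟩
  ∑Within d (M ℕ.+ N) f    ≡⟨ ∑Within-extend d M N sN ⟩
  ∑Within d N f            ∎
  where open ≡-Reasoning

term≤∑< : ∀ N {g} i → i ℕ.< N → g i ℕ.≤ ∑< N g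
term≤∑< (suc N) {g} i i<1+N with ℕ.m≤n⇒m<n∨m≡n (ℕ.s≤s⁻¹ i<1+N)
... | inj₁ i<N  = ℕ.≤-trans (term≤∑< N i i<N) (ℕ.m≤m+n (∑< N g) (g N))
... | inj₂ refl = ℕ.m≤n+m (g N) (∑< N g)

term≤∑Within : ∀ d N {f} i → Within N i → f i ℕ.≤ ∑Within d N f
term≤∑Within zero    N []       w         = ℕ.≤-refl
term≤∑Within (suc d) N (i ∷ is) (i<N ∷ w) =
  ℕ.≤-trans (term≤∑Within d N is w) (term≤∑< N i i<N)

count≤∑< : ∀ N {g} a → a ℕ.≤ N → (∀ i → i ℕ.< a → 0 ℕ.< g i) → a ℕ.≤ ∑< N g
count≤∑< zero    .zero ℕ.z≤n h = ℕ.z≤n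
count≤∑< (suc N) {g} a a≤1+N h with ℕ.m≤n⇒m<n∨m≡n a≤1+N
... | inj₁ a<1+N = ℕ.≤-trans (count≤∑< N a (ℕ.s≤s⁻¹ a<1+N) h) (ℕ.m≤m+n (∑< N g) (g N))
... | inj₂ refl  = subst (ℕ._≤ ∑< N g ℕ.+ g N) (ℕ.+-comm N 1)
  (ℕ.+-mono-≤ (count≤∑< N N ℕ.≤-refl (λ i i<N → h i (ℕ.m<n⇒m<1+n i<N))) (h N ℕ.≤-refl))

-- A positive entry at i forces positive entries at all smaller positions,
-- so no coordinate of i reaches the volume.

within-volume : ∀ d N {f} → (∀ {i j} → i ≼ j → f j ℕ.≤ f i) →
                ∀ i → Within N i → 0 ℕ.< f i → Within (∑Within d N f) i
within-volume zero    N anti []       w         0<f = []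
within-volume (suc d) N {f} anti (i ∷ is) (i<N ∷ w) 0<f =
  count≤∑< N (suc i) i<N (λ j j<1+i → ℕ.≤-trans
    (ℕ.≤-trans 0<f (anti (ℕ.s≤s⁻¹ j<1+i ∷ Pointwise.refl ℕ.≤-refl)))
    (term≤∑Within d N {λ js → f (j ∷ js)} is w)) ∷
  All.map (λ p → ℕ.≤-trans p (term≤∑< N {λ j → ∑Within d N (λ js → f (j ∷ js))} i i<N))
    (within-volume d N {λ js → f (i ∷ js)} (λ is≼js → anti (ℕ.≤-refl ∷ is≼js)) is w 0<f)

support-volume : ∀ {d n} (π : PartitionOf d n) → ∀ i → entry (proj₁ π) i ≢ 0 → Within n i
support-volume {d} (π , refl) i ≢0 =
  within-volume d (size π) (antitone π) i (support π i ≢0) (ℕ.n≢0⇒n>0 ≢0)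

entry≤volume : ∀ {d n} (π : PartitionOf d n) → ∀ i → entry (proj₁ π) i ℕ.≤ n
entry≤volume {d} (π , refl) i with entry π i ℕ.≟ 0
... | yes ≡0 = subst (ℕ._≤ volume π) (sym ≡0) ℕ.z≤n
... | no  ≢0 = term≤∑Within d (size π) i (support π i ≢0)

allWithin? : ∀ {d} N {P : Position d → Set} → (∀ i → Dec (P i)) → Dec (∀ i → Within N i → P i)
allWithin? {zero} N P? with P? []
... | yes p = yes λ { [] _ → p }
... | no ¬p = no λ h → ¬p (h [] [])
allWithin? {suc d} N P? with ℕ.allUpTo? (λ i → allWithin? N (λ is → P? (i ∷ is))) N
... | yes h = yes λ { (i ∷ is) (i<N ∷ w) → h i<N is w }
... | no ¬h = no λ h → ¬h (λ {i} i<N is w → h (i ∷ is) (i<N ∷ w))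

≈-decidable : ∀ {d n} (π ρ : PartitionOf d n) → Dec (π ≈ ρ)
≈-decidable {n = n} π@(π′ , _) ρ@(ρ′ , _) with allWithin? n (λ i → entry π′ i ℕ.≟ entry ρ′ i)
... | no ¬h = no λ h → ¬h (λ i _ → h i)
... | yes h = yes everywhere
  where
  everywhere : ∀ i → entry π′ i ≡ entry ρ′ i
  everywhere i with All.all? (ℕ._<? n) i
  ... | yes w = h i w
  ... | no ¬w = trans (vanishes {f = entry π′} (support-volume π) i ¬w)
                      (sym (vanishes {f = entry ρ′} (support-volume ρ) i ¬w))

partitionDecSetoid : ℕ → ℕ → DecSetoid 0ℓ 0ℓ
partitionDecSetoid d n = record
  { Carrier          = PartitionOf d n
  ; _≈_              = _≈_
  ; isDecEquivalence = record
    { isEquivalence = record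
      { refl  = λ i → refl
      ; sym   = λ h i → sym (h i)
      ; trans = λ h k i → trans (h i) (k i)
      }
    ; _≟_ = ≈-decidable
    }
  }

partitionSetoid : ℕ → ℕ → Setoid 0ℓ 0ℓ
partitionSetoid d n = DecSetoid.setoid (partitionDecSetoid d n)

update : ∀ {d} → ℕ → (Position d → ℕ) → (Position (suc d) → ℕ) → Position (suc d) → ℕ
update N t r (i ∷ is) with i ℕ.≟ N
... | yes _ = t is
... | no  _ = r (i ∷ is)

-- All arrays on the cube of side M with entries at most n; their values
-- outside the cube are irrelevant.

mutual

  tables : ∀ d → ℕ → ℕ → List (Position d → ℕ)
  tables zero    M n = map (λ k _ → k) (upTo (suc n))
  tables (suc d) M n = layers d M n M

  layers : ∀ d → ℕ → ℕ → ℕ → List (Position (suc d) → ℕ)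
  layers d M n zero    = (λ _ → 0) ∷ []
  layers d M n (suc N) = cartesianProductWith (update N) (tables d M n) (layers d M n N)

mutual

  tables-complete : ∀ d M n (f : Position d → ℕ) → (∀ i → f i ℕ.≤ n) →
                    Any (λ t → ∀ i → Within M i → t i ≡ f i) (tables d M n)
  tables-complete zero    M n f f≤ =
    Any.map⁺ (Any.map (λ { refl [] _ → refl }) (∈-upTo⁺ (ℕ.s≤s (f≤ []))))
  tables-complete (suc d) M n f f≤ = Any.map (λ { h (i ∷ is) (i<M ∷ w) → h i is i<M w })
    (layers-complete d M n M f f≤)

  layers-complete : ∀ d M n N (f : Position (suc d) → ℕ) → (∀ i → f i ℕ.≤ n) →
                    Any (λ t → ∀ i is → i ℕ.< N → Within M is → t (i ∷ is) ≡ f (i ∷ is)) (layers d M n N)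
  layers-complete d M n zero    f f≤ = here (λ _ _ ())
  layers-complete d M n (suc N) f f≤ = Any.cartesianProductWith⁺ (update N) combine
    (tables-complete d M n (λ is → f (N ∷ is)) (λ is → f≤ (N ∷ is)))
    (layers-complete d M n N f f≤)
    where
    combine : ∀ {t r} → (∀ is → Within M is → t is ≡ f (N ∷ is)) →
              (∀ i is → i ℕ.< N → Within M is → r (i ∷ is) ≡ f (i ∷ is)) →
              ∀ i is → i ℕ.< suc N → Within M is → update N t r (i ∷ is) ≡ f (i ∷ is)
    combine ht hr i is i<1+N w with i ℕ.≟ N
    ... | yes refl = ht is w
    ... | no  i≢N  = hr i is (ℕ.≤∧≢⇒< (ℕ.s≤s⁻¹ i<1+N) i≢N) w

clip : ∀ {d} → ℕ → (Position d → ℕ) → Position d → ℕ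
clip M t i with All.all? (ℕ._<? M) i
... | yes _ = t i
... | no  _ = 0

clip-support : ∀ {d} M (t : Position d → ℕ) i → clip M t i ≢ 0 → Within M i
clip-support M t i ≢0 with All.all? (ℕ._<? M) i
... | yes w = w
... | no  _ = contradiction refl ≢0

clip-≡ : ∀ {d} M (t f : Position d → ℕ) → (∀ i → f i ≢ 0 → Within M i) →
         (∀ i → Within M i → t i ≡ f i) → ∀ i → clip M t i ≡ f i
clip-≡ M t f supp h i with All.all? (ℕ._<? M) i
... | yes w = h i w
... | no ¬w = sym (vanishes {f = f} supp i ¬w)

≼-within : ∀ {d M} {i j : Position d} → i ≼ j → Within M j → Within M i
≼-within []           []       = []
≼-within (i≤j ∷ is≼js) (j<M ∷ w) = ℕ.≤-<-trans i≤j j<M ∷ ≼-within is≼js w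

Antitone : ∀ {d} → (Position d → ℕ) → Set
Antitone f = ∀ i j → i ≼ j → f j ℕ.≤ f i

antitone? : ∀ {d} M (f : Position d → ℕ) → (∀ i → f i ≢ 0 → Within M i) → Dec (Antitone f)
antitone? M f supp with
  allWithin? M (λ i → allWithin? M (λ j → Pointwise.decidable ℕ._≤?_ i j →-dec f j ℕ.≤? f i))
... | no ¬h = no λ h → ¬h (λ i _ j _ → h i j)
... | yes h = yes everywhere
  where
  everywhere : Antitone f
  everywhere i j i≼j with All.all? (ℕ._<? M) j
  ... | yes w = h i (≼-within i≼j w) j w i≼j
  ... | no ¬w = subst (ℕ._≤ f i) (sym (vanishes {f = f} supp j ¬w)) ℕ.z≤n

toPartition : ∀ {d} n → (Position d → ℕ) → Maybe (PartitionOf d n)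
toPartition {d} n t with antitone? n (clip n t) (clip-support n t) | ∑Within d n (clip n t) ℕ.≟ n
... | yes anti | yes vol = just (record
  { entry    = clip n t
  ; antitone = λ {i} {j} → anti i j
  ; size     = n
  ; support  = clip-support n t
  } , vol)
... | _ | _ = nothing

toPartition-complete : ∀ {d n} (π : PartitionOf d n) (t : Position d → ℕ) →
  (∀ i → Within n i → t i ≡ entry (proj₁ π) i) →
  Maybe.Any (π ≈_) (toPartition n t)
toPartition-complete {d} {n} π@(π′ , vol) t h
  with antitone? n (clip n t) (clip-support n t) | ∑Within d n (clip n t) ℕ.≟ n
... | yes anti | yes _ = just (λ i → sym (same i))
  where
  same : ∀ i → clip n t i ≡ entry π′ i
  same = clip-≡ n t (entry π′) (support-volume π) h
... | no ¬anti | _ = contradiction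
  (λ i j i≼j → subst₂ ℕ._≤_ (sym (same j)) (sym (same i)) (antitone π′ i≼j)) ¬anti
  where
  same : ∀ i → clip n t i ≡ entry π′ i
  same = clip-≡ n t (entry π′) (support-volume π) h
... | yes _ | no ¬vol = contradiction
  (trans (∑Within-cong d n (λ i _ → same i))
    (trans (∑Within-unique d n (size π′) (support-volume π) (support π′)) vol)) ¬vol
  where
  same : ∀ i → clip n t i ≡ entry π′ i
  same = clip-≡ n t (entry π′) (support-volume π) h

partitions : ∀ d n → List (PartitionOf d n)
partitions d n = deduplicate (DecSetoid._≟_ (partitionDecSetoid d n)) (mapMaybe (toPartition n) (tables d n n))

partitions-complete : ∀ d n → IsEnumeration (partitionSetoid d n) (partitions d n)
partitions-complete d n = Enumerates.deduplicate⁺ (partitionDecSetoid d n) λ π →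
  Any.mapMaybe⁺ (toPartition n) (tables d n n)
    (Any.map⁺ (Any.map (toPartition-complete π _)
      (tables-complete d n n (entry (proj₁ π)) (entry≤volume π))))

partitions-unique : ∀ d n → Unique (partitionSetoid d n) (partitions d n)
partitions-unique d n = deduplicate-! (partitionDecSetoid d n) (mapMaybe (toPartition n) (tables d n n))

-- By partitions-complete and partitions-unique, the list has exactly one entry
-- for each partition of volume n up to equality of entries.

𝗉 : ℕ → ℕ → ℕ
𝗉 d n = length (partitions d n)

infix 8 _^⟨_/_⟩

_^⟨_/_⟩ : ℕ → ℕ → (q : ℕ) .{{_ : ℕ.NonZero q}} → ℝ
n ^⟨ p / q ⟩ = root q (fromℕᵣ (n ℕ.^ p))

root-!-positive : ∀ d → fromℕᵣ 0 <ᵣ root (suc d) (fromℕᵣ (suc d ℕ.!))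
root-!-positive d = root-positive (suc d) (fromℕᵣ (suc d ℕ.!))
  (fromℕᵣ-positive (suc d ℕ.!) {{suc d ℕ.!≢0}})

α : ℕ → ℝ → ℝ
α d δ = fromℕᵣ (suc d) *ᵣ recip (root (suc d) (fromℕᵣ (suc d ℕ.!))) (root-!-positive d) *ᵣ δ

β : (d : ℕ) → 1 ℕ.≤ d → ℝ
β d 1≤d = fromℕᵣ (suc d) *ᵣ root (suc d) (ζ (suc d) (ℕ.s≤s 1≤d))

{-# OPTIONS --safe #-}
module Submission where

-- Upper bound.  An array π is determined by its drops a_i = π_i - max_k π_{i+e_k},
-- and replacing the maximum by the average with weights (i_k+1)/(i_1+⋯+i_d+d)
-- (positions counted from 0) gives Σ a_i (i_1+⋯+i_d+d) ≤ d n.  Counting arrays a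
-- by the generating function Π 1/(1 - q^(i_1+⋯+i_d+d)) at q = 1/(1+t) gives
-- log 𝗉 d n ≤ d n t + ζ(d+1)/t^d for all t > 0; the optimal t gives β.
--
-- Lower bound.  Start from the staircase π_i = m - (i_1+⋯+i_d) and raise its
-- surface entries by 0 or 1 arbitrarily: this alone gives the constant log 2.  To
-- gain on it, divide the positions into cubes of side 2 and allow one more
-- filling of each cube, with 2 at its top corner and 1 at all others.  So a cube
-- has 2^(2^d) + 1 fillings.  The volume is padded to n at the origin.

-- The constant ζ(d+1) comes from -log (1 - q^h) = Σ_k q^(hk)/k: for fixed k, summing q^(hk) over
-- all positions gives the d-th power of a geometric series, at most 1/(kt)^d.
--
-- The factor of δ in α is a count of positions: a staircase of volume n has about ((d+1)!
-- n)^(d/(d+1))/d! surface positions, and ((d+1)!)^(d/(d+1))/d! = (d+1)/((d+1)!)^(1/(d+1)).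
--
-- Padding at the origin hides the filling of the cell there, so the family is injective only
-- together with that filling. This costs one factor 2^(2^d) + 1, that is one cell, and the simplex
-- of cells has one more than r^d/d!.
--
-- The logarithm of n is given only by the partial sums `S (1 - 1/n) K`, so its functional equation
-- is replaced by inequalities between partial sums. Subadditivity of x ↦ `S (1 - x) K` holds for
-- every K, superadditivity up to a term that tends to 0 as K grows. Both come from comparing
-- derivatives, which are finite geometric sums.

module Arrays where

  open import Data.Fin.Base as Fin using (Fin; zero; suc; toℕ; combine; finToFun; funToFin; quotient; remainder)
  import Data.Fin.Properties as Fin
  open import Data.List.Base using (List; []; _∷_; map; _++_; length; lookup; downFrom; cartesianProductWith)
  open import Data.List.Membership.Propositional using (_∈_)
  open import Data.List.Membership.Propositional.Properties
    using (∈-map⁺; ∈-map⁻; ∈-++⁺ˡ; ∈-++⁺ʳ; ∈-cartesianProductWith⁺; ∈-downFrom⁺; ∈-lookup)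
  open import Data.List.Properties using (length-map; length-++; ∷-injectiveˡ; ∷-injectiveʳ)
  open import Data.List.Relation.Unary.All as All using (All; []; _∷_)
  import Data.List.Relation.Unary.All.Properties as All
  open import Data.List.Relation.Unary.AllPairs using ([]; _∷_)
  open import Data.List.Relation.Unary.Any as Any using (here; there)
  import Data.List.Relation.Unary.Any.Properties as Any
  open import Data.List.Relation.Unary.Enumerates.Setoid using (IsEnumeration)
  open import Data.List.Relation.Unary.Unique.Setoid using (Unique)
  import Data.List.Relation.Unary.Unique.Setoid.Properties as Unique
  open import Data.Maybe.Base using (Maybe; just; nothing; maybe; fromMaybe)
  import Data.Maybe.Properties as Maybe
  open import Data.Nat.Base
  open import Data.Nat.Properties
  open import Data.Nat.Solver using (module +-*-Solver)
  open import Data.Product.Base using (∃-syntax; _×_; _,_; proj₁)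
  open import Data.Sum.Base using (_⊎_; inj₁; inj₂)
  open import Data.Vec.Base using ([]; _∷_)
  import Data.Vec.Properties as Vec
  import Data.Vec.Relation.Binary.Pointwise.Inductive as Pointwise
  import Data.Vec.Relation.Unary.All as Vec
  open import Function.Base using (_∘_)
  open import Level using (0ℓ)
  open import Relation.Binary.Bundles using (Setoid)
  open import Relation.Binary.PropositionalEquality
  open import Relation.Nullary using (¬_; yes; no; contradiction)
  open import Defs using (Position; _≼_; Within; Partition; PartitionOf; _≈_; entry; antitone; size; support; volume;
    ∑<; ∑Within; ∑<-cong; ∑Within-cong; ∑Within-zero; ∑Within-unique; vanishes; support-volume;
    𝗉; partitionSetoid; partitions-complete; partitions-unique)
  open +-*-Solver using (solve; _:+_; _:*_; _:=_; con)

  -- Counting by injections, and lists of bounded weighted sum.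

  box : ∀ d → ℕ → List (Position d)
  box zero    N = [] ∷ []
  box (suc d) N = cartesianProductWith _∷_ (downFrom N) (box d N)

  height : ∀ {d} → Position d → ℕ
  height []       = 0
  height (i ∷ is) = suc i + height is

  module _ (Γ : Setoid 0ℓ 0ℓ) where
    private module Γ = Setoid Γ

    lookup-injective : ∀ {xs} → Unique Γ xs → ∀ i j → lookup xs i Γ.≈ lookup xs j → i ≡ j
    lookup-injective (_ ∷ _)  zero    zero    _  = refl
    lookup-injective (x ∷ _)  zero    (suc j) eq = contradiction eq (All.lookup x (∈-lookup j))
    lookup-injective (x ∷ _)  (suc i) zero    eq = contradiction (Γ.sym eq) (All.lookup x (∈-lookup i))
    lookup-injective (_ ∷ xs) (suc i) (suc j) eq = cong suc (lookup-injective xs i j eq)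

    unique⇒length≤ : ∀ {B : Set} {xs} {ys : List B} → Unique Γ xs → (f : Γ.Carrier → B) →
      (∀ x → f x ∈ ys) → (∀ x y → f x ≡ f y → x Γ.≈ y) → length xs ≤ length ys
    unique⇒length≤ {xs = xs} {ys} xs! f f∈ f-inj = Fin.injective⇒≤ {f = position} λ {i} {j} eq →
      lookup-injective xs! i j (f-inj (lookup xs i) (lookup xs j) (begin
        f (lookup xs i)               ≡⟨ Any.lookup-index (f∈ (lookup xs i)) ⟩
        lookup ys (position i)        ≡⟨ cong (lookup ys) eq ⟩
        lookup ys (position j)        ≡⟨ Any.lookup-index (f∈ (lookup xs j)) ⟨
        f (lookup xs j)               ∎))
      where
      open ≡-Reasoning
      position : Fin (length xs) → Fin (length ys)
      position i = Any.index (f∈ (lookup xs i))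

    -- `f` may identify indices; `g` supplies the lost information, so at most `J` indices share a
    -- class. Below, `g` is the filling of the cell at the origin.
    enumeration⇒≤length : ∀ {K J xs} → IsEnumeration Γ xs → (f : Fin K → Γ.Carrier) (g : Fin K → Fin J) →
      (∀ i j → f i Γ.≈ f j → g i ≡ g j → i ≡ j) → K ≤ length xs * J
    enumeration⇒≤length {xs = xs} all f g inj =
      Fin.injective⇒≤ {f = λ i → combine (position i) (g i)} λ {i} {j} eq →
        let same , g≡ = Fin.combine-injective (position i) (g i) (position j) (g j) eq in
        inj i j (Γ.trans (Any.lookup-index (all (f i)))
          (Γ.trans (Γ.reflexive (cong (lookup xs) same)) (Γ.sym (Any.lookup-index (all (f j)))))) g≡
      where
      position : Fin _ → Fin (length xs)
      position i = Any.index (all (f i))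

  ∑ℕ : {A : Set} → (A → ℕ) → List A → ℕ
  ∑ℕ f []       = 0
  ∑ℕ f (x ∷ xs) = f x + ∑ℕ f xs

  bump : List ℕ → List ℕ
  bump []       = []
  bump (a ∷ as) = suc a ∷ as

  -- The entry prepended has weight w; the fuel f bounds it.

  extend : ℕ → (ℕ → List (List ℕ)) → ℕ → ℕ → List (List ℕ)
  extend w C zero    N = map (0 ∷_) (C N)
  extend w C (suc f) N with w ≤? N
  ... | yes _ = map (0 ∷_) (C N) ++ map bump (extend w C f (N ∸ w))
  ... | no  _ = map (0 ∷_) (C N)

  module _ {A : Set} (h : A → ℕ) where

    -- For positive weights these are the lists (a_x) with Σ a_x h(x) ≤ N; their number is the
    -- coefficient of q^N in 1/(1 - q) times Π 1/(1 - q^(h x)).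
    weighted : List A → ℕ → List (List ℕ)
    weighted []       N = [] ∷ []
    weighted (x ∷ xs) N = extend (h x) (weighted xs) N N

    extend-∈ : ∀ w C f N {a r as} → a ≤ f → a * w + r ≤ N → (∀ {M} → r ≤ M → as ∈ C M) →
               a ∷ as ∈ extend w C f N
    extend-∈ w C zero    N z≤n h∈ ∈C = ∈-map⁺ (0 ∷_) (∈C h∈)
    extend-∈ w C (suc f) N {a} {r} a≤ h∈ ∈C with w ≤? N | a
    ... | yes _   | zero  = ∈-++⁺ˡ (∈-map⁺ (0 ∷_) (∈C h∈))
    ... | no  _   | zero  = ∈-map⁺ (0 ∷_) (∈C h∈)
    ... | yes w≤N | suc b = ∈-++⁺ʳ (map (0 ∷_) (C N)) (∈-map⁺ bump (extend-∈ w C f (N ∸ w) (s≤s⁻¹ a≤)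
            (m+n≤o⇒m≤o∸n (b * w + r) (subst (_≤ N) (trans (+-assoc w (b * w) r) (+-comm w (b * w + r))) h∈)) ∈C))
    ... | no  w≰N | suc b = contradiction (≤-trans (≤-trans (m≤m+n w (b * w)) (m≤m+n (w + b * w) r)) h∈) w≰N

    weighted-∈ : ∀ xs N (a : A → ℕ) → (∀ x → 1 ≤ h x) → ∑ℕ (λ x → a x * h x) xs ≤ N → map a xs ∈ weighted xs N
    weighted-∈ []       N a 1≤h sum≤ = here refl
    weighted-∈ (x ∷ xs) N a 1≤h sum≤ = extend-∈ (h x) (weighted xs) N N
      (≤-trans (≤-trans (≤-reflexive (sym (*-identityʳ (a x)))) (*-monoʳ-≤ (a x) (1≤h x))) (m+n≤o⇒m≤o (a x * h x) sum≤))
      sum≤ (λ {M} → weighted-∈ xs M a 1≤h)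

  -- Drops of an array and the encoding of partitions.

  nextMax : ∀ {d} → (Position d → ℕ) → Position d → ℕ
  nextMax f []       = 0
  nextMax f (i ∷ is) = f (suc i ∷ is) ⊔ nextMax (λ js → f (i ∷ js)) is

  nextSum : ∀ {d} → (Position d → ℕ) → Position d → ℕ
  nextSum f []       = 0
  nextSum f (i ∷ is) = suc i * f (suc i ∷ is) + nextSum (λ js → f (i ∷ js)) is

  nextSum≤ : ∀ {d} (f : Position d → ℕ) i → nextSum f i ≤ height i * nextMax f i
  nextSum≤ f []       = z≤n
  nextSum≤ f (i ∷ is) = begin
    suc i * x + nextSum g is                  ≤⟨ +-monoʳ-≤ (suc i * x) (nextSum≤ g is) ⟩
    suc i * x + height is * y               ≤⟨ +-mono-≤ (*-monoʳ-≤ (suc i) (m≤m⊔n x y)) (*-monoʳ-≤ (height is) (m≤n⊔m x y)) ⟩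
    suc i * (x ⊔ y) + height is * (x ⊔ y) ≡⟨ *-distribʳ-+ (x ⊔ y) (suc i) (height is) ⟨
    (suc i + height is) * (x ⊔ y)           ∎
    where
    open ≤-Reasoning
    g = λ js → f (i ∷ js)
    x = f (suc i ∷ is)
    y = nextMax g is

  nextMax≤ : ∀ {d} {f : Position d → ℕ} → (∀ {i j} → i ≼ j → f j ≤ f i) → ∀ i → nextMax f i ≤ f i
  nextMax≤ anti []       = z≤n
  nextMax≤ anti (i ∷ is) = ⊔-lub (anti (n≤1+n i Pointwise.∷ Pointwise.refl ≤-refl))
    (nextMax≤ (λ is≼js → anti (≤-refl Pointwise.∷ is≼js)) is)

  nextMax-cong : ∀ {d} {f g : Position d → ℕ} i → (∀ j → height j ≡ suc (height i) → f j ≡ g j) →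
                 nextMax f i ≡ nextMax g i
  nextMax-cong []       eq = refl
  nextMax-cong (i ∷ is) eq = cong₂ _⊔_ (eq (suc i ∷ is) refl)
    (nextMax-cong is (λ js eq′ → eq (i ∷ js) (trans (cong (suc i +_) eq′) (+-suc (suc i) (height is)))))

  ∑<-mono : ∀ N {f g} → (∀ i → f i ≤ g i) → ∑< N f ≤ ∑< N g
  ∑<-mono zero    h = z≤n
  ∑<-mono (suc N) h = +-mono-≤ (∑<-mono N h) (h N)

  ∑Within-mono : ∀ d N {f g} → (∀ i → f i ≤ g i) → ∑Within d N f ≤ ∑Within d N g
  ∑Within-mono zero    N h = h []
  ∑Within-mono (suc d) N h = ∑<-mono N (λ i → ∑Within-mono d N (λ is → h (i ∷ is)))

  ∑<-+ : ∀ N f g → ∑< N (λ i → f i + g i) ≡ ∑< N f + ∑< N g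
  ∑<-+ zero    f g = refl
  ∑<-+ (suc N) f g = trans (cong (_+ (f N + g N)) (∑<-+ N f g))
    (solve 4 (λ a b c d → (a :+ b) :+ (c :+ d) := (a :+ c) :+ (b :+ d)) refl (∑< N f) (∑< N g) (f N) (g N))

  ∑Within-+ : ∀ d N f g → ∑Within d N (λ i → f i + g i) ≡ ∑Within d N f + ∑Within d N g
  ∑Within-+ zero    N f g = refl
  ∑Within-+ (suc d) N f g = trans (∑<-cong N (λ i _ → ∑Within-+ d N (λ is → f (i ∷ is)) (λ is → g (i ∷ is))))
    (∑<-+ N (λ i → ∑Within d N (λ is → f (i ∷ is))) (λ i → ∑Within d N (λ is → g (i ∷ is))))

  ∑<-* : ∀ N c f → ∑< N (λ i → c * f i) ≡ c * ∑< N f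
  ∑<-* zero    c f = sym (*-zeroʳ c)
  ∑<-* (suc N) c f = trans (cong (_+ c * f N) (∑<-* N c f)) (sym (*-distribˡ-+ c (∑< N f) (f N)))

  ∑Within-* : ∀ d N c f → ∑Within d N (λ i → c * f i) ≡ c * ∑Within d N f
  ∑Within-* zero    N c f = refl
  ∑Within-* (suc d) N c f = trans (∑<-cong N (λ i _ → ∑Within-* d N c (λ is → f (i ∷ is))))
    (∑<-* N c (λ i → ∑Within d N (λ is → f (i ∷ is))))

  ∑<-shift : ∀ N (F : ℕ → ℕ) → ∑< N (λ i → suc i * F (suc i)) ≡ ∑< N (λ i → i * F i) + N * F N
  ∑<-shift zero    F = refl
  ∑<-shift (suc N) F = cong (_+ suc N * F (suc N)) (∑<-shift N F)

  -- Summation by parts in each coordinate: with j = i + e_k, the weight i_k + 1 becomes j_k, and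
  -- the boundary term vanishes because the support lies in the cube. The rest, height j - Σ j_k, is
  -- d.
  height-sum : ∀ d N (f : Position d → ℕ) → (∀ i → f i ≢ 0 → Within N i) →
    ∑Within d N (λ i → height i * f i) ≡ ∑Within d N (nextSum f) + d * ∑Within d N f
  height-sum zero    N f supp = refl
  height-sum (suc d) N f supp = begin
    ∑< N (λ i → W (λ is → (suc i + height is) * f (i ∷ is)))
      ≡⟨ ∑<-cong N (λ i _ → row i) ⟩
    ∑< N (λ i → (F i + i * F i) + (G i + d * F i))
      ≡⟨ ∑<-+ N (λ i → F i + i * F i) (λ i → G i + d * F i) ⟩
    ∑< N (λ i → F i + i * F i) + ∑< N (λ i → G i + d * F i)
      ≡⟨ cong₂ _+_ (∑<-+ N F (λ i → i * F i)) (∑<-+ N G (λ i → d * F i)) ⟩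
    (∑< N F + ∑< N (λ i → i * F i)) + (∑< N G + ∑< N (λ i → d * F i))
      ≡⟨ cong₂ (λ x y → (∑< N F + x) + (∑< N G + y)) shifted (∑<-* N d F) ⟩
    (∑< N F + ∑< N (λ i → suc i * F (suc i))) + (∑< N G + d * ∑< N F)
      ≡⟨ solve 4 (λ a b c e → (a :+ b) :+ (c :+ e) := (b :+ c) :+ (a :+ e)) refl
           (∑< N F) (∑< N (λ i → suc i * F (suc i))) (∑< N G) (d * ∑< N F) ⟩
    (∑< N (λ i → suc i * F (suc i)) + ∑< N G) + suc d * ∑< N F
      ≡⟨ cong (_+ suc d * ∑< N F) (∑<-+ N (λ i → suc i * F (suc i)) G) ⟨
    ∑< N (λ i → suc i * F (suc i) + G i) + suc d * ∑< N F
      ≡⟨ cong (_+ suc d * ∑< N F) (∑<-cong N (λ i _ → sym (split i))) ⟩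
    ∑< N (λ i → W (λ is → nextSum f (i ∷ is))) + suc d * ∑< N F ∎
    where
    open ≡-Reasoning
    W = ∑Within d N
    F G : ℕ → ℕ
    F i = W (λ is → f (i ∷ is))
    G i = W (nextSum (λ is → f (i ∷ is)))
    row : ∀ i → W (λ is → (suc i + height is) * f (i ∷ is)) ≡ (F i + i * F i) + (G i + d * F i)
    row i = trans (∑Within-cong d N (λ is _ → *-distribʳ-+ (f (i ∷ is)) (suc i) (height is)))
      (trans (∑Within-+ d N (λ is → suc i * f (i ∷ is)) (λ is → height is * f (i ∷ is)))
        (cong₂ _+_ (∑Within-* d N (suc i) (λ is → f (i ∷ is)))
          (height-sum d N (λ is → f (i ∷ is)) (λ is ≢0 → Vec.tail (supp (i ∷ is) ≢0)))))
    split : ∀ i → W (λ is → nextSum f (i ∷ is)) ≡ suc i * F (suc i) + G i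
    split i = trans (∑Within-+ d N (λ is → suc i * f (suc i ∷ is)) (nextSum (λ is → f (i ∷ is))))
      (cong (_+ G i) (∑Within-* d N (suc i) (λ is → f (suc i ∷ is))))
    FN≡0 : F N ≡ 0
    FN≡0 = ∑Within-zero d N (λ is → vanishes {f = f} supp (N ∷ is) (λ w → <-irrefl refl (Vec.head w)))
    shifted : ∑< N (λ i → i * F i) ≡ ∑< N (λ i → suc i * F (suc i))
    shifted = sym (trans (∑<-shift N F) (trans (cong (λ x → ∑< N (λ i → i * F i) + N * x) FN≡0)
      (trans (cong (∑< N (λ i → i * F i) +_) (*-zeroʳ N)) (+-identityʳ _))))

  drop : ∀ {d} → (Position d → ℕ) → Position d → ℕ
  drop f i = f i ∸ nextMax f i

  -- The positions i + e_k, weighted by i_k + 1, have total weight height i, and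
  -- the entry at j is weighted j_1 + ⋯ + j_d = height j - d in the sum over i.

  drop-sum≤ : ∀ d N (f : Position d → ℕ) → (∀ {i j} → i ≼ j → f j ≤ f i) → (∀ i → f i ≢ 0 → Within N i) →
    ∑Within d N (λ i → drop f i * height i) ≤ d * ∑Within d N f
  drop-sum≤ d N f anti supp = +-cancelˡ-≤ (∑Within d N (nextSum f)) _ _ (begin
    ∑Within d N (nextSum f) + ∑Within d N (λ i → drop f i * height i)
      ≡⟨ ∑Within-+ d N (nextSum f) (λ i → drop f i * height i) ⟨
    ∑Within d N (λ i → nextSum f i + drop f i * height i)
      ≤⟨ ∑Within-mono d N pointwise ⟩
    ∑Within d N (λ i → height i * f i)
      ≡⟨ height-sum d N f supp ⟩
    ∑Within d N (nextSum f) + d * ∑Within d N f ∎)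
    where
    open ≤-Reasoning
    pointwise : ∀ i → nextSum f i + drop f i * height i ≤ height i * f i
    pointwise i = begin
      nextSum f i + drop f i * height i                 ≤⟨ +-mono-≤ (nextSum≤ f i) (≤-reflexive (*-comm (drop f i) (height i))) ⟩
      height i * nextMax f i + height i * drop f i    ≡⟨ *-distribˡ-+ (height i) (nextMax f i) (drop f i) ⟨
      height i * (nextMax f i + drop f i)               ≡⟨ cong (height i *_) (m+[n∸m]≡n (nextMax≤ anti i)) ⟩
      height i * f i                                      ∎

  height-within : ∀ {d N} {i : Position d} → Within N i → height i ≤ d * N
  height-within Vec.[]         = z≤n
  height-within (i<N Vec.∷ w) = +-mono-≤ i<N (height-within w)

  -- f i is `drop f i` plus a maximum over positions one unit higher, so f is recovered by downward
  -- induction on the height, starting outside the cube, where both arrays vanish.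
  drop-determines : ∀ {d N} {f g : Position d → ℕ} →
    (∀ {i j} → i ≼ j → f j ≤ f i) → (∀ {i j} → i ≼ j → g j ≤ g i) →
    (∀ i → f i ≢ 0 → Within N i) → (∀ i → g i ≢ 0 → Within N i) →
    (∀ i → Within N i → drop f i ≡ drop g i) → ∀ i → f i ≡ g i
  drop-determines {d} {N} {f} {g} anti-f anti-g supp-f supp-g eq i =
    from-top (suc (d * N)) i (m≤n+m (suc (d * N)) (height i))
    where
    open ≡-Reasoning
    -- `k` is the distance to the heights above d N, the greatest height in the cube; at k = 0 the
    -- position must lie outside.
    from-top : ∀ k i → d * N < height i + k → f i ≡ g i
    from-top k i far with Vec.all? (_<? N) i
    from-top k       i far | no ¬w = trans (vanishes {f = f} supp-f i ¬w) (sym (vanishes {f = g} supp-g i ¬w))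
    from-top zero    i far | yes w = contradiction (height-within w)
      (<⇒≱ (subst (d * N <_) (+-identityʳ (height i)) far))
    from-top (suc k) i far | yes w = begin
      f i                          ≡⟨ m∸n+n≡m (nextMax≤ anti-f i) ⟨
      drop f i + nextMax f i     ≡⟨ cong₂ _+_ (eq i w) (nextMax-cong i (λ j eq′ →
                                        from-top k j (subst (d * N <_) (trans (+-suc (height i) k) (cong (_+ k) (sym eq′))) far))) ⟩
      drop g i + nextMax g i     ≡⟨ m∸n+n≡m (nextMax≤ anti-g i) ⟩
      g i                          ∎

  ∈-box : ∀ {d N} {i : Position d} → Within N i → i ∈ box d N
  ∈-box Vec.[]         = here refl
  ∈-box (i<N Vec.∷ w) = ∈-cartesianProductWith⁺ _∷_ (∈-downFrom⁺ i<N) (∈-box w)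

  ∑ℕ-++ : ∀ {A : Set} (f : A → ℕ) xs ys → ∑ℕ f (xs ++ ys) ≡ ∑ℕ f xs + ∑ℕ f ys
  ∑ℕ-++ f []       ys = refl
  ∑ℕ-++ f (x ∷ xs) ys = trans (cong (f x +_) (∑ℕ-++ f xs ys)) (sym (+-assoc (f x) (∑ℕ f xs) (∑ℕ f ys)))

  ∑ℕ-map : ∀ {A B : Set} (f : A → ℕ) (g : B → A) xs → ∑ℕ f (map g xs) ≡ ∑ℕ (λ x → f (g x)) xs
  ∑ℕ-map f g []       = refl
  ∑ℕ-map f g (x ∷ xs) = cong (f (g x) +_) (∑ℕ-map f g xs)

  ∑ℕ-box : ∀ d N (f : Position d → ℕ) → ∑ℕ f (box d N) ≡ ∑Within d N f
  ∑ℕ-box zero    N f = +-identityʳ (f [])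
  ∑ℕ-box (suc d) N f = go N
    where
    go : ∀ M → ∑ℕ f (cartesianProductWith _∷_ (downFrom M) (box d N)) ≡ ∑< M (λ i → ∑Within d N (λ is → f (i ∷ is)))
    go zero    = refl
    go (suc M) = begin
      ∑ℕ f (map (M ∷_) (box d N) ++ rest)              ≡⟨ ∑ℕ-++ f (map (M ∷_) (box d N)) rest ⟩
      ∑ℕ f (map (M ∷_) (box d N)) + ∑ℕ f rest        ≡⟨ cong₂ _+_ (trans (∑ℕ-map f (M ∷_) (box d N)) (∑ℕ-box d N (λ is → f (M ∷ is)))) (go M) ⟩
      ∑Within d N (λ is → f (M ∷ is)) + ∑< M _       ≡⟨ +-comm (∑Within d N (λ is → f (M ∷ is))) _ ⟩
      ∑< M _ + ∑Within d N (λ is → f (M ∷ is))       ∎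
      where
      open ≡-Reasoning
      rest = cartesianProductWith _∷_ (downFrom M) (box d N)

  map-≡⇒≡ : ∀ {A B : Set} {f g : A → B} {xs x} → map f xs ≡ map g xs → x ∈ xs → f x ≡ g x
  map-≡⇒≡ {f = f} {g} {y ∷ xs} eq (here refl) = ∷-injectiveˡ eq
  map-≡⇒≡ {f = f} {g} {y ∷ xs} eq (there x∈) = map-≡⇒≡ (∷-injectiveʳ eq) x∈

  volume-∑Within : ∀ {d n} (π : PartitionOf d n) → ∑Within d n (entry (proj₁ π)) ≡ n
  volume-∑Within {d} {n} π@(ρ , vol) = trans (∑Within-unique d n (size ρ) (support-volume π) (support ρ)) vol

  1≤height : ∀ {d} → 1 ≤ d → (i : Position d) → 1 ≤ height i
  1≤height _ (i ∷ is) = s≤s z≤n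

  𝗉≤weighted : ∀ d n → 1 ≤ d → 𝗉 d n ≤ length (weighted height (box d n) (d * n))
  𝗉≤weighted d n 1≤d = unique⇒length≤ (partitionSetoid d n) (partitions-unique d n) code code-∈ code-injective
    where
    code : PartitionOf d n → List ℕ
    code π = map (drop (entry (proj₁ π))) (box d n)
    code-∈ : ∀ π → code π ∈ weighted height (box d n) (d * n)
    code-∈ π = weighted-∈ height (box d n) (d * n) (drop f) (1≤height 1≤d) (begin
      ∑ℕ (λ i → drop f i * height i) (box d n)      ≡⟨ ∑ℕ-box d n (λ i → drop f i * height i) ⟩
      ∑Within d n (λ i → drop f i * height i)       ≤⟨ drop-sum≤ d n f (antitone (proj₁ π)) (support-volume π) ⟩
      d * ∑Within d n f                             ≡⟨ cong (d *_) (volume-∑Within π) ⟩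
      d * n                                         ∎)
      where
      open ≤-Reasoning
      f = entry (proj₁ π)
    code-injective : ∀ π ρ → code π ≡ code ρ → π ≈ ρ
    code-injective π ρ eq = drop-determines (antitone (proj₁ π)) (antitone (proj₁ ρ))
      (support-volume π) (support-volume ρ) (λ i w → map-≡⇒≡ eq (∈-box w))

  -- A discrete mean value bound: the derivative of x^(k+1) is taken at the right end of [x, x+1]
  -- here and at the left end in `≤suc^`. The first serves to count cells, the second to bound
  -- volumes.
  suc^≤ : ∀ x k → suc x ^ suc k ≤ x ^ suc k + suc k * suc x ^ k
  suc^≤ x zero    = ≤-reflexive (solve 1 (λ x → (con 1 :+ x) :* con 1 := x :* con 1 :+ con 1 :* con 1) refl x)
  suc^≤ x (suc k) = begin
    y * (y * y ^ k)                                       ≤⟨ +-monoʳ-≤ (y * y ^ k) (*-monoʳ-≤ x (suc^≤ x k)) ⟩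
    y * y ^ k + x * (x ^ suc k + suc k * y ^ k)           ≤⟨ +-monoʳ-≤ (y * y ^ k) (≤-trans (≤-reflexive (*-distribˡ-+ x (x ^ suc k) (suc k * y ^ k)))
                                                               (+-monoʳ-≤ (x * x ^ suc k) (*-monoˡ-≤ (suc k * y ^ k) (n≤1+n x)))) ⟩
    y * y ^ k + (x * x ^ suc k + y * (suc k * y ^ k))
      ≡⟨ solve 4 (λ y p q k → y :* p :+ (q :+ y :* (k :* p)) := q :+ (con 1 :+ k) :* (y :* p)) refl y (y ^ k) (x * x ^ suc k) (suc k) ⟩
    x * x ^ suc k + suc (suc k) * (y * y ^ k)             ∎
    where
    open ≤-Reasoning
    y = suc x

  ≤suc^ : ∀ x k → x ^ suc k + suc k * x ^ k ≤ suc x ^ suc k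
  ≤suc^ x zero    = ≤-reflexive (solve 1 (λ x → x :* con 1 :+ con 1 :* con 1 := (con 1 :+ x) :* con 1) refl x)
  ≤suc^ x (suc k) = begin
    x * (x * x ^ k) + suc (suc k) * (x * x ^ k)
      ≡⟨ solve 3 (λ x p k → x :* (x :* p) :+ (con 1 :+ k) :* (x :* p) := x :* (x :* p :+ k :* p) :+ x :* p) refl x (x ^ k) (suc k) ⟩
    x * (x * x ^ k + suc k * x ^ k) + x * x ^ k   ≤⟨ +-mono-≤ (*-monoʳ-≤ x (≤suc^ x k)) (≤-trans (m≤m+n (x * x ^ k) (suc k * x ^ k)) (≤suc^ x k)) ⟩
    x * suc x ^ suc k + suc x ^ suc k             ≡⟨ +-comm (x * suc x ^ suc k) (suc x ^ suc k) ⟩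
    suc x * suc x ^ suc k                         ∎
    where open ≤-Reasoning

  -- Levels, cells and their fillings.

  level : ∀ {d} → Position d → ℕ
  level []       = 0
  level (i ∷ is) = i + level is

  level-mono : ∀ {d} {i j : Position d} → i ≼ j → level i ≤ level j
  level-mono Pointwise.[]             = z≤n
  level-mono (i≤j Pointwise.∷ is≼js) = +-mono-≤ i≤j (level-mono is≼js)

  level-strict : ∀ {d} {i j : Position d} → i ≼ j → i ≡ j ⊎ level i < level j
  level-strict Pointwise.[]            = inj₁ refl
  level-strict (i≤j Pointwise.∷ is≼js) with m≤n⇒m<n∨m≡n i≤j | level-strict is≼js
  ... | inj₁ i<j  | _          = inj₂ (+-mono-<-≤ i<j (level-mono is≼js))
  ... | inj₂ refl | inj₁ refl  = inj₁ refl
  ... | inj₂ refl | inj₂ is<js = inj₂ (+-monoʳ-< _ is<js)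

  within-level : ∀ {d N} (i : Position d) → level i < N → Within N i
  within-level []       _ = Vec.[]
  within-level {N = N} (i ∷ is) h = ≤-<-trans (m≤m+n i (level is)) h Vec.∷ within-level is (≤-<-trans (m≤n+m (level is) i) h)

  -- The cells ⌊i/2⌋ partition ℕᵈ into cubes, whose 2ᵈ corners are numbered by the
  -- parities of the coordinates.

  odd : ℕ → Fin 2
  odd zero          = zero
  odd (suc zero)    = suc zero
  odd (suc (suc n)) = odd n

  cell : ∀ {d} → Position d → Position d
  cell []       = []
  cell (i ∷ is) = ⌊ i /2⌋ ∷ cell is

  corner : ∀ {d} → Position d → Fin (2 ^ d)
  corner []           = zero
  corner {suc d} (i ∷ is) = combine {2} {2 ^ d} (odd i) (corner is)

  -- The inverse of the pair (`cell`, `corner`).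
  place : ∀ {d} → Position d → Fin (2 ^ d) → Position d
  place []           c = []
  place {suc d} (x ∷ xs) c = toℕ (quotient {2} (2 ^ d) c) + x * 2 ∷ place xs (remainder {2} (2 ^ d) c)

  half-place : ∀ (b : Fin 2) x → ⌊ toℕ b + x * 2 /2⌋ ≡ x
  half-place zero       zero    = refl
  half-place zero       (suc x) = cong suc (half-place zero x)
  half-place (suc zero) zero    = refl
  half-place (suc zero) (suc x) = cong suc (half-place (suc zero) x)

  odd-place : ∀ (b : Fin 2) x → odd (toℕ b + x * 2) ≡ b
  odd-place zero       zero    = refl
  odd-place zero       (suc x) = odd-place zero x
  odd-place (suc zero) zero    = refl
  odd-place (suc zero) (suc x) = odd-place (suc zero) x

  cell-place : ∀ {d} (x : Position d) c → cell (place x c) ≡ x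
  cell-place []       c = refl
  cell-place {suc d} (x ∷ xs) c = cong₂ _∷_ (half-place (quotient {2} (2 ^ d) c) x) (cell-place xs (remainder {2} (2 ^ d) c))

  corner-place : ∀ {d} (x : Position d) c → corner (place x c) ≡ c
  corner-place {zero}  []       zero = refl
  corner-place {suc d} (x ∷ xs) c = trans
    (cong₂ (combine {2} {2 ^ d}) (odd-place (quotient {2} (2 ^ d) c) x) (corner-place xs (remainder {2} (2 ^ d) c)))
    (Fin.combine-remQuot {2} (2 ^ d) c)

  -- Each coordinate exceeds twice its half by at most 1. This fixes the height 2r + d of the
  -- staircase that carries the cells of level at most r.
  level-cell : ∀ {d} (i : Position d) → level i ≤ 2 * level (cell i) + d
  level-cell []       = z≤n
  level-cell {suc d} (i ∷ is) = begin
    i + level is                                       ≤⟨ +-mono-≤ (≤half i) (level-cell is) ⟩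
    (2 * ⌊ i /2⌋ + 1) + (2 * level (cell is) + d)
      ≡⟨ solve 3 (λ x y d → (con 2 :* x :+ con 1) :+ (con 2 :* y :+ d) := con 2 :* (x :+ y) :+ (con 1 :+ d)) refl ⌊ i /2⌋ (level (cell is)) d ⟩
    2 * (⌊ i /2⌋ + level (cell is)) + suc d            ∎
    where
    open ≤-Reasoning
    ≤half : ∀ i → i ≤ 2 * ⌊ i /2⌋ + 1
    ≤half zero          = z≤n
    ≤half (suc zero)    = s≤s z≤n
    ≤half (suc (suc i)) = ≤-trans (s≤s (s≤s (≤half i)))
      (≤-reflexive (solve 1 (λ x → con 2 :+ (con 2 :* x :+ con 1) := con 2 :* (con 1 :+ x) :+ con 1) refl ⌊ i /2⌋))

  cell-level : ∀ {d} (i : Position d) → level (cell i) ≤ level i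
  cell-level []       = z≤n
  cell-level (i ∷ is) = +-mono-≤ (⌊n/2⌋≤n i) (cell-level is)

  -- The indicator of the top corner of a cell: 1 exactly when all coordinates are odd.
  top : ∀ {d} → Position d → ℕ
  top []       = 1
  top (i ∷ is) = toℕ (odd i) * top is

  odd≤1 : ∀ i → toℕ (odd i) ≤ 1
  odd≤1 i = s≤s⁻¹ (Fin.toℕ<n (odd i))

  top≤1 : ∀ {d} (i : Position d) → top i ≤ 1
  top≤1 []       = ≤-refl
  top≤1 (i ∷ is) = *-mono-≤ (odd≤1 i) (top≤1 is)

  top-place : ∀ {d} (x : Position d) → ∃[ c ] top (place x c) ≡ 1
  top-place []       = zero , refl
  top-place {suc d} (x ∷ xs) with top-place xs
  ... | c , eq = combine {2} {2 ^ d} (suc zero) c ,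
    trans (cong (λ (b , c) → toℕ (odd (toℕ b + x * 2)) * top (place xs c)) (Fin.remQuot-combine {2} {2 ^ d} (suc zero) c))
      (trans (cong₂ (λ b t → toℕ b * t) (odd-place (suc zero) x) eq) refl)

  -- A coordinate that changes its half grows by at least 1, and by at least 2 if it ends odd, since
  -- the even number of the same pair lies between. At a top corner all coordinates are odd, so a
  -- position below it in another cell is at least two levels lower: there the staircase absorbs the
  -- raise by 2.
  leave-cell : ∀ {d} {i j : Position d} → i ≼ j → cell i ≡ cell j ⊎ top j + suc (level i) ≤ level j
  leave-cell Pointwise.[] = inj₁ refl
  leave-cell {i = i ∷ is} {j ∷ js} (i≤j Pointwise.∷ is≼js) with halves i j i≤j | leave-cell is≼js
    where
    halves : ∀ i j → i ≤ j → ⌊ i /2⌋ ≡ ⌊ j /2⌋ ⊎ toℕ (odd j) + suc i ≤ j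
    halves zero          zero          _ = inj₁ refl
    halves zero          (suc zero)    _ = inj₁ refl
    halves zero          (suc (suc j)) _ = inj₂ (odd-step j)
      where
      odd-step : ∀ j → toℕ (odd j) + 1 ≤ suc (suc j)
      odd-step j = ≤-trans (+-monoˡ-≤ 1 (odd≤1 j)) (s≤s (s≤s z≤n))
    halves (suc zero)    (suc zero)    _ = inj₁ refl
    halves (suc zero)    (suc (suc j)) _ = inj₂ (odd-step j)
      where
      odd-step : ∀ j → toℕ (odd j) + 2 ≤ suc (suc j)
      odd-step j = ≤-trans (≤-reflexive (+-comm (toℕ (odd j)) 2)) (s≤s (s≤s (odd≤ j)))
        where
        odd≤ : ∀ j → toℕ (odd j) ≤ j
        odd≤ zero          = z≤n
        odd≤ (suc zero)    = ≤-refl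
        odd≤ (suc (suc j)) = ≤-trans (odd≤ j) (m≤n⇒m≤1+n (n≤1+n j))
    halves (suc (suc i)) (suc zero)    (s≤s ())
    halves (suc (suc i)) (suc (suc j)) i≤j with halves i j (s≤s⁻¹ (s≤s⁻¹ i≤j))
    ... | inj₁ eq = inj₁ (cong suc eq)
    ... | inj₂ le = inj₂ (≤-trans (≤-reflexive (trans (+-suc o (suc (suc i))) (cong suc (+-suc o (suc i))))) (s≤s (s≤s le)))
      where o = toℕ (odd j)
  ... | inj₁ eq | inj₁ eqs = inj₁ (cong₂ _∷_ eq eqs)
  ... | inj₂ le | _        = inj₂ (begin
    o * top js + suc (i + level is)   ≤⟨ +-mono-≤ (*-monoʳ-≤ o (top≤1 js)) (s≤s (+-monoʳ-≤ i (level-mono is≼js))) ⟩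
    o * 1 + suc (i + level js)        ≡⟨ solve 3 (λ o i l → o :* con 1 :+ (con 1 :+ (i :+ l)) := o :+ (con 1 :+ i) :+ l) refl o i (level js) ⟩
    o + suc i + level js              ≤⟨ +-monoˡ-≤ (level js) le ⟩
    j + level js                      ∎)
    where
    open ≤-Reasoning
    o = toℕ (odd j)
  ... | inj₁ _  | inj₂ le  = inj₂ (begin
    o * top js + suc (i + level is)   ≤⟨ +-mono-≤ (*-monoˡ-≤ (top js) (odd≤1 j)) (s≤s (+-monoˡ-≤ (level is) i≤j)) ⟩
    1 * top js + suc (j + level is)   ≡⟨ solve 3 (λ t j l → con 1 :* t :+ (con 1 :+ (j :+ l)) := j :+ (t :+ (con 1 :+ l))) refl (top js) j (level is) ⟩
    j + (top js + suc (level is))     ≤⟨ +-monoʳ-≤ j le ⟩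
    j + level js                      ∎)
    where
    open ≤-Reasoning
    o = toℕ (odd j)

  -- A filling of a cell either raises its corners independently by 0 or 1, or
  -- raises the top corner by 2 and all others by 1.

  Filling : ℕ → Set
  Filling d = Fin (suc (2 ^ (2 ^ d)))

  raise : ∀ d → Filling d → Position d → ℕ
  raise d zero    i = suc (top i)
  raise d (suc e) i = toℕ (finToFun {2} {2 ^ d} e (corner i))

  raise≤2 : ∀ d z i → raise d z i ≤ 2
  raise≤2 d zero    i = s≤s (top≤1 i)
  raise≤2 d (suc e) i = <⇒≤ (Fin.toℕ<n (finToFun {2} {2 ^ d} e (corner i)))

  funToFin-cong : ∀ {m n} {f g : Fin m → Fin n} → (∀ i → f i ≡ g i) → funToFin f ≡ funToFin g
  funToFin-cong {zero}  h = refl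
  funToFin-cong {suc m} h = cong₂ combine (h zero) (funToFin-cong (h ∘ suc))

  finToFun-injective : ∀ {m n} (e f : Fin (m ^ n)) → (∀ i → finToFun {m} {n} e i ≡ finToFun f i) → e ≡ f
  finToFun-injective {m} {n} e f h = begin
    e                              ≡⟨ Fin.funToFin-finToFin {n} {m} e ⟨
    funToFin (finToFun {m} {n} e)  ≡⟨ funToFin-cong h ⟩
    funToFin (finToFun {m} {n} f)  ≡⟨ Fin.funToFin-finToFin {n} {m} f ⟩
    f                              ∎
    where open ≡-Reasoning

  -- The extra filling has the value 2 at the top corner, which no 0/1 filling attains; two 0/1
  -- fillings are compared corner by corner through `place`.
  raise-injective : ∀ d (z z′ : Filling d) x → (∀ i → cell i ≡ x → raise d z i ≡ raise d z′ i) → z ≡ z′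
  raise-injective d zero zero x h = refl
  raise-injective d zero (suc e) x h = let c , t = top-place x in
    contradiction (≤-trans (≤-reflexive (trans (cong suc (sym t)) (h (place x c) (cell-place x c))))
      (s≤s⁻¹ (Fin.toℕ<n (finToFun {2} {2 ^ d} e (corner (place x c)))))) (<-irrefl refl)
  raise-injective d (suc e) zero x h = let c , t = top-place x in
    contradiction (≤-trans (≤-reflexive (trans (cong suc (sym t)) (sym (h (place x c) (cell-place x c)))))
      (s≤s⁻¹ (Fin.toℕ<n (finToFun {2} {2 ^ d} e (corner (place x c)))))) (<-irrefl refl)
  raise-injective d (suc e) (suc f) x h = cong suc (finToFun-injective {2} {2 ^ d} e f λ c → Fin.toℕ-injective
    (subst (λ c → toℕ (finToFun {2} {2 ^ d} e c) ≡ toℕ (finToFun {2} {2 ^ d} f c)) (corner-place x c) (h (place x c) (cell-place x c))))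

  -- T d L = C(L+d, d+1).

  T : ℕ → ℕ → ℕ
  T zero    L       = L
  T (suc d) zero    = 0
  T (suc d) (suc L) = T d (suc L) + T (suc d) L

  ∑<-head : ∀ N (g : ℕ → ℕ) → ∑< (suc N) g ≡ g 0 + ∑< N (g ∘ suc)
  ∑<-head zero    g = sym (+-identityʳ (g 0))
  ∑<-head (suc N) g = trans (cong (_+ g (suc N)) (∑<-head N g)) (+-assoc (g 0) (∑< N (g ∘ suc)) (g (suc N)))

  -- The hockey-stick identity, as an inequality because the sum may stop before L - i reaches 0.
  -- Applied to one coordinate at a time, it evaluates the volume of a staircase.
  ∑<-T : ∀ d N L → ∑< N (λ i → T d (L ∸ i)) ≤ T (suc d) L
  ∑<-T d zero    L       = z≤n
  ∑<-T d (suc N) zero    = ≤-reflexive (∑<-zero′ (suc N))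
    where
    T-zero : ∀ d → T d 0 ≡ 0
    T-zero zero    = refl
    T-zero (suc d) = refl
    ∑<-zero′ : ∀ N → ∑< N (λ i → T d (0 ∸ i)) ≡ 0
    ∑<-zero′ zero    = refl
    ∑<-zero′ (suc N) = cong₂ _+_ (∑<-zero′ N) (trans (cong (T d) (0∸n≡0 N)) (T-zero d))
  ∑<-T d (suc N) (suc L) = ≤-trans (≤-reflexive (∑<-head N (λ i → T d (suc L ∸ i)))) (+-monoʳ-≤ (T d (suc L)) (∑<-T d N L))

  ∑Within-T : ∀ d N L → ∑Within d N (λ i → L ∸ level i) ≤ T d L
  ∑Within-T zero    N L = ≤-refl
  ∑Within-T (suc d) N L = ≤-trans (∑<-mono N λ i → ≤-trans
      (≤-reflexive (∑Within-cong d N (λ is _ → sym (∸-+-assoc L i (level is))))) (∑Within-T d N (L ∸ i)))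
    (∑<-T d N L)

  -- The left side is the rising product L (L+1) ⋯ (L+d). The induction follows Pascal's rule and
  -- closes with `≤suc^`.
  T≤ : ∀ d L → suc d ! * T d L ≤ (L + d) ^ suc d
  T≤ zero    L       = ≤-reflexive (solve 1 (λ L → con 1 :* L := (L :+ con 0) :* con 1) refl L)
  T≤ (suc d) zero    = ≤-trans (≤-reflexive (*-zeroʳ (suc (suc d) !))) z≤n
  T≤ (suc d) (suc L) = begin
    suc (suc d) ! * (T d (suc L) + T (suc d) L)
      ≡⟨ *-distribˡ-+ (suc (suc d) !) (T d (suc L)) (T (suc d) L) ⟩
    suc (suc d) * suc d ! * T d (suc L) + suc (suc d) ! * T (suc d) L
      ≡⟨ cong (_+ suc (suc d) ! * T (suc d) L) (*-assoc (suc (suc d)) (suc d !) (T d (suc L))) ⟩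
    suc (suc d) * (suc d ! * T d (suc L)) + suc (suc d) ! * T (suc d) L
      ≤⟨ +-mono-≤ (*-monoʳ-≤ (suc (suc d)) (T≤ d (suc L))) (T≤ (suc d) L) ⟩
    suc (suc d) * (suc L + d) ^ suc d + (L + suc d) ^ suc (suc d)
      ≡⟨ cong (λ x → suc (suc d) * x ^ suc d + (L + suc d) ^ suc (suc d)) (sym (+-suc L d)) ⟩
    suc (suc d) * (L + suc d) ^ suc d + (L + suc d) ^ suc (suc d)
      ≡⟨ +-comm (suc (suc d) * (L + suc d) ^ suc d) ((L + suc d) ^ suc (suc d)) ⟩
    (L + suc d) ^ suc (suc d) + suc (suc d) * (L + suc d) ^ suc d
      ≤⟨ ≤suc^ (L + suc d) (suc d) ⟩
    (suc L + suc d) ^ suc (suc d) ∎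
    where open ≤-Reasoning

  -- Composed with `level` this is the padding: only the origin has level 0.
  atZero : ℕ → ℕ → ℕ
  atZero c zero    = c
  atZero c (suc _) = 0

  atZero-antitone : ∀ c {a b} → a ≤ b → atZero c b ≤ atZero c a
  atZero-antitone c {b = zero}  z≤n = ≤-refl
  atZero-antitone c {b = suc _} _   = z≤n

  ∑Within-atZero : ∀ d N c → ∑Within d (suc N) (λ i → atZero c (level i)) ≡ c
  ∑Within-atZero zero    N c = refl
  ∑Within-atZero (suc d) N c = begin
    ∑< (suc N) (λ i → ∑Within d (suc N) (λ is → atZero c (i + level is)))
      ≡⟨ ∑<-head N (λ i → ∑Within d (suc N) (λ is → atZero c (i + level is))) ⟩
    ∑Within d (suc N) (λ is → atZero c (level is)) + ∑< N (λ i → ∑Within d (suc N) (λ is → 0))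
      ≡⟨ cong₂ _+_ (∑Within-atZero d N c) (trans (∑<-cong N (λ i _ → ∑Within-zero d (suc N) (λ _ → refl))) (zeros N)) ⟩
    c + 0
      ≡⟨ +-identityʳ c ⟩
    c ∎
    where
    open ≡-Reasoning
    zeros : ∀ N → ∑< N (λ i → 0) ≡ 0
    zeros zero    = refl
    zeros (suc N) = trans (+-identityʳ (∑< N (λ i → 0))) (zeros N)

  -- The raised staircase is a partition.

  module Staircase (d r : ℕ) where

    -- By `level-cell`, every corner of a cell of level at most r has level at most m, so at raised
    -- positions `m ∸ level i` is a true difference.
    m = 2 * r + d

    module _ (D : Position d → Maybe (Filling d)) (bounded : ∀ x {z} → D x ≡ just z → level x ≤ r) where

      raised : Position d → ℕ
      raised i = maybe (λ z → raise d z i) 0 (D (cell i))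

      stair : Position d → ℕ
      stair i = (m ∸ level i) + raised i

      level≤m : ∀ i {z} → D (cell i) ≡ just z → level i ≤ m
      level≤m i eq = ≤-trans (level-cell i) (+-monoˡ-≤ d (*-monoʳ-≤ 2 (bounded (cell i) eq)))

      -- This is raised j - raised i ≤ level j - level i without subtraction. Within one cell the
      -- right side is at least 1: a 0/1 raise of j is at most 1, and under the extra filling j has
      -- at most 2 and i at least 1. Across cells `leave-cell` applies, the extra raise at j being 1
      -- + `top j`.
      slope : ∀ {i j z} → i ≼ j → D (cell j) ≡ just z → raised j + level i ≤ raised i + level j
      slope {i} {j} {z} i≼j eq with level-strict i≼j
      ... | inj₁ refl = ≤-refl
      ... | inj₂ i<j with leave-cell i≼j
      slope {i} {j} {z} i≼j eq | inj₂ i<j | inj₁ same rewrite same | eq = go z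
        where
        go : ∀ z → raise d z j + level i ≤ raise d z i + level j
        go (suc e) = ≤-trans (+-monoˡ-≤ (level i) (s≤s⁻¹ (Fin.toℕ<n (finToFun {2} {2 ^ d} e (corner j)))))
          (≤-trans i<j (m≤n+m (level j) (raise d (suc e) i)))
        go zero = s≤s (≤-trans (+-monoˡ-≤ (level i) (top≤1 j)) (≤-trans i<j (m≤n+m (level j) (top i))))
      slope {i} {j} {z} i≼j eq | inj₂ i<j | inj₂ far rewrite eq = ≤-trans (go z) (m≤n+m (level j) (raised i))
        where
        go : ∀ z → raise d z j + level i ≤ level j
        go (suc e) = ≤-trans (+-monoˡ-≤ (level i) (s≤s⁻¹ (Fin.toℕ<n (finToFun {2} {2 ^ d} e (corner j))))) i<j
        go zero = ≤-trans (≤-reflexive (sym (+-suc (top j) (level i)))) far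

      stair-antitone : ∀ {i j} → i ≼ j → stair j ≤ stair i
      stair-antitone {i} {j} i≼j = cases (D (cell j)) refl
        where
        cases : ∀ y → D (cell j) ≡ y → stair j ≤ stair i
        cases nothing eq = begin
          (m ∸ level j) + raised j    ≡⟨ cong (λ y → (m ∸ level j) + maybe (λ z → raise d z j) 0 y) eq ⟩
          (m ∸ level j) + 0           ≤⟨ +-mono-≤ (∸-monoʳ-≤ m (level-mono i≼j)) z≤n ⟩
          (m ∸ level i) + raised i    ∎
          where open ≤-Reasoning
        cases (just z) eq = +-cancelʳ-≤ (level i + level j) _ _ (begin
          (m ∸ level j) + raised j + (level i + level j)
            ≡⟨ solve 4 (λ a b c d → a :+ b :+ (c :+ d) := (a :+ d) :+ (b :+ c)) refl (m ∸ level j) (raised j) (level i) (level j) ⟩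
          ((m ∸ level j) + level j) + (raised j + level i)
            ≡⟨ cong (_+ (raised j + level i)) (trans (m∸n+n≡m j≤m) (sym (m∸n+n≡m i≤m))) ⟩
          ((m ∸ level i) + level i) + (raised j + level i)
            ≤⟨ +-monoʳ-≤ ((m ∸ level i) + level i) (slope i≼j eq) ⟩
          ((m ∸ level i) + level i) + (raised i + level j)
            ≡⟨ solve 4 (λ a b c d → (a :+ c) :+ (b :+ d) := a :+ b :+ (c :+ d)) refl (m ∸ level i) (raised i) (level i) (level j) ⟩
          (m ∸ level i) + raised i + (level i + level j) ∎)
          where
          open ≤-Reasoning
          j≤m = level≤m j eq
          i≤m = ≤-trans (level-mono i≼j) j≤m

      stair≤ : ∀ i → stair i ≤ (m + 2) ∸ level i
      stair≤ i = cases (D (cell i)) refl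
        where
        open ≤-Reasoning
        cases : ∀ y → D (cell i) ≡ y → stair i ≤ (m + 2) ∸ level i
        cases nothing eq = begin
          (m ∸ level i) + raised i    ≡⟨ cong (λ y → (m ∸ level i) + maybe (λ z → raise d z i) 0 y) eq ⟩
          (m ∸ level i) + 0           ≡⟨ +-identityʳ (m ∸ level i) ⟩
          m ∸ level i                 ≤⟨ ∸-monoˡ-≤ (level i) (m≤m+n m 2) ⟩
          (m + 2) ∸ level i           ∎
        cases (just z) eq = begin
          (m ∸ level i) + raised i    ≡⟨ cong (λ y → (m ∸ level i) + maybe (λ z → raise d z i) 0 y) eq ⟩
          (m ∸ level i) + raise d z i   ≤⟨ +-monoʳ-≤ (m ∸ level i) (raise≤2 d z i) ⟩
          (m ∸ level i) + 2           ≡⟨ +-∸-comm 2 (level≤m i eq) ⟨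
          (m + 2) ∸ level i           ∎

      stair-support : ∀ i → m < level i → stair i ≡ 0
      stair-support i m<i = cases (D (cell i)) refl
        where
        cases : ∀ y → D (cell i) ≡ y → stair i ≡ 0
        cases nothing  eq = trans (cong (λ y → (m ∸ level i) + maybe (λ z → raise d z i) 0 y) eq)
          (trans (+-identityʳ (m ∸ level i)) (m≤n⇒m∸n≡0 (<⇒≤ m<i)))
        cases (just z) eq = contradiction (level≤m i eq) (<⇒≱ m<i)

      base : ℕ
      base = ∑Within d (suc m) stair

      -- Raises are at most 2 and occur only where the level is at most m, so the array lies under
      -- the staircase of height m + 2; its volume is bounded by `T d (m + 2)`.
      base≤ : suc d ! * base ≤ (2 * r + 2 * d + 2) ^ suc d
      base≤ = begin
        suc d ! * base                ≤⟨ *-monoʳ-≤ (suc d !) (≤-trans (∑Within-mono d (suc m) stair≤) (∑Within-T d (suc m) (m + 2))) ⟩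
        suc d ! * T d (m + 2)         ≤⟨ T≤ d (m + 2) ⟩
        (m + 2 + d) ^ suc d           ≡⟨ cong (_^ suc d) (solve 2 (λ r d → con 2 :* r :+ d :+ con 2 :+ d := con 2 :* r :+ con 2 :* d :+ con 2) refl r d) ⟩
        (2 * r + 2 * d + 2) ^ suc d   ∎
        where open ≤-Reasoning

      padded : ℕ → Partition d
      padded c = record
        { entry    = λ i → atZero c (level i) + stair i
        ; antitone = λ i≼j → +-mono-≤ (atZero-antitone c (level-mono i≼j)) (stair-antitone i≼j)
        ; size     = suc m
        ; support  = supported
        }
        where
        supported : ∀ i → atZero c (level i) + stair i ≢ 0 → Within (suc m) i
        supported i ≢0 with level i ≤? m
        ... | yes i≤m = within-level i (s≤s i≤m)
        ... | no  i≰m = contradiction (cong₂ _+_ (beyond (level i) (≰⇒> i≰m)) (stair-support i (≰⇒> i≰m))) ≢0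
          where
          beyond : ∀ l → m < l → atZero c l ≡ 0
          beyond (suc l) _ = refl

      padded-volume : ∀ n → base ≤ n → volume (padded (n ∸ base)) ≡ n
      padded-volume n base≤n = begin
        ∑Within d (suc m) (λ i → atZero c (level i) + stair i)
          ≡⟨ ∑Within-+ d (suc m) (λ i → atZero c (level i)) stair ⟩
        ∑Within d (suc m) (λ i → atZero c (level i)) + base
          ≡⟨ cong (_+ base) (∑Within-atZero d m c) ⟩
        (n ∸ base) + base
          ≡⟨ m∸n+n≡m base≤n ⟩
        n ∎
        where
        open ≡-Reasoning
        c = n ∸ base

  -- The simplex of cells and the family of partitions.

  grow : ∀ {d} → Position (suc d) → Position (suc d)
  grow (x ∷ xs) = suc x ∷ xs

  -- The C(r+d, d) positions of level at most r.

  simplex : ∀ d → ℕ → List (Position d)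
  simplex zero    r       = [] ∷ []
  simplex (suc d) zero    = map (0 ∷_) (simplex d zero)
  simplex (suc d) (suc r) = map (0 ∷_) (simplex d (suc r)) ++ map grow (simplex (suc d) r)

  simplex-level : ∀ d r → All (λ x → level x ≤ r) (simplex d r)
  simplex-level zero    r       = z≤n ∷ []
  simplex-level (suc d) zero    = All.map⁺ (simplex-level d zero)
  simplex-level (suc d) (suc r) = All.++⁺ (All.map⁺ (simplex-level d (suc r)))
    (All.map⁺ (All.map (λ { {x ∷ xs} h → s≤s h }) (simplex-level (suc d) r)))

  origin : ∀ d → Position d
  origin zero    = []
  origin (suc d) = 0 ∷ origin d

  origin-∈ : ∀ d r → origin d ∈ simplex d r
  origin-∈ zero    r       = here refl
  origin-∈ (suc d) zero    = ∈-map⁺ (0 ∷_) (origin-∈ d zero)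
  origin-∈ (suc d) (suc r) = ∈-++⁺ˡ (∈-map⁺ (0 ∷_) (origin-∈ d (suc r)))

  level≡0⇒origin : ∀ {d} (x : Position d) → level x ≡ 0 → x ≡ origin d
  level≡0⇒origin []          eq = refl
  level≡0⇒origin (zero ∷ xs) eq = cong (0 ∷_) (level≡0⇒origin xs eq)

  simplex-unique : ∀ d r → Unique (setoid (Position d)) (simplex d r)
  simplex-unique zero    r       = [] ∷ []
  simplex-unique (suc d) zero    = Unique.map⁺ (setoid _) (setoid _) Vec.∷-injectiveʳ (simplex-unique d zero)
  simplex-unique (suc d) (suc r) = Unique.++⁺ (setoid _)
    (Unique.map⁺ (setoid _) (setoid _) Vec.∷-injectiveʳ (simplex-unique d (suc r)))
    (Unique.map⁺ (setoid _) (setoid _) grow-injective (simplex-unique (suc d) r))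
    disjoint
    where
    grow-injective : ∀ {x y : Position (suc d)} → grow x ≡ grow y → x ≡ y
    grow-injective {x ∷ xs} {y ∷ ys} refl = refl
    disjoint : ∀ {v} → ¬ (v ∈ map (0 ∷_) (simplex d (suc r)) × v ∈ map grow (simplex (suc d) r))
    disjoint (v∈ , v∈′) with ∈-map⁻ (0 ∷_) v∈ | ∈-map⁻ grow v∈′
    ... | xs , _ , refl | (y ∷ ys) , _ , ()

  mutual

    simplex-length : ∀ d r → r ^ d ≤ d ! * length (simplex d r)
    simplex-length zero    r = ≤-refl
    simplex-length (suc d) r = ≤-trans (m≤m+n (r ^ suc d) (suc d !)) (simplex-length+ d r)

    -- The summand (d+1)! means one cell beyond r^(d+1)/(d+1)!. It is present at r = 0, where there
    -- is one cell, and `suc^≤` carries it along; it will pay for the cell at the origin.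
    simplex-length+ : ∀ d r → r ^ suc d + suc d ! ≤ suc d ! * length (simplex (suc d) r)
    simplex-length+ d zero    = ≤-reflexive (sym (trans (cong (suc d ! *_) (single (suc d))) (*-identityʳ (suc d !))))
      where
      single : ∀ d → length (simplex d 0) ≡ 1
      single zero    = refl
      single (suc d) = trans (length-map (0 ∷_) (simplex d 0)) (single d)
    simplex-length+ d (suc r) = begin
      suc r ^ suc d + suc d !
        ≤⟨ +-monoˡ-≤ (suc d !) (suc^≤ r d) ⟩
      r ^ suc d + suc d * suc r ^ d + suc d !
        ≤⟨ +-monoˡ-≤ (suc d !) (+-monoʳ-≤ (r ^ suc d) (*-monoʳ-≤ (suc d) (simplex-length d (suc r)))) ⟩
      r ^ suc d + suc d * (d ! * a) + suc d !
        ≡⟨ solve 5 (λ p k f a g → p :+ k :* (f :* a) :+ g := k :* f :* a :+ (p :+ g)) refl (r ^ suc d) (suc d) (d !) a (suc d !) ⟩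
      suc d ! * a + (r ^ suc d + suc d !)
        ≤⟨ +-monoʳ-≤ (suc d ! * a) (simplex-length+ d r) ⟩
      suc d ! * a + suc d ! * b
        ≡⟨ *-distribˡ-+ (suc d !) a b ⟨
      suc d ! * (a + b)
        ≡⟨ cong (suc d ! *_) (trans (length-++ xs) (cong₂ _+_ (length-map (0 ∷_) (simplex d (suc r))) (length-map grow (simplex (suc d) r)))) ⟨
      suc d ! * length (simplex (suc d) (suc r)) ∎
      where
      open ≤-Reasoning
      xs = map (0 ∷_) (simplex d (suc r))
      a = length (simplex d (suc r))
      b = length (simplex (suc d) r)

  module Family (d r n : ℕ) (fits : (2 * r + 2 * d + 2) ^ suc d ≤ suc d ! * n) where
    open Staircase d r

    private
      X : List (Position d)
      X = simplex d r
      K : ℕ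
      K = suc (2 ^ (2 ^ d))
      import Data.List.Membership.DecPropositional (Vec.≡-dec {n = d} _≟_) as Dec

    filling : Fin (K ^ length X) → Position d → Maybe (Filling d)
    filling c x with x Dec.∈? X
    ... | yes x∈X = just (finToFun {K} {length X} c (Any.index x∈X))
    ... | no  _   = nothing

    filling-lookup : ∀ c k → filling c (lookup X k) ≡ just (finToFun {K} {length X} c k)
    filling-lookup c k with lookup X k Dec.∈? X
    ... | yes x∈X = cong (λ k → just (finToFun {K} {length X} c k))
            (lookup-injective (setoid _) (simplex-unique d r) (Any.index x∈X) k (sym (Any.lookup-index x∈X)))
    ... | no x∉X  = contradiction (∈-lookup k) x∉X

    filling-level : ∀ c x {z} → filling c x ≡ just z → level x ≤ r
    filling-level c x eq with x Dec.∈? X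
    filling-level c x eq | yes x∈X = All.lookup (simplex-level d r) x∈X
    filling-level c x () | no _

    fits′ : ∀ c → base (filling c) (filling-level c) ≤ n
    fits′ c = *-cancelˡ-≤ (suc d !) {{suc d !≢0}} (≤-trans (base≤ (filling c) (filling-level c)) fits)

    member : Fin (K ^ length X) → PartitionOf d n
    member c = padded (filling c) (filling-level c) (n ∸ base (filling c) (filling-level c)) ,
      padded-volume (filling c) (filling-level c) n (fits′ c)

    -- The part of `c` that the padding may conceal: the entry at the origin mixes its raise with
    -- `n ∸ base`.
    at-origin : Fin (K ^ length X) → Filling d
    at-origin c = fromMaybe zero (filling c (origin d))

    -- In a cell of nonzero level no corner is the origin (`cell-level`), so the padding vanishes
    -- there and equal arrays have equal raises. The cell of level 0 is settled by the second
    -- hypothesis.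
    member-injective : ∀ c c′ → member c ≈ member c′ → at-origin c ≡ at-origin c′ → c ≡ c′
    member-injective c c′ same same₀ = finToFun-injective {K} {length X} c c′ λ k → Maybe.just-injective
      (trans (sym (filling-lookup c k)) (trans (agree k) (filling-lookup c′ k)))
      where
      away : ∀ i → level i ≢ 0 → raised (filling c) (filling-level c) i ≡ raised (filling c′) (filling-level c′) i
      away i ≢0 = +-cancelˡ-≡ (m ∸ level i) _ _ (+-cancelˡ-≡ 0 _ _
        (subst (λ a → a + stair (filling c) (filling-level c) i ≡ a + stair (filling c′) (filling-level c′) i) (vanish (level i) ≢0 _)
          (trans (same i) (cong (_+ stair (filling c′) (filling-level c′) i)
            (trans (vanish (level i) ≢0 _) (sym (vanish (level i) ≢0 _)))))))
        where
        vanish : ∀ l → l ≢ 0 → ∀ c → atZero c l ≡ 0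
        vanish zero    ≢0 c = contradiction refl ≢0
        vanish (suc l) ≢0 c = refl
      agree : ∀ k → filling c (lookup X k) ≡ filling c′ (lookup X k)
      agree k with level (lookup X k) ≟ 0
      ... | yes ≡0 = begin
        filling c (lookup X k)                       ≡⟨ filling-lookup c k ⟩
        just (finToFun {K} {length X} c k)           ≡⟨ cong just (value c) ⟨
        just (at-origin c)                           ≡⟨ cong just same₀ ⟩
        just (at-origin c′)                          ≡⟨ cong just (value c′) ⟩
        just (finToFun {K} {length X} c′ k)          ≡⟨ filling-lookup c′ k ⟨
        filling c′ (lookup X k)                      ∎
        where
        open ≡-Reasoning
        value : ∀ c → at-origin c ≡ finToFun {K} {length X} c k
        value c = cong (fromMaybe zero) (trans (cong (filling c) (sym (level≡0⇒origin (lookup X k) ≡0))) (filling-lookup c k))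
      ... | no ≢0 = trans (filling-lookup c k) (trans (cong just (raise-injective d _ _ x here-same)) (sym (filling-lookup c′ k)))
        where
        x = lookup X k
        raised≡ : ∀ c i → cell i ≡ x → raised (filling c) (filling-level c) i ≡ raise d (finToFun {K} {length X} c k) i
        raised≡ c i eq = cong (maybe (λ z → raise d z i) 0) (trans (cong (filling c) eq) (filling-lookup c k))
        here-same : ∀ i → cell i ≡ x → raise d (finToFun {K} {length X} c k) i ≡ raise d (finToFun {K} {length X} c′ k) i
        here-same i eq = trans (sym (raised≡ c i eq)) (trans
          (away i (λ i≡0 → ≢0 (n≤0⇒n≡0 (≤-trans (≤-reflexive (cong level (sym eq))) (≤-trans (cell-level i) (≤-reflexive i≡0))))))
          (raised≡ c′ i eq))

    family-size : K ^ length X ≤ 𝗉 d n * K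
    family-size = enumeration⇒≤length (partitionSetoid d n) (partitions-complete d n) member at-origin member-injective

-- Truncated logarithms: increments and the functional equation.

module Analysis where

  open import Algebra.Bundles using (CommutativeRing)
  open import Data.List.Base using (List; []; _∷_; map; _++_; length; downFrom; cartesianProductWith)
  open import Data.List.Properties using (length-map; length-++)
  open import Data.List.Relation.Unary.All as All using (All; []; _∷_)
  open import Data.Nat.Base as ℕ using (ℕ; zero; suc; _!)
  import Data.Nat.Properties as ℕ
  open import Data.Nat.Solver using () renaming (module +-*-Solver to ℕ-Solver)
  open import Data.Product.Base using (∃-syntax; _×_; _,_; proj₁; proj₂)
  open import Data.Rational.Base
  open import Data.Rational.Properties hiding (_≟_)
  open import Data.Rational.Solver using (module +-*-Solver)
  open import Data.Vec.Base using ([]; _∷_)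
  open import Relation.Binary.PropositionalEquality
  open import Relation.Nullary using (¬_; yes; no; contradiction)
  open import Relation.Unary using (Decidable)
  open import Algebra.Properties.CommutativeSemiring.Exp (CommutativeRing.commutativeSemiring +-*-commutativeRing)
    using (_^_; ^-distrib-*; ^-homo-*; ^-assocʳ)
  open import Defs
  open Arrays using (box; height; bump; extend; weighted; 𝗉≤weighted; simplex; simplex-length+; module Family)
  open +-*-Solver using (solve; _:+_; _:*_; :-_; _:=_; con)
  open ℕ-Solver using () renaming (solve to solveℕ; _:+_ to _⊕_; _:*_ to _⊗_; _:=_ to _⊜_; con to #)

  -- An inequality by certificate: the solver checks p + x = q for an explicit x, built from terms
  -- known to be nonnegative.
  ≤-by : ∀ {p q x} → 0ℚ ≤ x → p + x ≡ q → p ≤ q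
  ≤-by {p} 0≤x eq = subst (p ≤_) eq (p≤p+q p 0≤x)

  diff : ∀ {p q} → p ≤ q → 0ℚ ≤ q - p
  diff {p} {q} p≤q = subst (_≤ q - p) (+-inverseʳ p) (+-monoˡ-≤ (- p) p≤q)

  ≤-inv-limit : ∀ {x y c} → 0ℚ ≤ c → (∀ k → x ≤ y + c * inv k) → x ≤ y
  ≤-inv-limit {x} {y} {c} 0≤c h = ≮⇒≥ λ y<x →
    let 0<d = subst (_< x - y) (+-inverseʳ y) (+-monoˡ-< (- y) y<x)
        -- c may be 0, hence the divisor c + 1; the spare δ makes the final inequality strict.
        δ , 0<δ , eq = divide {c + 1ℚ} {x - y} (0<+ 0≤c 0<1) 0<d
        N , hN = archimedean 0<δ
        small : c * inv N ≤ c * δ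
        small = *-monoˡ 0≤c (hN N ℕ.≤-refl)
    in <-irrefl refl (begin-strict
      x                     ≤⟨ h N ⟩
      y + c * inv N         ≤⟨ +-monoʳ-≤ y small ⟩
      y + c * δ             <⟨ +-monoʳ-< y (subst (_< c * δ + δ) (+-identityʳ (c * δ)) (+-monoʳ-< (c * δ) 0<δ)) ⟩
      y + (c * δ + δ)       ≡⟨ solve 3 (λ y c d → y :+ (c :* d :+ d) := y :+ (c :+ con 1ℚ) :* d) refl y c δ ⟩
      y + (c + 1ℚ) * δ      ≡⟨ cong (y +_) eq ⟩
      y + (x - y)           ≡⟨ solve 2 (λ x y → y :+ (x :+ :- y) := x) refl x y ⟩
      x                     ∎)
    where open ≤-Reasoning

  -- The mean value bound for u^(i+1), with the derivative at the right end; `power-increment-≥` has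
  -- it at the left end. After division by i + 1 and summation these bound the increments of `S`.
  power-increment-≤ : ∀ {u h} → 0ℚ ≤ u → 0ℚ ≤ h → ∀ i →
    (u + h) ^ suc i ≤ u ^ suc i + fromℕ (suc i) * (h * (u + h) ^ i)
  power-increment-≤ {u} {h} 0≤u 0≤h zero = ≤-reflexive
    (solve 2 (λ u h → (u :+ h) :* con 1ℚ := u :* con 1ℚ :+ con 1ℚ :* (h :* con 1ℚ)) refl u h)
  power-increment-≤ {u} {h} 0≤u 0≤h (suc i) = subst
    (λ c → (u + h) * (w * w ^ i) ≤ u * (u * u ^ i) + c * (h * (w * w ^ i)))
    (sym (fromℕ-suc (suc i)))
    (≤-by (0≤+ (0≤* 0≤u (diff (power-increment-≤ 0≤u 0≤h i)))
               (0≤* (0≤* (0≤fromℕ (suc i)) (0≤* 0≤h 0≤h)) (0≤^ (0≤+ 0≤u 0≤h) i)))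
      (solve 5 (λ u h wi ui c →
        (u :+ h) :* ((u :+ h) :* wi) :+
        (u :* ((u :* ui :+ c :* (h :* wi)) :+ :- ((u :+ h) :* wi)) :+ (c :* (h :* h)) :* wi)
        := u :* (u :* ui) :+ (con 1ℚ :+ c) :* (h :* ((u :+ h) :* wi)))
        refl u h (w ^ i) (u ^ i) (fromℕ (suc i))))
    where w = u + h

  power-increment-≥ : ∀ {u h} → 0ℚ ≤ u → 0ℚ ≤ h → ∀ i →
    u ^ suc i + fromℕ (suc i) * (h * u ^ i) ≤ (u + h) ^ suc i
  power-increment-≥ {u} {h} 0≤u 0≤h zero = ≤-reflexive
    (solve 2 (λ u h → u :* con 1ℚ :+ con 1ℚ :* (h :* con 1ℚ) := (u :+ h) :* con 1ℚ) refl u h)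
  power-increment-≥ {u} {h} 0≤u 0≤h (suc i) = subst
    (λ c → u * (u * u ^ i) + c * (h * (u * u ^ i)) ≤ (u + h) * (w * w ^ i))
    (sym (fromℕ-suc (suc i)))
    (≤-by (0≤+ (0≤* (0≤+ 0≤u 0≤h) (diff (power-increment-≥ 0≤u 0≤h i)))
               (0≤* (0≤* (0≤fromℕ (suc i)) (0≤* 0≤h 0≤h)) (0≤^ 0≤u i)))
      (solve 5 (λ u h wi ui c →
        u :* (u :* ui) :+ (con 1ℚ :+ c) :* (h :* (u :* ui)) :+
        ((u :+ h) :* ((u :+ h) :* wi :+ :- (u :* ui :+ c :* (h :* ui))) :+ (c :* (h :* h)) :* ui)
        := (u :+ h) :* ((u :+ h) :* wi))
        refl u h (w ^ i) (u ^ i) (fromℕ (suc i))))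
    where w = u + h

  -- The partial sums of the Taylor series of -log(1 - u).

  S : ℚ → ℕ → ℚ
  S u = sumℚ (λ i → u ^ suc i * inv i)

  -- The derivative of `S` with respect to u.
  geo : ℚ → ℕ → ℚ
  geo u = sumℚ (u ^_)

  0≤geo : ∀ {u} → 0ℚ ≤ u → ∀ K → 0ℚ ≤ geo u K
  0≤geo 0≤u zero    = ≤-refl
  0≤geo 0≤u (suc K) = 0≤+ (0≤geo 0≤u K) (0≤^ 0≤u K)

  geo-sum : ∀ u K → (1ℚ - u) * geo u K ≡ 1ℚ - u ^ K
  geo-sum u zero    = solve 1 (λ u → (con 1ℚ :+ :- u) :* con 0ℚ := con 1ℚ :+ :- con 1ℚ) refl u
  geo-sum u (suc K) = begin
    (1ℚ - u) * (geo u K + u ^ K)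
      ≡⟨ *-distribˡ-+ (1ℚ - u) (geo u K) (u ^ K) ⟩
    (1ℚ - u) * geo u K + (1ℚ - u) * u ^ K
      ≡⟨ cong (_+ (1ℚ - u) * u ^ K) (geo-sum u K) ⟩
    1ℚ - u ^ K + (1ℚ - u) * u ^ K
      ≡⟨ solve 2 (λ u p → con 1ℚ :+ :- p :+ (con 1ℚ :+ :- u) :* p := con 1ℚ :+ :- (u :* p)) refl u (u ^ K) ⟩
    1ℚ - u * u ^ K ∎
    where open ≡-Reasoning

  geo≤ : ∀ {u} → 0ℚ ≤ u → u ≤ 1ℚ → ∀ K → geo u K ≤ fromℕ K
  geo≤ 0≤u u≤1 zero    = ≤-refl
  geo≤ {u} 0≤u u≤1 (suc K) = subst (geo u K + u ^ K ≤_)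
    (trans (+-comm (fromℕ K) 1ℚ) (sym (fromℕ-suc K))) (+-mono-≤ (geo≤ 0≤u u≤1 K) (^≤1 0≤u u≤1 K))

  scale-by-inv : ∀ i q r → (q + fromℕ (suc i) * r) * inv i ≡ q * inv i + r
  scale-by-inv i q r = begin
    (q + fromℕ (suc i) * r) * inv i
      ≡⟨ solve 4 (λ q c r i → (q :+ c :* r) :* i := q :* i :+ i :* c :* r) refl q (fromℕ (suc i)) r (inv i) ⟩
    q * inv i + inv i * fromℕ (suc i) * r
      ≡⟨ cong (λ t → q * inv i + t * r) (inv-inverse i) ⟩
    q * inv i + 1ℚ * r
      ≡⟨ cong (q * inv i +_) (*-identityˡ r) ⟩
    q * inv i + r ∎
    where open ≡-Reasoning

  S-increment-≤ : ∀ {u h} → 0ℚ ≤ u → 0ℚ ≤ h → ∀ K → S (u + h) K ≤ S u K + h * geo (u + h) K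
  S-increment-≤ {u} {h} 0≤u 0≤h zero    = ≤-reflexive (solve 1 (λ h → con 0ℚ := con 0ℚ :+ h :* con 0ℚ) refl h)
  S-increment-≤ {u} {h} 0≤u 0≤h (suc K) = ≤-trans
    (+-mono-≤ (S-increment-≤ 0≤u 0≤h K)
              (≤-trans (*-monoʳ (0≤inv K) (power-increment-≤ 0≤u 0≤h K))
                       (≤-reflexive (scale-by-inv K (u ^ suc K) (h * (u + h) ^ K)))))
    (≤-reflexive (solve 5 (λ s h g p w → s :+ h :* g :+ (p :+ h :* w) := s :+ p :+ h :* (g :+ w)) refl
      (S u K) h (geo (u + h) K) (u ^ suc K * inv K) ((u + h) ^ K)))

  S-increment-≥ : ∀ {u h} → 0ℚ ≤ u → 0ℚ ≤ h → ∀ K → S u K + h * geo u K ≤ S (u + h) K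
  S-increment-≥ {u} {h} 0≤u 0≤h zero    = ≤-reflexive (solve 1 (λ h → con 0ℚ :+ h :* con 0ℚ := con 0ℚ) refl h)
  S-increment-≥ {u} {h} 0≤u 0≤h (suc K) = ≤-trans
    (≤-reflexive (solve 5 (λ s h g p w → s :+ p :+ h :* (g :+ w) := s :+ h :* g :+ (p :+ h :* w)) refl
      (S u K) h (geo u K) (u ^ suc K * inv K) (u ^ K)))
    (+-mono-≤ (S-increment-≥ 0≤u 0≤h K)
              (≤-trans (≤-reflexive (sym (scale-by-inv K (u ^ suc K) (h * u ^ K))))
                       (*-monoʳ (0≤inv K) (power-increment-≥ 0≤u 0≤h K))))

  S-mono : ∀ {u v} → 0ℚ ≤ u → u ≤ v → ∀ K → S u K ≤ S v K
  S-mono 0≤u u≤v zero    = ≤-refl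
  S-mono 0≤u u≤v (suc K) = +-mono-≤ (S-mono 0≤u u≤v K) (*-monoʳ (0≤inv K) (^-mono 0≤u u≤v (suc K)))

  S-zero : ∀ K → S 0ℚ K ≡ 0ℚ
  S-zero zero    = refl
  S-zero (suc K) = trans (cong₂ _+_ (S-zero K) (trans (cong (_* inv K) (*-zeroˡ (0ℚ ^ K))) (*-zeroˡ (inv K)))) refl

  -- A discrete mean value theorem: f and g are compared along u/k, 2u/k, …, u,
  -- and the quadratic error terms vanish as k grows.

  increment-comparison : ∀ (f g : ℚ → ℚ) {u C D} → 0ℚ ≤ u → 0ℚ ≤ C → 0ℚ ≤ D →
    (∀ {s h} → 0ℚ ≤ s → 0ℚ ≤ h → s + h ≤ u → f (s + h) + g s ≤ f s + g (s + h) + h * (h * C + D)) →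
    f 0ℚ ≤ g 0ℚ → f u ≤ g u + u * D
  increment-comparison f g {u} {C} {D} 0≤u 0≤C 0≤D step base =
    ≤-inv-limit (0≤* (0≤* 0≤u 0≤u) 0≤C) last
    where
    module _ (k : ℕ) where
      h = inv k * u
      0≤h = 0≤* (0≤inv k) 0≤u
      e = h * C + D
      at : ℕ → ℚ
      at j = fromℕ j * h
      at-suc : ∀ j → at (suc j) ≡ at j + h
      at-suc j = trans (cong (_* h) (fromℕ-suc j)) (one-more (fromℕ j) h)
      at-end : at (suc k) ≡ u
      at-end = trans (solve 3 (λ n i u → n :* (i :* u) := i :* n :* u) refl (fromℕ (suc k)) (inv k) u)
               (trans (cong (_* u) (inv-inverse k)) (*-identityˡ u))
      walk : ∀ j → j ℕ.≤ suc k → f (at j) ≤ g (at j) + at j * e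
      walk zero    _ = subst (λ t → f t ≤ g t + t * e) (sym (*-zeroˡ h))
        (subst (f 0ℚ ≤_) (solve 2 (λ x e → x := x :+ con 0ℚ :* e) refl (g 0ℚ) e) base)
      walk (suc j) j<k = subst (λ t → f t ≤ g t + t * e) (sym (at-suc j))
        (≤-by (0≤+ (diff (walk j (ℕ.<⇒≤ j<k))) (diff (step (0≤* (0≤fromℕ j) 0≤h) 0≤h inside)))
          (solve 7 (λ f₁ g₀ f₀ g₁ x h e → f₁ :+ ((g₀ :+ x :* e :+ :- f₀) :+ (f₀ :+ g₁ :+ h :* e :+ :- (f₁ :+ g₀)))
                  := g₁ :+ (x :+ h) :* e) refl
            (f (at j + h)) (g (at j)) (f (at j)) (g (at j + h)) (at j) h e))
        where
        inside : at j + h ≤ u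
        inside = subst₂ _≤_ (at-suc j) at-end (*-monoʳ 0≤h (fromℕ-mono j<k))
      last : f u ≤ g u + u * D + u * u * C * inv k
      last = subst (f u ≤_)
        (solve 5 (λ g u C D i → g :+ u :* (i :* u :* C :+ D) := g :+ u :* D :+ u :* u :* C :* i) refl (g u) u C D (inv k))
        (subst (λ t → f t ≤ g t + t * e) at-end (walk (suc k) ℕ.≤-refl))

  -- Here b = 1/r, and z ≤ y/c ≤ y/r for y ≥ 0. It gives one bound for 1/(1 - s) that is uniform
  -- along the path s ≤ u.
  divide-≤ : ∀ {b r c y z} → 0ℚ < r → b * r ≡ 1ℚ → 0ℚ ≤ b → r ≤ c → 0ℚ ≤ y → c * z ≤ y → z ≤ b * y
  divide-≤ {b} {r} {c} {y} {z} 0<r br≡1 0≤b r≤c 0≤y cz≤y =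
    *-cancelˡ-≤-pos c {{positive (<-≤-trans 0<r r≤c)}} (begin
      c * z         ≤⟨ cz≤y ⟩
      y             ≡⟨ trans (cong (_* y) br≡1) (*-identityˡ y) ⟨
      b * r * y     ≡⟨ solve 3 (λ b r y → b :* r :* y := r :* (b :* y)) refl b r y ⟩
      r * (b * y)   ≤⟨ *-monoʳ (0≤* 0≤b 0≤y) r≤c ⟩
      c * (b * y)   ∎)
    where open ≤-Reasoning

  module _ {u v b : ℚ} (0≤u : 0ℚ ≤ u) (u<1 : 0ℚ < 1ℚ - u) (0≤v : 0ℚ ≤ v) (v≤1 : v ≤ 1ℚ)
           (0≤b : 0ℚ ≤ b) (b-inv : b * (1ℚ - u) ≡ 1ℚ) where

    private
      a = 1ℚ - v
      0≤a : 0ℚ ≤ a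
      0≤a = diff v≤1
      -- 1 - `join s` = (1 - s)(1 - v), so s from 0 to u leads from v to the argument that belongs
      -- to the product (1 - u)(1 - v).
      join : ℚ → ℚ
      join s = v + s * a
      split : ∀ s h → join (s + h) ≡ join s + h * a
      split s h = solve 4 (λ s h v a → v :+ (s :+ h) :* a := (v :+ s :* a) :+ h :* a) refl s h v a
      1-join : ∀ s → 1ℚ - join s ≡ (1ℚ - s) * a
      1-join s = solve 2 (λ s v → con 1ℚ :+ :- (v :+ s :* (con 1ℚ :+ :- v)) := (con 1ℚ :+ :- s) :* (con 1ℚ :+ :- v)) refl s v
      0≤join : ∀ {s} → 0ℚ ≤ s → 0ℚ ≤ join s
      0≤join 0≤s = 0≤+ 0≤v (0≤* 0≤s 0≤a)
      s≤join : ∀ {s} → s ≤ 1ℚ → s ≤ join s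
      s≤join {s} s≤1 = ≤-by (0≤* 0≤v (diff s≤1))
        (solve 2 (λ s v → s :+ v :* (con 1ℚ :+ :- s) := v :+ s :* (con 1ℚ :+ :- v)) refl s v)
      u≤1 : u ≤ 1ℚ
      u≤1 = ≤-by (<⇒≤ u<1) (solve 1 (λ u → u :+ (con 1ℚ :+ :- u) := con 1ℚ) refl u)
      anti : ∀ {s t} → s ≤ t → 1ℚ - t ≤ 1ℚ - s
      anti s≤t = +-monoʳ-≤ 1ℚ (neg-antimono-≤ s≤t)
      geo-join : ∀ s K → (1ℚ - s) * (a * geo (join s) K) ≡ 1ℚ - join s ^ K
      geo-join s K = trans (sym (*-assoc (1ℚ - s) a (geo (join s) K)))
        (trans (cong (_* geo (join s) K) (sym (1-join s))) (geo-sum (join s) K))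

    -- As functions of s, `S (join s) K` and `S s K + S v K` agree at 0. Their derivatives are (1 -
    -- (join s)^K)/(1 - s) and (1 - s^K)/(1 - s), and s ≤ `join s`. Taking them at different ends of
    -- a step costs only a term quadratic in h.
    S-subadditive : ∀ K → S (v + u * (1ℚ - v)) K ≤ S u K + S v K
    S-subadditive K = subst (S (join u) K ≤_)
      (solve 2 (λ g u → g :+ u :* con 0ℚ := g) refl (S u K + S v K) u)
      (increment-comparison (λ s → S (join s) K) (λ s → S s K + S v K) 0≤u (0≤* 0≤b (0≤fromℕ K)) ≤-refl
        step
        (≤-reflexive (trans (cong (λ t → S t K) (solve 2 (λ v a → v :+ con 0ℚ :* a := v) refl v a))
          (trans (sym (+-identityˡ (S v K))) (cong (_+ S v K) (sym (S-zero K)))))))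
      where
      step : ∀ {s h} → 0ℚ ≤ s → 0ℚ ≤ h → s + h ≤ u →
        S (join (s + h)) K + (S s K + S v K) ≤
        S (join s) K + (S (s + h) K + S v K) + h * (h * (b * fromℕ K) + 0ℚ)
      step {s} {h} 0≤s 0≤h s+h≤u =
        ≤-by (0≤+ (0≤+ (diff above) (diff (S-increment-≥ 0≤s 0≤h K))) (0≤* 0≤h (diff rates)))
          (solve 9 (λ f₁ f₀ g₁ g₀ v h x g e →
            f₁ :+ (g₀ :+ v) :+ ((f₀ :+ h :* x :+ :- f₁) :+ (g₁ :+ :- (g₀ :+ h :* g)) :+ h :* (e :+ :- (x :+ :- g)))
            := f₀ :+ (g₁ :+ v) :+ h :* (e :+ con 0ℚ)) refl
            (S (join (s + h)) K) (S (join s) K) (S (s + h) K) (S s K) (S v K) h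
            (a * geo (join (s + h)) K) (geo s K) (h * (b * fromℕ K)))
        where
        s≤s+h = p≤p+q s 0≤h
        s≤1 = ≤-trans s≤s+h (≤-trans s+h≤u u≤1)
        above : S (join (s + h)) K ≤ S (join s) K + h * (a * geo (join (s + h)) K)
        above = subst (λ w → S w K ≤ S (join s) K + h * (a * geo w K)) (sym (split s h))
          (subst (S (join s + h * a) K ≤_) (cong (S (join s) K +_) (*-assoc h a (geo (join s + h * a) K)))
            (S-increment-≤ (0≤join 0≤s) (0≤* 0≤h 0≤a) K))
        rates : a * geo (join (s + h)) K - geo s K ≤ h * (b * fromℕ K)
        rates = subst (a * geo (join (s + h)) K - geo s K ≤_) (solve 3 (λ b h n → b :* (h :* n) := h :* (b :* n)) refl b h (fromℕ K))
          (divide-≤ u<1 b-inv 0≤b (anti s+h≤u) (0≤* 0≤h (0≤fromℕ K)) (begin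
            (1ℚ - (s + h)) * (a * geo (join (s + h)) K - geo s K)
              ≡⟨ solve 4 (λ s h x g → (con 1ℚ :+ :- (s :+ h)) :* (x :+ :- g) :=
                   (con 1ℚ :+ :- (s :+ h)) :* x :+ :- ((con 1ℚ :+ :- s) :* g) :+ h :* g) refl
                   s h (a * geo (join (s + h)) K) (geo s K) ⟩
            (1ℚ - (s + h)) * (a * geo (join (s + h)) K) - (1ℚ - s) * geo s K + h * geo s K
              ≡⟨ cong₂ (λ x y → x - y + h * geo s K) (geo-join (s + h) K) (geo-sum s K) ⟩
            1ℚ - join (s + h) ^ K - (1ℚ - s ^ K) + h * geo s K
              ≤⟨ ≤-by (0≤+ (diff (^-mono 0≤s (≤-trans s≤s+h (s≤join (≤-trans s+h≤u u≤1))) K))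
                           (0≤* 0≤h (diff (geo≤ 0≤s s≤1 K))))
                   (solve 5 (λ p q h g n → con 1ℚ :+ :- q :+ :- (con 1ℚ :+ :- p) :+ h :* g :+ ((q :+ :- p) :+ h :* (n :+ :- g)) := h :* n)
                     refl (s ^ K) (join (s + h) ^ K) h (geo s K) (fromℕ K)) ⟩
            h * fromℕ K ∎))
          where open ≤-Reasoning

    -- The same two derivatives differ by ((join s)^K - s^K)/(1 - s), at most b (join u)^K. This is
    -- the truncation error, and it decays geometrically when join u < 1.
    S-superadditive : ∀ K → S u K + S v K ≤ S (v + u * (1ℚ - v)) K + b * (v + u * (1ℚ - v)) ^ K
    S-superadditive K = ≤-trans
      (increment-comparison (λ s → S s K + S v K) (λ s → S (join s) K) 0≤u (0≤* 0≤b (0≤fromℕ K)) (0≤* 0≤b 0≤W)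
        step
        (≤-reflexive (trans (trans (cong (_+ S v K) (S-zero K)) (+-identityˡ (S v K)))
          (cong (λ t → S t K) (solve 2 (λ v a → v := v :+ con 0ℚ :* a) refl v a)))))
      (+-monoʳ-≤ (S (join u) K) (subst (u * (b * W) ≤_) (*-identityˡ (b * W)) (*-monoʳ (0≤* 0≤b 0≤W) u≤1)))
      where
      W = join u ^ K
      0≤W : 0ℚ ≤ W
      0≤W = 0≤^ (0≤join 0≤u) K
      step : ∀ {s h} → 0ℚ ≤ s → 0ℚ ≤ h → s + h ≤ u →
        (S (s + h) K + S v K) + S (join s) K ≤
        (S s K + S v K) + S (join (s + h)) K + h * (h * (b * fromℕ K) + b * W)
      step {s} {h} 0≤s 0≤h s+h≤u =
        ≤-by (0≤+ (0≤+ (diff below) (diff (S-increment-≤ 0≤s 0≤h K))) (0≤* 0≤h (diff rates)))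
          (solve 9 (λ f₁ f₀ g₁ g₀ v h x g e →
            (g₁ :+ v) :+ f₀ :+ ((f₁ :+ :- (f₀ :+ h :* x)) :+ (g₀ :+ h :* g :+ :- g₁) :+ h :* (e :+ :- (g :+ :- x)))
            := (g₀ :+ v) :+ f₁ :+ h :* e) refl
            (S (join (s + h)) K) (S (join s) K) (S (s + h) K) (S s K) (S v K) h
            (a * geo (join s) K) (geo (s + h) K) (h * (b * fromℕ K) + b * W))
        where
        s≤s+h = p≤p+q s 0≤h
        s≤u = ≤-trans s≤s+h s+h≤u
        0≤s+h = 0≤+ 0≤s 0≤h
        below : S (join s) K + h * (a * geo (join s) K) ≤ S (join (s + h)) K
        below = subst (λ w → S (join s) K + h * (a * geo (join s) K) ≤ S w K) (sym (split s h))
          (subst (_≤ S (join s + h * a) K) (cong (S (join s) K +_) (*-assoc h a (geo (join s) K)))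
            (S-increment-≥ (0≤join 0≤s) (0≤* 0≤h 0≤a) K))
        rates : geo (s + h) K - a * geo (join s) K ≤ h * (b * fromℕ K) + b * W
        rates = subst (geo (s + h) K - a * geo (join s) K ≤_) (solve 4 (λ b h n w → b :* (h :* n :+ w) := h :* (b :* n) :+ b :* w) refl b h (fromℕ K) W)
          (divide-≤ u<1 b-inv 0≤b (anti s≤u) (0≤+ (0≤* 0≤h (0≤fromℕ K)) 0≤W) (begin
            (1ℚ - s) * (geo (s + h) K - a * geo (join s) K)
              ≡⟨ solve 4 (λ s h x g → (con 1ℚ :+ :- s) :* (g :+ :- x) :=
                   (con 1ℚ :+ :- (s :+ h)) :* g :+ :- ((con 1ℚ :+ :- s) :* x) :+ h :* g) refl
                   s h (a * geo (join s) K) (geo (s + h) K) ⟩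
            (1ℚ - (s + h)) * geo (s + h) K - (1ℚ - s) * (a * geo (join s) K) + h * geo (s + h) K
              ≡⟨ cong₂ (λ x y → x - y + h * geo (s + h) K) (geo-sum (s + h) K) (geo-join s K) ⟩
            1ℚ - (s + h) ^ K - (1ℚ - join s ^ K) + h * geo (s + h) K
              ≤⟨ ≤-by (0≤+ (0≤+ (0≤^ 0≤s+h K) (diff (^-mono (0≤join 0≤s) (+-monoʳ-≤ v (*-monoʳ 0≤a s≤u)) K)))
                           (0≤* 0≤h (diff (geo≤ 0≤s+h (≤-trans s+h≤u u≤1) K))))
                   (solve 6 (λ p q h g n w → con 1ℚ :+ :- p :+ :- (con 1ℚ :+ :- q) :+ h :* g :+ (p :+ (w :+ :- q) :+ h :* (n :+ :- g)) := h :* n :+ w)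
                     refl ((s + h) ^ K) (join s ^ K) h (geo (s + h) K) (fromℕ K) W) ⟩
            h * fromℕ K + W ∎))
          where open ≤-Reasoning

  inverse : ∀ {x} → 0ℚ < x → ∃[ b ] 0ℚ < b × b * x ≡ 1ℚ
  inverse {x} 0<x with divide 0<x 0<1
  ... | b , 0<b , eq = b , 0<b , trans (*-comm b x) eq

  1-[1-x] : ∀ x → 1ℚ - (1ℚ - x) ≡ x
  1-[1-x] = solve 1 (λ x → con 1ℚ :+ :- (con 1ℚ :+ :- x) := x) refl

  join-complements : ∀ x y → (1ℚ - y) + (1ℚ - x) * (1ℚ - (1ℚ - y)) ≡ 1ℚ - x * y
  join-complements = solve 2 (λ x y →
    (con 1ℚ :+ :- y) :+ (con 1ℚ :+ :- x) :* (con 1ℚ :+ :- (con 1ℚ :+ :- y)) := con 1ℚ :+ :- (x :* y)) refl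

  complement≤1 : ∀ {y} → 0ℚ ≤ y → 1ℚ - y ≤ 1ℚ
  complement≤1 {y} 0≤y = ≤-by 0≤y (solve 1 (λ y → con 1ℚ :+ :- y :+ y := con 1ℚ) refl y)

  -log-subadditive : ∀ {x y} → 0ℚ < x → x ≤ 1ℚ → 0ℚ ≤ y → y ≤ 1ℚ →
    ∀ K → S (1ℚ - x * y) K ≤ S (1ℚ - x) K + S (1ℚ - y) K
  -log-subadditive {x} {y} 0<x x≤1 0≤y y≤1 K = let b , 0<b , bx≡1 = inverse 0<x in
    subst (λ t → S t K ≤ S (1ℚ - x) K + S (1ℚ - y) K) (join-complements x y)
      (S-subadditive {1ℚ - x} {1ℚ - y} {b} (diff x≤1) (subst (0ℚ <_) (sym (1-[1-x] x)) 0<x)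
        (diff y≤1) (complement≤1 0≤y) (<⇒≤ 0<b) (trans (cong (b *_) (1-[1-x] x)) bx≡1) K)

  -log-superadditive : ∀ {x y b} → 0ℚ < x → x ≤ 1ℚ → 0ℚ ≤ y → y ≤ 1ℚ → 0ℚ ≤ b → b * x ≡ 1ℚ →
    ∀ K → S (1ℚ - x) K + S (1ℚ - y) K ≤ S (1ℚ - x * y) K + b * (1ℚ - x * y) ^ K
  -log-superadditive {x} {y} {b} 0<x x≤1 0≤y y≤1 0≤b bx≡1 K =
    subst (λ t → S (1ℚ - x) K + S (1ℚ - y) K ≤ S t K + b * t ^ K) (join-complements x y)
      (S-superadditive {1ℚ - x} {1ℚ - y} {b} (diff x≤1) (subst (0ℚ <_) (sym (1-[1-x] x)) 0<x)
        (diff y≤1) (complement≤1 0≤y) 0≤b (trans (cong (b *_) (1-[1-x] x)) bx≡1) K)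

  -- A truncated form of log (1 + t) ≤ t: the derivative at u = 1 - q is at most 1/q, and u/q = t.
  -log≤ : ∀ {q t} → 0ℚ ≤ t → 0ℚ ≤ q → q ≤ 1ℚ → q * (1ℚ + t) ≡ 1ℚ → ∀ K → S (1ℚ - q) K ≤ t
  -log≤ {q} {t} 0≤t 0≤q q≤1 eq K = begin
    S u K                      ≡⟨ cong (λ v → S v K) (+-identityˡ u) ⟨
    S (0ℚ + u) K               ≤⟨ S-increment-≤ ≤-refl 0≤u K ⟩
    S 0ℚ K + u * geo (0ℚ + u) K
      ≡⟨ cong₂ (λ x y → x + u * geo y K) (S-zero K) (+-identityˡ u) ⟩
    0ℚ + u * geo u K           ≡⟨ cong (λ x → 0ℚ + x * geo u K) u≡tq ⟩
    0ℚ + t * q * geo u K       ≡⟨ solve 3 (λ t q g → con 0ℚ :+ t :* q :* g := t :* ((con 1ℚ :+ :- (con 1ℚ :+ :- q)) :* g)) refl t q (geo u K) ⟩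
    t * ((1ℚ - u) * geo u K)   ≡⟨ cong (t *_) (geo-sum u K) ⟩
    t * (1ℚ - u ^ K)           ≤⟨ *-monoˡ 0≤t (complement≤1 (0≤^ 0≤u K)) ⟩
    t * 1ℚ                     ≡⟨ *-identityʳ t ⟩
    t                          ∎
    where
    open ≤-Reasoning
    u = 1ℚ - q
    0≤u = diff q≤1
    u≡tq : u ≡ t * q
    u≡tq = trans (cong (_- q) (sym eq)) (solve 2 (λ q t → q :* (con 1ℚ :+ t) :+ :- q := t :* q) refl q t)

  -- Generating functions at a rational point.

  ∑ : {A : Set} → (A → ℚ) → List A → ℚ
  ∑ f []       = 0ℚ
  ∑ f (x ∷ xs) = f x + ∑ f xs

  ∏ : {A : Set} → (A → ℚ) → List A → ℚ
  ∏ f []       = 1ℚ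
  ∏ f (x ∷ xs) = f x * ∏ f xs

  module _ {A : Set} where

    ∑-+ : ∀ (f g : A → ℚ) xs → ∑ (λ x → f x + g x) xs ≡ ∑ f xs + ∑ g xs
    ∑-+ f g []       = refl
    ∑-+ f g (x ∷ xs) = trans (cong (f x + g x +_) (∑-+ f g xs))
      (solve 4 (λ a b c d → a :+ b :+ (c :+ d) := a :+ c :+ (b :+ d)) refl (f x) (g x) (∑ f xs) (∑ g xs))

    ∑-*ʳ : ∀ (f : A → ℚ) c xs → ∑ (λ x → f x * c) xs ≡ ∑ f xs * c
    ∑-*ʳ f c []       = sym (*-zeroˡ c)
    ∑-*ʳ f c (x ∷ xs) = trans (cong (f x * c +_) (∑-*ʳ f c xs)) (sym (*-distribʳ-+ c (f x) (∑ f xs)))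

    ∑-cong : ∀ {f g : A → ℚ} → (∀ x → f x ≡ g x) → ∀ xs → ∑ f xs ≡ ∑ g xs
    ∑-cong h []       = refl
    ∑-cong h (x ∷ xs) = cong₂ _+_ (h x) (∑-cong h xs)

    ∑-++ : ∀ (f : A → ℚ) xs ys → ∑ f (xs ++ ys) ≡ ∑ f xs + ∑ f ys
    ∑-++ f []       ys = sym (+-identityˡ (∑ f ys))
    ∑-++ f (x ∷ xs) ys = trans (cong (f x +_) (∑-++ f xs ys)) (sym (+-assoc (f x) (∑ f xs) (∑ f ys)))

    ∑-map : ∀ {B : Set} (f : A → ℚ) (g : B → A) xs → ∑ f (map g xs) ≡ ∑ (λ x → f (g x)) xs
    ∑-map f g []       = refl
    ∑-map f g (x ∷ xs) = cong (f (g x) +_) (∑-map f g xs)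

    ∏-bounds : ∀ {f : A → ℚ} xs → All (λ x → 0ℚ < f x × f x ≤ 1ℚ) xs → 0ℚ < ∏ f xs × ∏ f xs ≤ 1ℚ
    ∏-bounds []       []             = 0<1 , ≤-refl
    ∏-bounds {f} (x ∷ xs) ((0<f , f≤1) ∷ h) = let 0<p , p≤1 = ∏-bounds xs h in
      0<* 0<f 0<p , *-mono₂ (<⇒≤ 0<f) (<⇒≤ 0<p) f≤1 p≤1

    -log-∏ : ∀ {f : A → ℚ} xs → All (λ x → 0ℚ < f x × f x ≤ 1ℚ) xs →
             ∀ K → S (1ℚ - ∏ f xs) K ≤ ∑ (λ x → S (1ℚ - f x) K) xs
    -log-∏ {f} []       []                    K = ≤-reflexive (trans (cong (λ u → S u K) (+-inverseʳ 1ℚ)) (S-zero K))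
    -log-∏ {f} (x ∷ xs) ((0<f , f≤1) ∷ h) K = let 0<p , p≤1 = ∏-bounds xs h in
      ≤-trans (-log-subadditive 0<f f≤1 (<⇒≤ 0<p) p≤1 K) (+-monoʳ-≤ (S (1ℚ - f x) K) (-log-∏ xs h K))

  -log-^ : ∀ {q t} → 0ℚ < q → q ≤ 1ℚ → ∀ K → S (1ℚ - q) K ≤ t → ∀ N → S (1ℚ - q ^ N) K ≤ fromℕ N * t
  -log-^ {q} {t} 0<q q≤1 K h zero    = ≤-reflexive
    (trans (cong (λ u → S u K) (+-inverseʳ 1ℚ)) (trans (S-zero K) (sym (*-zeroˡ t))))
  -log-^ {q} {t} 0<q q≤1 K h (suc N) = subst (S (1ℚ - q * q ^ N) K ≤_)
    (trans (trans (+-comm t (fromℕ N * t)) (sym (one-more (fromℕ N) t))) (cong (_* t) (sym (fromℕ-suc N))))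
    (≤-trans (-log-subadditive 0<q q≤1 (0≤^ (<⇒≤ 0<q) N) (^≤1 (<⇒≤ 0<q) q≤1 N) K)
             (+-mono-≤ h (-log-^ 0<q q≤1 K h N)))

  -- The height is additive over coordinates, so the sum over the box is a d-fold product of equal
  -- geometric sums.
  box-generating : ∀ d N x → ∑ (λ i → x ^ height i) (box d N) ≡ ∑ (λ j → x ^ suc j) (downFrom N) ^ d
  box-generating zero    N x = refl
  box-generating (suc d) N x = go (downFrom N)
    where
    open ≡-Reasoning
    b = ∑ (λ j → x ^ suc j) (downFrom N) ^ d
    row : ∀ j → ∑ (λ i → x ^ height i) (map (j ∷_) (box d N)) ≡ x ^ suc j * b
    row j = begin
      ∑ (λ i → x ^ height i) (map (j ∷_) (box d N))      ≡⟨ ∑-map (λ i → x ^ height i) (j ∷_) (box d N) ⟩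
      ∑ (λ i → x ^ (suc j ℕ.+ height i)) (box d N)
        ≡⟨ ∑-cong (λ i → trans (^-homo-* x (suc j) (height i)) (*-comm (x ^ suc j) (x ^ height i))) (box d N) ⟩
      ∑ (λ i → x ^ height i * x ^ suc j) (box d N)       ≡⟨ ∑-*ʳ (λ i → x ^ height i) (x ^ suc j) (box d N) ⟩
      ∑ (λ i → x ^ height i) (box d N) * x ^ suc j       ≡⟨ *-comm (∑ (λ i → x ^ height i) (box d N)) (x ^ suc j) ⟩
      x ^ suc j * ∑ (λ i → x ^ height i) (box d N)       ≡⟨ cong (x ^ suc j *_) (box-generating d N x) ⟩
      x ^ suc j * b                                      ∎
    go : ∀ js → ∑ (λ i → x ^ height i) (cartesianProductWith _∷_ js (box d N)) ≡ ∑ (λ j → x ^ suc j) js * b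
    go []       = sym (*-zeroˡ b)
    go (j ∷ js) = begin
      ∑ (λ i → x ^ height i) (map (j ∷_) (box d N) ++ cartesianProductWith _∷_ js (box d N))
        ≡⟨ ∑-++ (λ i → x ^ height i) (map (j ∷_) (box d N)) (cartesianProductWith _∷_ js (box d N)) ⟩
      ∑ (λ i → x ^ height i) (map (j ∷_) (box d N)) + ∑ (λ i → x ^ height i) (cartesianProductWith _∷_ js (box d N))
        ≡⟨ cong₂ _+_ (row j) (go js) ⟩
      x ^ suc j * b + ∑ (λ j → x ^ suc j) js * b
        ≡⟨ *-distribʳ-+ b (x ^ suc j) (∑ (λ j → x ^ suc j) js) ⟨
      (x ^ suc j + ∑ (λ j → x ^ suc j) js) * b ∎

  bernoulli : ∀ {t} → 0ℚ ≤ t → ∀ k → 1ℚ + fromℕ k * t ≤ (1ℚ + t) ^ k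
  bernoulli {t} 0≤t zero    = ≤-reflexive (solve 1 (λ t → con 1ℚ :+ con 0ℚ :* t := con 1ℚ) refl t)
  bernoulli {t} 0≤t (suc k) = subst (λ c → 1ℚ + c * t ≤ (1ℚ + t) * (1ℚ + t) ^ k) (sym (fromℕ-suc k))
    (≤-by (0≤+ (0≤* (0≤+ 0≤1 0≤t) (diff (bernoulli 0≤t k))) (0≤* (0≤fromℕ k) (0≤* 0≤t 0≤t)))
      (solve 3 (λ t c p → con 1ℚ :+ (con 1ℚ :+ c) :* t :+ ((con 1ℚ :+ t) :* (p :+ :- (con 1ℚ :+ c :* t)) :+ c :* (t :* t))
                          := (con 1ℚ :+ t) :* p) refl t (fromℕ k) ((1ℚ + t) ^ k)))

  module _ {q t T : ℚ} (0<t : 0ℚ < t) (0<q : 0ℚ < q) (q≤1 : q ≤ 1ℚ) (q-inv : q * (1ℚ + t) ≡ 1ℚ)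
           (0≤T : 0ℚ ≤ T) (T-inv : t * T ≡ 1ℚ) where

    private
      0≤t = <⇒≤ 0<t
      0≤q = <⇒≤ 0<q

    -- With q = 1/(1+t), this says x/(1 - x) ≤ 1/((k+1)t) for x = q^(k+1).

    ratio : ∀ k → fromℕ (suc k) * t * q ^ suc k ≤ 1ℚ - q ^ suc k
    ratio k = begin
      c * t * x                       ≡⟨ solve 2 (λ a x → a :* x := (con 1ℚ :+ a) :* x :+ :- x) refl (c * t) x ⟩
      (1ℚ + c * t) * x - x            ≤⟨ +-monoˡ-≤ (- x) (*-monoʳ (0≤^ 0≤q (suc k)) (bernoulli 0≤t (suc k))) ⟩
      (1ℚ + t) ^ suc k * x - x        ≡⟨ cong (_- x) (trans (sym (^-distrib-* (1ℚ + t) q (suc k)))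
                                          (trans (cong (_^ suc k) (trans (*-comm (1ℚ + t) q) q-inv)) (1^ (suc k)))) ⟩
      1ℚ - x                          ∎
      where
      open ≤-Reasoning
      c = fromℕ (suc k)
      x = q ^ suc k
      1^ : ∀ n → 1ℚ ^ n ≡ 1ℚ
      1^ zero    = refl
      1^ (suc n) = trans (*-identityˡ (1ℚ ^ n)) (1^ n)

    -- The geometric series x/(1 - x) for x = q^(k+1), bounded by `ratio`; T stands for 1/t.
    row-sum≤ : ∀ k N → ∑ (λ j → (q ^ suc k) ^ suc j) (downFrom N) ≤ T * inv k
    row-sum≤ k N = begin
      s                         ≡⟨ trans (cong₂ (λ a b → a * b * s) (inv-inverse k) T-inv) (solve 1 (λ s → con 1ℚ :* con 1ℚ :* s := s) refl s) ⟨
      inv k * c * (t * T) * s   ≡⟨ solve 5 (λ i c t T s → i :* c :* (t :* T) :* s := T :* i :* (c :* t :* s)) refl (inv k) c t T s ⟩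
      T * inv k * (c * t * s)   ≤⟨ *-monoˡ (0≤* 0≤T (0≤inv k)) (≤-trans (telescope N) (complement≤1 (0≤^ 0≤x N))) ⟩
      T * inv k * 1ℚ            ≡⟨ *-identityʳ (T * inv k) ⟩
      T * inv k                 ∎
      where
      open ≤-Reasoning
      c = fromℕ (suc k)
      x = q ^ suc k
      0≤x = 0≤^ 0≤q (suc k)
      s = ∑ (λ j → x ^ suc j) (downFrom N)
      telescope : ∀ N → c * t * ∑ (λ j → x ^ suc j) (downFrom N) ≤ 1ℚ - x ^ N
      telescope zero    = ≤-reflexive (*-zeroʳ (c * t))
      telescope (suc N) = ≤-by (0≤+ (0≤* (0≤^ 0≤x N) (diff (ratio k))) (diff (telescope N)))
        (solve 4 (λ a x p s → a :* (x :* p :+ s) :+ (p :* ((con 1ℚ :+ :- x) :+ :- (a :* x)) :+ ((con 1ℚ :+ :- p) :+ :- (a :* s)))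
                              := con 1ℚ :+ :- (x :* p)) refl (c * t) x (x ^ N) (∑ (λ j → x ^ suc j) (downFrom N)))

    -- Positions and Taylor terms are summed in exchanged order. The term of index K contributes at
    -- most T^d (inv K)^(d+1): a factor inv K from each of the d row sums and one from the Taylor
    -- coefficient. Thus logarithm and zeta function are truncated at the same K.
    box-log≤ : ∀ d N K → ∑ (λ i → S (q ^ height i) K) (box d N) ≤ T ^ d * sumℚ (λ k → inv k ^ suc d) K
    box-log≤ d N zero    = ≤-reflexive (trans (zeros (box d N)) (sym (*-zeroʳ (T ^ d))))
      where
      zeros : ∀ (is : List (Position d)) → ∑ (λ i → 0ℚ) is ≡ 0ℚ
      zeros []       = refl
      zeros (i ∷ is) = trans (+-identityˡ (∑ (λ i → 0ℚ) is)) (zeros is)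
    box-log≤ d N (suc K) = begin
      ∑ (λ i → S (q ^ height i) K + (q ^ height i) ^ suc K * inv K) is
        ≡⟨ ∑-+ (λ i → S (q ^ height i) K) (λ i → (q ^ height i) ^ suc K * inv K) is ⟩
      ∑ (λ i → S (q ^ height i) K) is + ∑ (λ i → (q ^ height i) ^ suc K * inv K) is
        ≤⟨ +-mono-≤ (box-log≤ d N K) term ⟩
      T ^ d * Z + T ^ d * inv K ^ suc d
        ≡⟨ *-distribˡ-+ (T ^ d) Z (inv K ^ suc d) ⟨
      T ^ d * (Z + inv K ^ suc d) ∎
      where
      open ≤-Reasoning
      is = box d N
      Z = sumℚ (λ k → inv k ^ suc d) K
      x = q ^ suc K
      swap : ∀ h → (q ^ h) ^ suc K ≡ x ^ h
      swap h = trans (^-assocʳ q h (suc K)) (trans (cong (q ^_) (ℕ.*-comm h (suc K))) (sym (^-assocʳ q (suc K) h)))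
      0≤∑ : ∀ js → 0ℚ ≤ ∑ (λ j → x ^ suc j) js
      0≤∑ []       = ≤-refl
      0≤∑ (j ∷ js) = 0≤+ (0≤^ (0≤^ 0≤q (suc K)) (suc j)) (0≤∑ js)
      term : ∑ (λ i → (q ^ height i) ^ suc K * inv K) is ≤ T ^ d * inv K ^ suc d
      term = begin
        ∑ (λ i → (q ^ height i) ^ suc K * inv K) is  ≡⟨ ∑-*ʳ (λ i → (q ^ height i) ^ suc K) (inv K) is ⟩
        ∑ (λ i → (q ^ height i) ^ suc K) is * inv K  ≡⟨ cong (_* inv K) (trans (∑-cong (λ i → swap (height i)) is) (box-generating d N x)) ⟩
        ∑ (λ j → x ^ suc j) (downFrom N) ^ d * inv K ≤⟨ *-monoʳ (0≤inv K) (^-mono (0≤∑ (downFrom N)) (row-sum≤ K N) d) ⟩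
        (T * inv K) ^ d * inv K                      ≡⟨ cong (_* inv K) (^-distrib-* T (inv K) d) ⟩
        T ^ d * inv K ^ d * inv K                    ≡⟨ solve 3 (λ a b i → a :* b :* i := a :* (i :* b)) refl (T ^ d) (inv K ^ d) (inv K) ⟩
        T ^ d * (inv K * inv K ^ d)                  ∎

    -- The count says q^M P ≤ 1/(k+1), so `S` at 1 - 1/(k+1) is at most its value at 1 - q^M P,
    -- which subadditivity splits into the factors.
    log-count≤ : ∀ {k M} d N → 1 ℕ.≤ d →
      fromℕ (suc k) * (q ^ M * ∏ (λ i → 1ℚ - q ^ height i) (box d N)) ≤ 1ℚ →
      ∀ K → seq (log (suc k)) K ≤ fromℕ M * t + T ^ d * sumℚ (λ i → inv i ^ suc d) K
    log-count≤ {k} {M} d N 1≤d count K = begin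
      S (1ℚ - inv k) K             ≤⟨ S-mono (diff (inv≤1 k)) (+-monoʳ-≤ 1ℚ (neg-antimono-≤ P≤inv)) K ⟩
      S (1ℚ - q ^ M * P) K         ≤⟨ -log-subadditive (0<^ 0<q M) (^≤1 0≤q q≤1 M) (<⇒≤ 0<P) P≤1 K ⟩
      S (1ℚ - q ^ M) K + S (1ℚ - P) K
        ≤⟨ +-mono-≤ (-log-^ 0<q q≤1 K (-log≤ 0≤t 0≤q q≤1 q-inv K) M) (-log-∏ (box d N) factors K) ⟩
      fromℕ M * t + ∑ (λ i → S (1ℚ - (1ℚ - q ^ height i)) K) (box d N)
        ≡⟨ cong (fromℕ M * t +_) (∑-cong (λ i → cong (λ u → S u K) (1-[1-x] (q ^ height i))) (box d N)) ⟩
      fromℕ M * t + ∑ (λ i → S (q ^ height i) K) (box d N)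
        ≤⟨ +-monoʳ-≤ (fromℕ M * t) (box-log≤ d N K) ⟩
      fromℕ M * t + T ^ d * sumℚ (λ i → inv i ^ suc d) K ∎
      where
      open ≤-Reasoning
      P = ∏ (λ i → 1ℚ - q ^ height i) (box d N)
      q<1 : 0ℚ < 1ℚ - q
      q<1 = subst (0ℚ <_) (trans (solve 2 (λ q t → t :* q := q :* (con 1ℚ :+ t) :+ :- q) refl q t) (cong (_- q) q-inv))
              (0<* 0<t 0<q)
      factor : ∀ {d} → 1 ℕ.≤ d → (i : Position d) → 0ℚ < 1ℚ - q ^ height i × 1ℚ - q ^ height i ≤ 1ℚ
      factor _ (i ∷ is) = <-≤-trans q<1 (+-monoʳ-≤ 1ℚ (neg-antimono-≤
          (subst (q * q ^ (i ℕ.+ height is) ≤_) (*-identityʳ q) (*-monoˡ 0≤q (^≤1 0≤q q≤1 (i ℕ.+ height is))))))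
        , complement≤1 (0≤^ 0≤q (suc i ℕ.+ height is))
      factors : All (λ i → 0ℚ < 1ℚ - q ^ height i × 1ℚ - q ^ height i ≤ 1ℚ) (box d N)
      factors = All.universal (factor 1≤d) (box d N)
      0<P = proj₁ (∏-bounds (box d N) factors)
      P≤1 = proj₂ (∏-bounds (box d N) factors)
      P≤inv : q ^ M * P ≤ inv k
      P≤inv = begin
        q ^ M * P                                ≡⟨ trans (cong (_* (q ^ M * P)) (inv-inverse k)) (*-identityˡ (q ^ M * P)) ⟨
        inv k * fromℕ (suc k) * (q ^ M * P)      ≡⟨ *-assoc (inv k) (fromℕ (suc k)) (q ^ M * P) ⟩
        inv k * (fromℕ (suc k) * (q ^ M * P))    ≤⟨ *-monoˡ (0≤inv k) count ⟩
        inv k * 1ℚ                               ≡⟨ *-identityʳ (inv k) ⟩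
        inv k                                    ∎

  module _ {A : Set} (h : A → ℕ) {q : ℚ} (0≤q : 0ℚ ≤ q) (q≤1 : q ≤ 1ℚ) where

    -- The bound of a coefficient by its generating function, kept free of division. With y = q^w,
    -- lists whose new entry is 0 account for at most 1 - y. The others, after lowering that entry
    -- by 1, are counted at N - w and account for at most y.
    extend-count : ∀ w C G → (∀ N → fromℕ (length (C N)) * (q ^ N * G) ≤ 1ℚ) →
      ∀ f N → fromℕ (length (extend w C f N)) * (q ^ N * ((1ℚ - q ^ w) * G)) ≤ 1ℚ
    extend-count w C G hC = go
      where
      open ≤-Reasoning
      y = q ^ w
      0≤y = 0≤^ 0≤q w
      y≤1 = ^≤1 0≤q q≤1 w
      base : ∀ N → fromℕ (length (map (0 ∷_) (C N))) * (q ^ N * ((1ℚ - y) * G)) ≤ 1ℚ - y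
      base N = begin
        fromℕ (length (map (0 ∷_) (C N))) * (q ^ N * ((1ℚ - y) * G))
          ≡⟨ cong (λ l → fromℕ l * (q ^ N * ((1ℚ - y) * G))) (length-map (0 ∷_) (C N)) ⟩
        fromℕ (length (C N)) * (q ^ N * ((1ℚ - y) * G))
          ≡⟨ solve 4 (λ l p y G → l :* (p :* (y :* G)) := y :* (l :* (p :* G))) refl (fromℕ (length (C N))) (q ^ N) (1ℚ - y) G ⟩
        (1ℚ - y) * (fromℕ (length (C N)) * (q ^ N * G))
          ≤⟨ *-monoˡ (diff y≤1) (hC N) ⟩
        (1ℚ - y) * 1ℚ
          ≡⟨ *-identityʳ (1ℚ - y) ⟩
        1ℚ - y ∎
      go : ∀ f N → fromℕ (length (extend w C f N)) * (q ^ N * ((1ℚ - y) * G)) ≤ 1ℚ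
      go zero    N = ≤-trans (base N) (complement≤1 0≤y)
      go (suc f) N with w ℕ.≤? N
      ... | no _ = ≤-trans (base N) (complement≤1 0≤y)
      ... | yes w≤N = begin
        fromℕ (length (xs ++ map bump ys)) * (q ^ N * Y)
          ≡⟨ cong (λ l → fromℕ l * (q ^ N * Y)) (trans (length-++ xs) (cong (length xs ℕ.+_) (length-map bump ys))) ⟩
        fromℕ (length xs ℕ.+ length ys) * (q ^ N * Y)
          ≡⟨ cong (_* (q ^ N * Y)) (fromℕ-+ (length xs) (length ys)) ⟩
        (fromℕ (length xs) + fromℕ (length ys)) * (q ^ N * Y)
          ≡⟨ *-distribʳ-+ (q ^ N * Y) (fromℕ (length xs)) (fromℕ (length ys)) ⟩
        fromℕ (length xs) * (q ^ N * Y) + fromℕ (length ys) * (q ^ N * Y)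
          ≡⟨ cong (λ p → fromℕ (length xs) * (q ^ N * Y) + fromℕ (length ys) * (p * Y))
               (trans (cong (q ^_) (sym (ℕ.m+[n∸m]≡n w≤N))) (^-homo-* q w (N ℕ.∸ w))) ⟩
        fromℕ (length xs) * (q ^ N * Y) + fromℕ (length ys) * (y * q ^ (N ℕ.∸ w) * Y)
          ≡⟨ cong (fromℕ (length xs) * (q ^ N * Y) +_)
               (solve 4 (λ l y p Y → l :* (y :* p :* Y) := y :* (l :* (p :* Y))) refl (fromℕ (length ys)) y (q ^ (N ℕ.∸ w)) Y) ⟩
        fromℕ (length xs) * (q ^ N * Y) + y * (fromℕ (length ys) * (q ^ (N ℕ.∸ w) * Y))
          ≤⟨ +-mono-≤ (base N) (*-monoˡ 0≤y (go f (N ℕ.∸ w))) ⟩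
        1ℚ - y + y * 1ℚ
          ≡⟨ solve 1 (λ y → con 1ℚ :+ :- y :+ y :* con 1ℚ := con 1ℚ) refl y ⟩
        1ℚ ∎
        where
        Y = (1ℚ - y) * G
        xs = map (0 ∷_) (C N)
        ys = extend w C f (N ℕ.∸ w)

    weighted-count : ∀ xs N → fromℕ (length (weighted h xs N)) * (q ^ N * ∏ (λ x → 1ℚ - q ^ h x) xs) ≤ 1ℚ
    weighted-count []       N = subst (_≤ 1ℚ) (solve 1 (λ p → p := con 1ℚ :* (p :* con 1ℚ)) refl (q ^ N)) (^≤1 0≤q q≤1 N)
    weighted-count (x ∷ xs) N = extend-count (h x) (weighted h xs) (∏ (λ x → 1ℚ - q ^ h x) xs) (weighted-count xs) N N

  𝗉-generating≤ : ∀ {q} d n → 1 ℕ.≤ d → 0ℚ < q → q ≤ 1ℚ →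
    fromℕ (𝗉 d n) * (q ^ (d ℕ.* n) * ∏ (λ i → 1ℚ - q ^ height i) (box d n)) ≤ 1ℚ
  𝗉-generating≤ {q} d n 1≤d 0<q q≤1 = ≤-trans
    (*-monoʳ (0≤* (0≤^ 0≤q (d ℕ.* n)) (0≤∏ (box d n))) (fromℕ-mono (𝗉≤weighted d n 1≤d)))
    (weighted-count height 0≤q q≤1 (box d n) (d ℕ.* n))
    where
    0≤q = <⇒≤ 0<q
    0≤∏ : ∀ (is : List (Position d)) → 0ℚ ≤ ∏ (λ i → 1ℚ - q ^ height i) is
    0≤∏ []       = 0≤1
    0≤∏ (i ∷ is) = 0≤* (diff (^≤1 0≤q q≤1 (height i))) (0≤∏ is)

  -- Order on the reals and inequalities for the logarithm.

  fromℕ-* : ∀ m n → fromℕ (m ℕ.* n) ≡ fromℕ m * fromℕ n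
  fromℕ-* zero    n = sym (*-zeroˡ (fromℕ n))
  fromℕ-* (suc m) n = begin
    fromℕ (n ℕ.+ m ℕ.* n)          ≡⟨ fromℕ-+ n (m ℕ.* n) ⟩
    fromℕ n + fromℕ (m ℕ.* n)      ≡⟨ cong (fromℕ n +_) (fromℕ-* m n) ⟩
    fromℕ n + fromℕ m * fromℕ n    ≡⟨ +-comm (fromℕ n) (fromℕ m * fromℕ n) ⟩
    fromℕ m * fromℕ n + fromℕ n    ≡⟨ one-more (fromℕ m) (fromℕ n) ⟨
    (1ℚ + fromℕ m) * fromℕ n       ≡⟨ cong (_* fromℕ n) (fromℕ-suc m) ⟨
    fromℕ (suc m) * fromℕ n        ∎
    where open ≡-Reasoning

  fromℕ-^ : ∀ m k → fromℕ (m ℕ.^ k) ≡ fromℕ m ^ k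
  fromℕ-^ m zero    = refl
  fromℕ-^ m (suc k) = trans (fromℕ-* m (m ℕ.^ k)) (cong (fromℕ m *_) (fromℕ-^ m k))

  inv-antitone : ∀ {m n} → m ℕ.≤ n → inv n ≤ inv m
  inv-antitone {m} {n} m≤n = subst (_≤ inv m) (*-identityʳ (inv n)) (inv-≤ n
    (subst (_≤ fromℕ (suc n) * inv m) (trans (*-comm (fromℕ (suc m)) (inv m)) (inv-inverse m))
      (*-monoʳ (0≤inv m) (fromℕ-mono (ℕ.s≤s m≤n)))))

  inv-* : ∀ m n → inv m * inv n ≡ inv (n ℕ.+ m ℕ.* suc n)
  inv-* m n = begin
    inv m * inv n                                     ≡⟨ *-identityʳ (inv m * inv n) ⟨
    inv m * inv n * 1ℚ                                ≡⟨ cong (inv m * inv n *_) (inv-inverse k) ⟨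
    inv m * inv n * (inv k * fromℕ (suc m ℕ.* suc n)) ≡⟨ cong (λ x → inv m * inv n * (inv k * x)) (fromℕ-* (suc m) (suc n)) ⟩
    inv m * inv n * (inv k * (fromℕ (suc m) * fromℕ (suc n)))
      ≡⟨ solve 5 (λ i j k a b → i :* j :* (k :* (a :* b)) := i :* a :* (j :* b) :* k) refl (inv m) (inv n) (inv k) (fromℕ (suc m)) (fromℕ (suc n)) ⟩
    inv m * fromℕ (suc m) * (inv n * fromℕ (suc n)) * inv k
      ≡⟨ cong₂ (λ x y → x * y * inv k) (inv-inverse m) (inv-inverse n) ⟩
    1ℚ * 1ℚ * inv k                                   ≡⟨ solve 1 (λ k → con 1ℚ :* con 1ℚ :* k := k) refl (inv k) ⟩
    inv k                                             ∎
    where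
    open ≡-Reasoning
    k = n ℕ.+ m ℕ.* suc n

  ≤ᵣ-trans : ∀ x y z → x ≤ᵣ y → y ≤ᵣ z → x ≤ᵣ z
  ≤ᵣ-trans x y z x≤y y≤z ε 0<ε =
    let M , hM = x≤y (½ * ε) (0<half 0<ε)
        N , hN = y≤z (½ * ε) (0<half 0<ε)
    in M ℕ.⊔ N , λ n n≥ → begin
      seq x n                         ≤⟨ hM n (ℕ.m⊔n≤o⇒m≤o M N n≥) ⟩
      seq y n + ½ * ε                 ≤⟨ +-monoˡ-≤ (½ * ε) (hN n (ℕ.m⊔n≤o⇒n≤o M N n≥)) ⟩
      seq z n + ½ * ε + ½ * ε         ≡⟨ trans (+-assoc (seq z n) (½ * ε) (½ * ε)) (cong (seq z n +_) (half ε)) ⟩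
      seq z n + ε                     ∎
    where open ≤-Reasoning

  -- The error c/(n+1) tends to 0. Terms are compared at index n + 1 because `power-decay` bounds
  -- the power w^(K+1) by a multiple of `inv K`.
  ≤ᵣ-pointwise : ∀ x y {c} N → 0ℚ ≤ c → (∀ n → N ℕ.≤ n → seq x (suc n) ≤ seq y (suc n) + c * inv n) → x ≤ᵣ y
  ≤ᵣ-pointwise x y {c} N 0≤c h ε 0<ε =
    let δ , 0<δ , eq = divide {c + 1ℚ} {ε} (0<+ 0≤c 0<1) 0<ε
        M , hM = archimedean 0<δ
    in suc (M ℕ.⊔ N) , λ { (suc n) (ℕ.s≤s n≥) → begin
      seq x (suc n)               ≤⟨ h n (ℕ.m⊔n≤o⇒n≤o M N n≥) ⟩
      seq y (suc n) + c * inv n   ≤⟨ +-monoʳ-≤ (seq y (suc n)) (*-monoˡ 0≤c (hM n (ℕ.m⊔n≤o⇒m≤o M N n≥))) ⟩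
      seq y (suc n) + c * δ       ≤⟨ +-monoʳ-≤ (seq y (suc n)) (≤-by (<⇒≤ 0<δ) (solve 2 (λ c d → c :* d :+ d := (c :+ con 1ℚ) :* d) refl c δ)) ⟩
      seq y (suc n) + (c + 1ℚ) * δ ≡⟨ cong (seq y (suc n) +_) eq ⟩
      seq y (suc n) + ε           ∎ }
    where open ≤-Reasoning

  ≤ᵣ-everywhere : ∀ x y → (∀ n → seq x n ≤ seq y n) → x ≤ᵣ y
  ≤ᵣ-everywhere x y h ε 0<ε = 0 , λ n _ → ≤-trans (h n) (p≤p+q (seq y n) (<⇒≤ 0<ε))

  +ᵣ-monoˡ-≤ᵣ : ∀ x y z → x ≤ᵣ y → x +ᵣ z ≤ᵣ y +ᵣ z
  +ᵣ-monoˡ-≤ᵣ x y z x≤y ε 0<ε = let N , h = x≤y ε 0<ε in N , λ n N≤n → ≤-trans (+-monoˡ-≤ (seq z n) (h n N≤n))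
    (≤-reflexive (solve 3 (λ y e z → y :+ e :+ z := y :+ z :+ e) refl (seq y n) ε (seq z n)))

  *ᵣ-monoʳ-≤ᵣ : ∀ c x y → x ≤ᵣ y → fromℕᵣ c *ᵣ x ≤ᵣ fromℕᵣ c *ᵣ y
  *ᵣ-monoʳ-≤ᵣ c x y x≤y ε 0<ε =
    let δ , 0<δ , eq = divide {fromℕ (suc c)} {ε} (0<fromℕ c) 0<ε
        N , h = x≤y δ 0<δ
    in N , λ n N≤n → begin
      fromℕ c * seq x n                       ≤⟨ *-monoˡ (0≤fromℕ c) (h n N≤n) ⟩
      fromℕ c * (seq y n + δ)                 ≡⟨ *-distribˡ-+ (fromℕ c) (seq y n) δ ⟩
      fromℕ c * seq y n + fromℕ c * δ         ≤⟨ +-monoʳ-≤ (fromℕ c * seq y n) (*-monoʳ (<⇒≤ 0<δ) (fromℕ-mono (ℕ.n≤1+n c))) ⟩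
      fromℕ c * seq y n + fromℕ (suc c) * δ   ≡⟨ cong (fromℕ c * seq y n +_) eq ⟩
      fromℕ c * seq y n + ε                   ∎
    where open ≤-Reasoning

  -- (K+1) w^(K+1) ≤ 1 + w + ⋯ + w^K ≤ 1/(1 - w) = b.
  power-decay : ∀ {w b} → 0ℚ ≤ w → 0ℚ < 1ℚ - w → 0ℚ ≤ b → b * (1ℚ - w) ≡ 1ℚ → ∀ K → w ^ suc K ≤ b * inv K
  power-decay {w} {b} 0≤w 0<1-w 0≤b b-inv K = begin
    w ^ suc K                             ≡⟨ trans (cong (_* w ^ suc K) (inv-inverse K)) (*-identityˡ (w ^ suc K)) ⟨
    inv K * fromℕ (suc K) * w ^ suc K     ≡⟨ *-assoc (inv K) (fromℕ (suc K)) (w ^ suc K) ⟩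
    inv K * (fromℕ (suc K) * w ^ suc K)   ≤⟨ *-monoˡ (0≤inv K) (≤-trans (below-geo (suc K)) (divide-≤ 0<1-w b-inv 0≤b ≤-refl 0≤1
                                               (subst (_≤ 1ℚ) (sym (geo-sum w (suc K))) (complement≤1 (0≤^ 0≤w (suc K)))))) ⟩
    inv K * (b * 1ℚ)                      ≡⟨ solve 2 (λ i b → i :* (b :* con 1ℚ) := b :* i) refl (inv K) b ⟩
    b * inv K                             ∎
    where
    open ≤-Reasoning
    w≤1 : w ≤ 1ℚ
    w≤1 = ≤-by (<⇒≤ 0<1-w) (solve 1 (λ w → w :+ (con 1ℚ :+ :- w) := con 1ℚ) refl w)
    below-geo : ∀ K → fromℕ K * w ^ K ≤ geo w K
    below-geo zero    = ≤-refl
    below-geo (suc K) = begin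
      fromℕ (suc K) * (w * w ^ K)     ≤⟨ *-monoˡ (0≤fromℕ (suc K)) (subst (w * w ^ K ≤_) (*-identityˡ (w ^ K)) (*-monoʳ (0≤^ 0≤w K) w≤1)) ⟩
      fromℕ (suc K) * w ^ K           ≡⟨ trans (cong (_* w ^ K) (fromℕ-suc K)) (one-more (fromℕ K) (w ^ K)) ⟩
      fromℕ K * w ^ K + w ^ K         ≤⟨ +-monoˡ-≤ (w ^ K) (below-geo K) ⟩
      geo w K + w ^ K                 ∎

  complement-decay : ∀ k K → (1ℚ - inv k) ^ suc K ≤ fromℕ (suc k) * inv K
  complement-decay k = power-decay (diff (inv≤1 k)) (subst (0ℚ <_) (sym (1-[1-x] (inv k))) (0<inv k)) (0≤fromℕ (suc k))
    (trans (cong (fromℕ (suc k) *_) (1-[1-x] (inv k))) (trans (*-comm (fromℕ (suc k)) (inv k)) (inv-inverse k)))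

  log-mono : ∀ {m n} .{{_ : ℕ.NonZero m}} → m ℕ.≤ n → log m ≤ᵣ log n
  log-mono {suc m} {suc n} (ℕ.s≤s m≤n) = ≤ᵣ-everywhere (log (suc m)) (log (suc n)) λ K →
    S-mono (diff (inv≤1 m)) (+-monoʳ-≤ 1ℚ (neg-antimono-≤ (inv-antitone m≤n))) K

  log-* : ∀ m n .{{_ : ℕ.NonZero m}} .{{_ : ℕ.NonZero n}} → log m +ᵣ log n ≤ᵣ log (m ℕ.* n)
  log-* (suc m) (suc n) = ≤ᵣ-pointwise (log (suc m) +ᵣ log (suc n)) (log (suc m ℕ.* suc n)) 0
    (0≤* (0≤fromℕ (suc m)) (0≤fromℕ (suc m ℕ.* suc n))) λ K _ → begin
      S (1ℚ - inv m) (suc K) + S (1ℚ - inv n) (suc K)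
        ≤⟨ -log-superadditive (0<inv m) (inv≤1 m) (0≤inv n) (inv≤1 n) (0≤fromℕ (suc m))
             (trans (*-comm (fromℕ (suc m)) (inv m)) (inv-inverse m)) (suc K) ⟩
      S (1ℚ - inv m * inv n) (suc K) + fromℕ (suc m) * (1ℚ - inv m * inv n) ^ suc K
        ≡⟨ cong (λ x → S (1ℚ - x) (suc K) + fromℕ (suc m) * (1ℚ - x) ^ suc K) (inv-* m n) ⟩
      S (1ℚ - inv k) (suc K) + fromℕ (suc m) * (1ℚ - inv k) ^ suc K
        ≤⟨ +-monoʳ-≤ (S (1ℚ - inv k) (suc K)) (*-monoˡ (0≤fromℕ (suc m)) (complement-decay k K)) ⟩
      S (1ℚ - inv k) (suc K) + fromℕ (suc m) * (fromℕ (suc k) * inv K)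
        ≡⟨ cong (S (1ℚ - inv k) (suc K) +_) (*-assoc (fromℕ (suc m)) (fromℕ (suc k)) (inv K)) ⟨
      S (1ℚ - inv k) (suc K) + fromℕ (suc m) * fromℕ (suc k) * inv K ∎
    where
    open ≤-Reasoning
    k = n ℕ.+ m ℕ.* suc n

  log-^ : ∀ m B .{{_ : ℕ.NonZero m}} → fromℕᵣ B *ᵣ log m ≤ᵣ log (m ℕ.^ B)
  log-^ m zero    = ≤ᵣ-everywhere (fromℕᵣ 0 *ᵣ log m) (log 1) λ K →
    ≤-reflexive (trans (*-zeroˡ (seq (log m) K)) (sym (S-zero K)))
  log-^ m (suc B) = ≤ᵣ-trans (fromℕᵣ (suc B) *ᵣ log m) (log m +ᵣ log (m ℕ.^ B)) (log (m ℕ.* m ℕ.^ B))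
    (≤ᵣ-trans (fromℕᵣ (suc B) *ᵣ log m) (fromℕᵣ B *ᵣ log m +ᵣ log m) (log m +ᵣ log (m ℕ.^ B))
      (≤ᵣ-everywhere (fromℕᵣ (suc B) *ᵣ log m) (fromℕᵣ B *ᵣ log m +ᵣ log m) λ K → ≤-reflexive
        (trans (cong (_* seq (log m) K) (fromℕ-suc B)) (one-more (fromℕ B) (seq (log m) K))))
      (≤ᵣ-trans (fromℕᵣ B *ᵣ log m +ᵣ log m) (log (m ℕ.^ B) +ᵣ log m) (log m +ᵣ log (m ℕ.^ B))
        (+ᵣ-monoˡ-≤ᵣ (fromℕᵣ B *ᵣ log m) (log (m ℕ.^ B)) (log m) (log-^ m B))
        (≤ᵣ-everywhere (log (m ℕ.^ B) +ᵣ log m) (log m +ᵣ log (m ℕ.^ B)) λ K → ≤-reflexive (+-comm (seq (log (m ℕ.^ B)) K) (seq (log m) K)))))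
    (log-* m (m ℕ.^ B))
    where
    instance
      power-nonZero : ℕ.NonZero (m ℕ.^ B)
      power-nonZero = ℕ.m^n≢0 m B

  -- From 1 - i to 1 - j, with i = 1/m and j = 1/(m+1), the argument grows by i j; the derivative at
  -- the left end tends to 1/i, which gives j in the limit.
  log-suc : ∀ m .{{_ : ℕ.NonZero m}} → log m +ᵣ fromℚ (inv m) ≤ᵣ log (suc m)
  log-suc (suc k) = ≤ᵣ-pointwise (log (suc k) +ᵣ fromℚ j) (log (suc (suc k))) 0 (0≤* 0≤j (0≤fromℕ (suc k))) λ K _ → begin
    S u (suc K) + j
      ≡⟨ solve 3 (λ s j p → s :+ j := s :+ j :* (con 1ℚ :+ :- p) :+ j :* p) refl (S u (suc K)) j (u ^ suc K) ⟩
    S u (suc K) + j * (1ℚ - u ^ suc K) + j * u ^ suc K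
      ≡⟨ cong (λ x → S u (suc K) + j * x + j * u ^ suc K) (geo-sum u (suc K)) ⟨
    S u (suc K) + j * ((1ℚ - u) * geo u (suc K)) + j * u ^ suc K
      ≡⟨ solve 5 (λ s j i g p → s :+ j :* ((con 1ℚ :+ :- (con 1ℚ :+ :- i)) :* g) :+ j :* p := s :+ i :* j :* g :+ j :* p) refl (S u (suc K)) j i (geo u (suc K)) (u ^ suc K) ⟩
    S u (suc K) + i * j * geo u (suc K) + j * u ^ suc K
      ≤⟨ +-mono-≤ (S-increment-≥ 0≤u (0≤* (0≤inv k) 0≤j) (suc K)) (*-monoˡ 0≤j (complement-decay k K)) ⟩
    S (u + i * j) (suc K) + j * (fromℕ (suc k) * inv K)
      ≡⟨ cong₂ (λ x y → S x (suc K) + y) end (sym (*-assoc j (fromℕ (suc k)) (inv K))) ⟩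
    S (1ℚ - j) (suc K) + j * fromℕ (suc k) * inv K ∎
    where
    open ≤-Reasoning
    i = inv k
    j = inv (suc k)
    u = 1ℚ - i
    0≤u = diff (inv≤1 k)
    0≤j = 0≤inv (suc k)
    end : u + i * j ≡ 1ℚ - j
    end = trans (cong (λ x → 1ℚ - x + i * j) (inv-step k))
      (solve 2 (λ i j → con 1ℚ :+ :- (j :+ i :* j) :+ i :* j := con 1ℚ :+ :- j) refl i j)

  0≤log : ∀ n K → 0ℚ ≤ seq (log n) K
  0≤log zero    K = ≤-refl
  0≤log (suc k) K = subst (_≤ S (1ℚ - inv k) K) (S-zero K) (S-mono ≤-refl (diff (inv≤1 k)) K)

  log2≤1 : ∀ K → seq (log 2) K ≤ 1ℚ
  log2≤1 K = -log≤ {inv 1} {1ℚ} 0≤1 (0≤inv 1) (inv≤1 1) refl K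

  -- Each term of the reciprocal inverts the maximum of x and its positivity gap ε, so the bounds
  -- hold at every index and not merely in the limit.
  recip-bounds : ∀ x (0<x : fromℕᵣ 0 <ᵣ x) → ∃[ b ] 0ℚ ≤ b ×
    (∀ K → 0ℚ ≤ seq (recip x 0<x) K × seq (recip x 0<x) K ≤ b × seq (recip x 0<x) K * seq x K ≤ 1ℚ)
  recip-bounds x 0<x@(ε , 0<ε , _) = let b , 0<b , bε≡1 = inverse 0<ε in b , <⇒≤ 0<b , λ K →
    let a = seq x K ⊔ ε
        r = seq (recip x 0<x) K
        0<a = <-≤-trans 0<ε (p≤q⊔p (seq x K) ε)
        0≤r = <⇒≤ (positive⁻¹ r {{1/pos⇒pos a {{positive 0<a}}}})
        ar≡1 = *-inverseʳ a {{>-nonZero 0<a}}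
    in 0≤r ,
       subst (r ≤_) (*-identityʳ b) (divide-≤ 0<ε bε≡1 (<⇒≤ 0<b) (p≤q⊔p (seq x K) ε) 0≤1 (≤-reflexive ar≡1)) ,
       ≤-trans (*-monoˡ 0≤r (p≤p⊔q (seq x K) ε)) (≤-reflexive (trans (*-comm r a) ar≡1))

  -- Powers, roots and the upper bound.

  ^-cancel-≤ : ∀ k {p q} → 0ℚ ≤ q → p ^ suc k ≤ q ^ suc k → p ≤ q
  ^-cancel-≤ k {p} {q} 0≤q h = ≮⇒≥ λ q<p →
    let 0<d = subst (_< p - q) (+-inverseʳ q) (+-monoˡ-< (- q) q<p) in
    <-irrefl refl (begin-strict
      q ^ suc k                   ≡⟨ +-identityʳ (q ^ suc k) ⟨
      q ^ suc k + 0ℚ              <⟨ +-monoʳ-< (q ^ suc k) (0<^ 0<d (suc k)) ⟩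
      q ^ suc k + (p - q) ^ suc k ≤⟨ ^-superadditive 0≤q (<⇒≤ 0<d) k ⟩
      (q + (p - q)) ^ suc k       ≡⟨ cong (_^ suc k) (solve 2 (λ p q → q :+ (p :+ :- q) := p) refl p q) ⟩
      p ^ suc k                   ≤⟨ h ⟩
      q ^ suc k                   ∎)
    where open ≤-Reasoning

  1+x^≤ : ∀ d → ∃[ C ] 0ℚ ≤ C × (∀ {x} → 0ℚ ≤ x → x ≤ 1ℚ → (1ℚ + x) ^ d ≤ 1ℚ + C * x)
  1+x^≤ zero    = 0ℚ , ≤-refl , λ {x} _ _ → ≤-reflexive (solve 1 (λ x → con 1ℚ := con 1ℚ :+ con 0ℚ :* x) refl x)
  1+x^≤ (suc d) = let C , 0≤C , h = 1+x^≤ d in 1ℚ + (C + C) , 0≤+ 0≤1 (0≤+ 0≤C 0≤C) , λ {x} 0≤x x≤1 →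
    ≤-by (0≤+ (0≤* (0≤+ 0≤1 0≤x) (diff (h 0≤x x≤1))) (0≤* (0≤* 0≤C 0≤x) (diff x≤1)))
      (solve 3 (λ x C p → (con 1ℚ :+ x) :* p :+ ((con 1ℚ :+ x) :* (con 1ℚ :+ C :* x :+ :- p) :+ C :* x :* (con 1ℚ :+ :- x))
                          := con 1ℚ :+ (con 1ℚ :+ (C :+ C)) :* x) refl x C ((1ℚ + x) ^ d))

  -- The side lengths of inner and outer staircase differ by a constant, so the ratio of their
  -- powers tends to 1. Linearising by `1+x^≤`, it suffices that E + 1 ≤ x (2r) with x about η/C.
  shifted-power≤ : ∀ d E {η} → 0ℚ < η → η ≤ 1ℚ →
    ∃[ R ] ∀ r → R ℕ.≤ r → fromℕ (2 ℕ.* r ℕ.+ suc E) ^ d ≤ (1ℚ + η) * fromℕ (2 ℕ.* r) ^ d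
  shifted-power≤ d E {η} 0<η η≤1 =
    let C , 0≤C , hC = 1+x^≤ d
        x , 0<x , Cx≡η = divide {C + 1ℚ} {η} (0<+ 0≤C 0<1) 0<η
        δ , 0<δ , Eδ≡x = divide {fromℕ (suc E)} {x} (0<fromℕ E) 0<x
        N , hN = archimedean 0<δ
        0≤x : 0ℚ ≤ x
        0≤x = <⇒≤ 0<x
        Cx≤η : C * x ≤ η
        Cx≤η = ≤-by 0≤x (trans (solve 2 (λ C x → C :* x :+ x := (C :+ con 1ℚ) :* x) refl C x) Cx≡η)
        x≤1 : x ≤ 1ℚ
        x≤1 = ≤-trans (≤-by (0≤* 0≤C 0≤x) (trans (solve 2 (λ C x → x :+ C :* x := (C :+ con 1ℚ) :* x) refl C x) Cx≡η)) η≤1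
    in suc N , λ { (suc r) (ℕ.s≤s N≤r) →
      let R = fromℕ (2 ℕ.* suc r)
          e≤ : fromℕ (suc E) ≤ x * R
          e≤ = begin
            fromℕ (suc E)                                ≡⟨ *-identityʳ (fromℕ (suc E)) ⟨
            fromℕ (suc E) * 1ℚ                           ≡⟨ cong (fromℕ (suc E) *_) (inv-inverse r) ⟨
            fromℕ (suc E) * (inv r * fromℕ (suc r))      ≡⟨ *-assoc (fromℕ (suc E)) (inv r) (fromℕ (suc r)) ⟨
            fromℕ (suc E) * inv r * fromℕ (suc r)        ≤⟨ *-mono₂ (0≤* (0≤fromℕ (suc E)) (0≤inv r)) (0≤fromℕ (suc r))
                                                              (≤-trans (*-monoˡ (0≤fromℕ (suc E)) (hN r N≤r)) (≤-reflexive Eδ≡x))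
                                                              (fromℕ-mono (ℕ.m≤m+n (suc r) (suc r ℕ.+ 0))) ⟩
            x * R                                        ∎
      in begin
        fromℕ (2 ℕ.* suc r ℕ.+ suc E) ^ d     ≡⟨ cong (_^ d) (fromℕ-+ (2 ℕ.* suc r) (suc E)) ⟩
        (R + fromℕ (suc E)) ^ d               ≤⟨ ^-mono (0≤+ (0≤fromℕ (2 ℕ.* suc r)) (0≤fromℕ (suc E))) (+-monoʳ-≤ R e≤) d ⟩
        (R + x * R) ^ d                       ≡⟨ cong (_^ d) (solve 2 (λ R x → R :+ x :* R := (con 1ℚ :+ x) :* R) refl R x) ⟩
        ((1ℚ + x) * R) ^ d                    ≡⟨ ^-distrib-* (1ℚ + x) R d ⟩
        (1ℚ + x) ^ d * R ^ d                  ≤⟨ *-monoʳ (0≤^ (0≤fromℕ (2 ℕ.* suc r)) d) (≤-trans (hC 0≤x x≤1) (+-monoʳ-≤ 1ℚ Cx≤η)) ⟩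
        (1ℚ + η) * R ^ d                      ∎ }
    where open ≤-Reasoning

  -- `upper-bound` and `α-≤` take roots as arbitrary sequences satisfying `IsRoot`; this lemma
  -- supplies the actual ones.
  root-isRoot : ∀ k x → IsRoot k (positivePart x) (seq (root (suc k) x))
  root-isRoot k x m = subst
    (λ r → 0ℚ ≤ r × r ^ suc k ≤ positivePart x m × positivePart x m < (r + inv m) ^ suc k)
    same (root-spec k x m)
    where
    same : rootℚ (suc k) (seq x m ⊔ 0ℚ) m ≡ seq (root (suc k) x) m
    same = refl

  -- The infimum of d n t + ζ(d+1)/tᵈ over t > 0, attained where tᵈ⁺¹ = ζ(d+1)/n,
  -- is (d+1) (ζ(d+1) nᵈ)^{1/(d+1)}.

  log≤product : ∀ d n m {p z y} → 1 ℕ.≤ d → 𝗉 d (suc n) ≡ suc p → 0ℚ < z → 0ℚ < y →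
    sumℚ (λ i → inv i ^ suc d) m ≤ z ^ suc d → fromℕ (suc n) ^ d ≤ y ^ suc d →
    seq (log (suc p)) m ≤ fromℕ (suc d) * (z * y)
  log≤product d n m {p} {z} {y} 1≤d 𝗉≡ 0<z 0<y ζ≤ n≤ = begin
    seq (log (suc p)) m
      ≤⟨ log-count≤ 0<t 0<q q≤1 qt≡1 (<⇒≤ 0<T) tT≡1 {p} {d ℕ.* suc n} d (suc n) 1≤d
           (subst (λ P → fromℕ P * (q ^ (d ℕ.* suc n) * ∏ (λ i → 1ℚ - q ^ height i) (box d (suc n))) ≤ 1ℚ) 𝗉≡
             (𝗉-generating≤ d (suc n) 1≤d 0<q q≤1)) m ⟩
    fromℕ (d ℕ.* suc n) * t + T ^ d * sumℚ (λ i → inv i ^ suc d) m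
      ≤⟨ +-mono-≤ (≤-reflexive linear) (≤-trans (*-monoˡ (0≤^ (<⇒≤ 0<T) d) ζ≤) power) ⟩
    fromℕ d * (z * y) + z * y
      ≡⟨ trans (sym (one-more (fromℕ d) (z * y))) (cong (_* (z * y)) (sym (fromℕ-suc d))) ⟩
    fromℕ (suc d) * (z * y) ∎
    where
    open ≤-Reasoning
    zy-inverse = inverse (0<* 0<z 0<y)
    v = proj₁ zy-inverse
    0<v : 0ℚ < v
    0<v = proj₁ (proj₂ zy-inverse)
    v-inv : v * (z * y) ≡ 1ℚ
    v-inv = proj₂ (proj₂ zy-inverse)
    -- z and y are rational bounds above the two roots, so t is only near the optimum. The
    -- generating function bound holds for every t > 0, and this t gives exactly (d+1) z y.
    t T : ℚ
    t = z * y * inv n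
    T = fromℕ (suc n) * v
    0<t : 0ℚ < t
    0<t = 0<* (0<* 0<z 0<y) (0<inv n)
    0<T : 0ℚ < T
    0<T = 0<* (0<fromℕ n) 0<v
    tT≡1 : t * T ≡ 1ℚ
    tT≡1 = trans (solve 4 (λ x i c v → x :* i :* (c :* v) := i :* c :* (v :* x)) refl (z * y) (inv n) (fromℕ (suc n)) v)
      (trans (cong₂ _*_ (inv-inverse n) v-inv) (*-identityˡ 1ℚ))
    q-inverse = inverse (0<+ 0≤1 0<t)
    q = proj₁ q-inverse
    0<q : 0ℚ < q
    0<q = proj₁ (proj₂ q-inverse)
    qt≡1 : q * (1ℚ + t) ≡ 1ℚ
    qt≡1 = proj₂ (proj₂ q-inverse)
    q≤1 : q ≤ 1ℚ
    q≤1 = ≤-by (0≤* (<⇒≤ 0<q) (<⇒≤ 0<t)) (trans (solve 2 (λ q t → q :+ q :* t := q :* (con 1ℚ :+ t)) refl q t) qt≡1)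
    linear : fromℕ (d ℕ.* suc n) * t ≡ fromℕ d * (z * y)
    linear = trans (cong (_* t) (fromℕ-* d (suc n)))
      (trans (solve 4 (λ d c x i → d :* c :* (x :* i) := i :* c :* (d :* x)) refl (fromℕ d) (fromℕ (suc n)) (z * y) (inv n))
      (trans (cong (_* (fromℕ d * (z * y))) (inv-inverse n)) (*-identityˡ (fromℕ d * (z * y)))))
    power : T ^ d * z ^ suc d ≤ z * y
    power = begin
      T ^ d * z ^ suc d                     ≡⟨ cong (_* z ^ suc d) (^-distrib-* (fromℕ (suc n)) v d) ⟩
      fromℕ (suc n) ^ d * v ^ d * z ^ suc d ≡⟨ *-assoc (fromℕ (suc n) ^ d) (v ^ d) (z ^ suc d) ⟩
      fromℕ (suc n) ^ d * (v ^ d * z ^ suc d)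
        ≤⟨ *-monoʳ (0≤* (0≤^ (<⇒≤ 0<v) d) (0≤^ (<⇒≤ 0<z) (suc d))) n≤ ⟩
      y ^ suc d * (v ^ d * z ^ suc d)
        ≡⟨ solve 5 (λ y yd v z zd → y :* yd :* (v :* (z :* zd)) := v :* (zd :* yd) :* (z :* y)) refl y (y ^ d) (v ^ d) z (z ^ d) ⟩
      v ^ d * (z ^ d * y ^ d) * (z * y)     ≡⟨ cong (λ x → v ^ d * x * (z * y)) (^-distrib-* z y d) ⟨
      v ^ d * (z * y) ^ d * (z * y)         ≡⟨ cong (_* (z * y)) (^-distrib-* v (z * y) d) ⟨
      (v * (z * y)) ^ d * (z * y)           ≡⟨ cong (λ x → x ^ d * (z * y)) v-inv ⟩
      1ℚ ^ d * (z * y)                      ≡⟨ cong (_* (z * y)) (1^ d) ⟩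
      1ℚ * (z * y)                          ≡⟨ *-identityˡ (z * y) ⟩
      z * y                                 ∎
      where
      1^ : ∀ d → 1ℚ ^ d ≡ 1ℚ
      1^ zero    = refl
      1^ (suc d) = trans (*-identityˡ (1ℚ ^ d)) (1^ d)

  -- A root sequence lies below its root by less than `inv m`, so termwise bounds carry this
  -- correction. The excess c (z + y + inv m) inv m tends to 0 since z and y are bounded.
  product-limit : ∀ c x z y w → (∀ m → 0ℚ ≤ seq z m) → (∀ m → 0ℚ ≤ seq y m) → (∀ m → 0ℚ ≤ seq w m) →
    (∀ m → seq x m ≤ fromℕ c * ((seq z m + inv m) * (seq y m + inv m))) → x ≤ᵣ fromℕᵣ c *ᵣ z *ᵣ y +ᵣ w
  product-limit c x z y w 0≤z 0≤y 0≤w x≤ =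
    let a , 0<a , M , hM = bounded z
        b , 0<b , N , hN = bounded y
    in ≤ᵣ-pointwise x (fromℕᵣ c *ᵣ z *ᵣ y +ᵣ w) (M ℕ.⊔ N)
    (0≤* (0≤fromℕ c) (0≤+ (0≤+ (<⇒≤ 0<a) (<⇒≤ 0<b)) 0≤1)) λ m m≥ →
    let k = suc m
        z≤a : seq z k ≤ a
        z≤a = ≤-trans (p≤∣p∣ (seq z k)) (hM k (ℕ.m≤n⇒m≤1+n (ℕ.m⊔n≤o⇒m≤o M N m≥)))
        y≤b : seq y k ≤ b
        y≤b = ≤-trans (p≤∣p∣ (seq y k)) (hN k (ℕ.m≤n⇒m≤1+n (ℕ.m⊔n≤o⇒n≤o M N m≥)))
    in begin
      seq x k
        ≤⟨ x≤ k ⟩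
      fromℕ c * ((seq z k + inv k) * (seq y k + inv k))
        ≡⟨ solve 4 (λ c z y i → c :* ((z :+ i) :* (y :+ i)) := c :* z :* y :+ c :* ((z :+ y :+ i) :* i)) refl (fromℕ c) (seq z k) (seq y k) (inv k) ⟩
      fromℕ c * seq z k * seq y k + fromℕ c * ((seq z k + seq y k + inv k) * inv k)
        ≤⟨ +-mono-≤ (p≤p+q (fromℕ c * seq z k * seq y k) (0≤w k))
                    (*-monoˡ (0≤fromℕ c) (*-mono₂ (0≤+ (0≤+ (0≤z k) (0≤y k)) (0≤inv k)) (0≤inv k)
                      (+-mono-≤ (+-mono-≤ z≤a y≤b) (inv≤1 k)) (inv-antitone (ℕ.n≤1+n m)))) ⟩
      fromℕ c * seq z k * seq y k + seq w k + fromℕ c * ((a + b + 1ℚ) * inv m)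
        ≡⟨ cong (fromℕ c * seq z k * seq y k + seq w k +_) (sym (*-assoc (fromℕ c) (a + b + 1ℚ) (inv m))) ⟩
      fromℕ c * seq z k * seq y k + seq w k + fromℕ c * (a + b + 1ℚ) * inv m ∎
    where open ≤-Reasoning

  module _ {k : ℕ} {x : ℝ} {r : ℕ → ℚ} (r-root : IsRoot k (positivePart x) r) where

    isRoot-nonNeg : ∀ m → 0ℚ ≤ r m
    isRoot-nonNeg m = proj₁ (r-root m)

    isRoot-upper : ∀ m → seq x m ≤ (r m + inv m) ^ suc k
    isRoot-upper m = ≤-trans (p≤p⊔q (seq x m) 0ℚ) (<⇒≤ (proj₂ (proj₂ (r-root m))))

  isRoot-lower : ∀ {k n r} → IsRoot k (positivePart (fromℕᵣ n)) r → ∀ m → r m ^ suc k ≤ fromℕ n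
  isRoot-lower {k} {n} {r} r-root m = subst (r m ^ suc k ≤_) (p≥q⇒p⊔q≡p (0≤fromℕ n)) (proj₁ (proj₂ (r-root m)))

  upper-bound : ∀ d n (1≤d : 1 ℕ.≤ d) {p} → 𝗉 d (suc n) ≡ suc p → ∀ z y →
    IsRoot d (positivePart (ζ (suc d) (ℕ.s≤s 1≤d))) (seq z) → IsRoot d (positivePart (fromℕᵣ (suc n ℕ.^ d))) (seq y) →
    log (suc p) ≤ᵣ fromℕᵣ (suc d) *ᵣ z *ᵣ y +ᵣ fromℕᵣ d *ᵣ log (suc n)
  upper-bound d n 1≤d {p} 𝗉≡ z y z-root y-root = product-limit (suc d) (log (suc p)) z y (fromℕᵣ d *ᵣ log (suc n))
    0≤z 0≤y (λ m → 0≤* (0≤fromℕ d) (0≤log (suc n) m)) pointwise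
    where
    Z N : ℝ
    Z = ζ (suc d) (ℕ.s≤s 1≤d)
    N = fromℕᵣ (suc n ℕ.^ d)
    0≤z : ∀ m → 0ℚ ≤ seq z m
    0≤z = isRoot-nonNeg {d} {Z} {seq z} z-root
    0≤y : ∀ m → 0ℚ ≤ seq y m
    0≤y = isRoot-nonNeg {d} {N} {seq y} y-root
    pointwise : ∀ m → seq (log (suc p)) m ≤ fromℕ (suc d) * ((seq z m + inv m) * (seq y m + inv m))
    pointwise m = log≤product d n m {p} {seq z m + inv m} {seq y m + inv m} 1≤d 𝗉≡
      (0<+ {seq z m} {inv m} (0≤z m) (0<inv m)) (0<+ {seq y m} {inv m} (0≤y m) (0<inv m))
      (isRoot-upper {d} {Z} {seq z} z-root m)
      (subst (_≤ (seq y m + inv m) ^ suc d) (fromℕ-^ (suc n) d) (isRoot-upper {d} {N} {seq y} y-root m))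

  -- The lower bound.

  log-family : ∀ {P B} Q → suc (2 ℕ.^ Q) ℕ.^ B ℕ.≤ P →
    fromℕᵣ B *ᵣ (fromℕᵣ Q *ᵣ log 2 +ᵣ fromℚ (inv (2 ℕ.^ Q))) ≤ᵣ log P
  log-family {P} {B} Q K^B≤P =
    ≤ᵣ-trans (fromℕᵣ B *ᵣ x) (fromℕᵣ B *ᵣ log K) (log P)
      (*ᵣ-monoʳ-≤ᵣ B x (log K) (≤ᵣ-trans x (log (2 ℕ.^ Q) +ᵣ fromℚ c) (log K)
        (+ᵣ-monoˡ-≤ᵣ (fromℕᵣ Q *ᵣ log 2) (log (2 ℕ.^ Q)) (fromℚ c) (log-^ 2 Q))
        (log-suc (2 ℕ.^ Q))))
      (≤ᵣ-trans (fromℕᵣ B *ᵣ log K) (log (K ℕ.^ B)) (log P) (log-^ K B) (log-mono K^B≤P))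
    where
    K = suc (2 ℕ.^ Q)
    c = inv (2 ℕ.^ Q)
    -- Per cell: Q log 2 from independent 0/1 raises of Q corners, and c = 1/(2^Q + 1) from the
    -- extra filling.
    x = fromℕᵣ Q *ᵣ log 2 +ᵣ fromℚ c
    instance
      2^Q≢0 : ℕ.NonZero (2 ℕ.^ Q)
      2^Q≢0 = ℕ.m^n≢0 2 Q
      K^B≢0 : ℕ.NonZero (K ℕ.^ B)
      K^B≢0 = ℕ.m^n≢0 K B

  -- With exact roots this is W n^(d/(d+1)) = W^(1/(d+1)) (W n)^(d/(d+1)) and (W n)^(1/(d+1)) ≤ A.
  -- Comparing (d+1)-st powers keeps it rational.
  root-product≤ : ∀ d {W n A y ρ} → W ℕ.* n ℕ.≤ A ℕ.^ suc d → 0ℚ ≤ y → 0ℚ ≤ ρ →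
    y ^ suc d ≤ fromℕ n ^ d → fromℕ W ≤ ρ ^ suc d → fromℕ W * y ≤ ρ * fromℕ A ^ d
  root-product≤ d {W} {n} {A} {y} {ρ} Wn≤ 0≤y 0≤ρ y≤ W≤ = ^-cancel-≤ d (0≤* 0≤ρ (0≤^ (0≤fromℕ A) d)) (begin
    (w * y) ^ suc d                 ≡⟨ ^-distrib-* w y (suc d) ⟩
    w ^ suc d * y ^ suc d           ≤⟨ *-monoˡ (0≤^ 0≤w (suc d)) y≤ ⟩
    w ^ suc d * fromℕ n ^ d         ≡⟨ trans (*-assoc w (w ^ d) (fromℕ n ^ d)) (cong (w *_) (sym (^-distrib-* w (fromℕ n) d))) ⟩
    w * (w * fromℕ n) ^ d           ≡⟨ cong (λ x → w * x ^ d) (fromℕ-* W n) ⟨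
    w * fromℕ (W ℕ.* n) ^ d         ≤⟨ *-mono₂ 0≤w (0≤^ (0≤fromℕ (W ℕ.* n)) d) W≤
                                         (^-mono (0≤fromℕ (W ℕ.* n)) (≤-trans (fromℕ-mono Wn≤) (≤-reflexive (fromℕ-^ A (suc d)))) d) ⟩
    ρ ^ suc d * (a ^ suc d) ^ d     ≡⟨ cong (ρ ^ suc d *_) (trans (^-assocʳ a (suc d) d) (trans (cong (a ^_) (ℕ.*-comm (suc d) d)) (sym (^-assocʳ a d (suc d))))) ⟩
    ρ ^ suc d * (a ^ d) ^ suc d     ≡⟨ ^-distrib-* ρ (a ^ d) (suc d) ⟨
    (ρ * a ^ d) ^ suc d             ∎)
    where
    open ≤-Reasoning
    w = fromℕ W
    a = fromℕ A
    0≤w = 0≤fromℕ W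

  -- The arithmetic of `α-≤` at one index m: k = d+1, f = d!, Q = 2^d, l a partial sum for log 2, a
  -- = A^d, s the d-th power of the radius, y and ρ the terms approximating n^(d/(d+1)) and
  -- ((d+1)!)^(1/(d+1)), r the term of 1/ρ, i = `inv m`.
  lower-estimate : ∀ {k f B Q l c c₀ γ a s y ρ r b i} →
    1ℚ ≤ f → 0ℚ ≤ Q → 0ℚ ≤ l + γ → 0ℚ ≤ l + c → 0ℚ ≤ a → 0ℚ ≤ s → 0ℚ ≤ r → 0ℚ ≤ b → 0ℚ ≤ i →
    k * f * y ≤ (ρ + i) * a → r * ρ ≤ 1ℚ → r ≤ b → a ≤ (1ℚ + γ) * (Q * s) → s ≤ f * B →
    (1ℚ + γ) * (l + γ) ≤ l + c → Q * c ≡ c₀ → l + γ ≤ 1ℚ + 1ℚ →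
    k * r * (l + γ) * y ≤ B * (Q * l + c₀) + (1ℚ + 1ℚ) * b * a * i
  lower-estimate {k} {f} {B} {Q} {l} {c} {c₀} {γ} {a} {s} {y} {ρ} {r} {b} {i}
    1≤f 0≤Q 0≤lγ 0≤lc 0≤a 0≤s 0≤r 0≤b 0≤i kfy≤ rρ≤1 r≤b a≤ s≤ γ≤ Qc≡ lγ≤2 =
    -- The factor f = d! is carried along so that s ≤ d! B can be used without division.
    *-cancelˡ-≤-pos f {{positive (<-≤-trans 0<1 1≤f)}} (begin
      f * (k * r * (l + γ) * y)
        ≡⟨ solve 5 (λ f k r lγ y → f :* (k :* r :* lγ :* y) := r :* (k :* f :* y) :* lγ) refl f k r (l + γ) y ⟩
      r * (k * f * y) * (l + γ)
        ≤⟨ *-monoʳ 0≤lγ (*-monoˡ 0≤r kfy≤) ⟩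
      r * ((ρ + i) * a) * (l + γ)
        ≡⟨ solve 5 (λ r ρ i a x → r :* ((ρ :+ i) :* a) :* x := r :* ρ :* (a :* x) :+ r :* x :* (a :* i)) refl r ρ i a (l + γ) ⟩
      r * ρ * (a * (l + γ)) + r * (l + γ) * (a * i)
        ≤⟨ +-mono-≤ (*-monoʳ (0≤* 0≤a 0≤lγ) rρ≤1) (*-monoʳ (0≤* 0≤a 0≤i) (*-mono₂ 0≤r 0≤lγ r≤b lγ≤2)) ⟩
      1ℚ * (a * (l + γ)) + b * (1ℚ + 1ℚ) * (a * i)
        ≡⟨ solve 4 (λ a x b i → con 1ℚ :* (a :* x) :+ b :* (con 1ℚ :+ con 1ℚ) :* (a :* i) := a :* x :+ (con 1ℚ :+ con 1ℚ) :* b :* a :* i) refl a (l + γ) b i ⟩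
      a * (l + γ) + e
        ≤⟨ +-mono-≤ main (subst (_≤ f * e) (*-identityˡ e) (*-monoʳ 0≤e 1≤f)) ⟩
      f * (B * (Q * l + c₀)) + f * e
        ≡⟨ *-distribˡ-+ f (B * (Q * l + c₀)) e ⟨
      f * (B * (Q * l + c₀) + e) ∎)
    where
    open ≤-Reasoning
    e = (1ℚ + 1ℚ) * b * a * i
    0≤e : 0ℚ ≤ e
    0≤e = 0≤* (0≤* (0≤* (<⇒≤ 0<2) 0≤b) 0≤a) 0≤i
    main : a * (l + γ) ≤ f * (B * (Q * l + c₀))
    main = begin
      a * (l + γ)                       ≤⟨ *-monoʳ 0≤lγ a≤ ⟩
      (1ℚ + γ) * (Q * s) * (l + γ)      ≡⟨ solve 4 (λ g Q s x → g :* (Q :* s) :* x := g :* x :* (Q :* s)) refl (1ℚ + γ) Q s (l + γ) ⟩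
      (1ℚ + γ) * (l + γ) * (Q * s)      ≤⟨ *-monoʳ (0≤* 0≤Q 0≤s) γ≤ ⟩
      (l + c) * (Q * s)                 ≤⟨ *-monoˡ 0≤lc (*-monoˡ 0≤Q s≤) ⟩
      (l + c) * (Q * (f * B))           ≡⟨ solve 5 (λ l c Q f B → (l :+ c) :* (Q :* (f :* B)) := f :* (B :* (Q :* l :+ Q :* c))) refl l c Q f B ⟩
      f * (B * (Q * l + Q * c))         ≡⟨ cong (λ x → f * (B * (Q * l + x))) Qc≡ ⟩
      f * (B * (Q * l + c₀))            ∎

  -- A bounds ((d+1)! n)^{1/(d+1)} from above, and w stands for 1/ρ.

  α-≤ : ∀ d {n A r B c c₀ γ} → 0ℚ ≤ γ → 0ℚ ≤ c → c ≤ 1ℚ → fromℕ 3 * γ ≡ c → fromℕ (2 ℕ.^ d) * c ≡ c₀ →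
    suc d ! ℕ.* n ℕ.≤ A ℕ.^ suc d → fromℕ A ^ d ≤ (1ℚ + γ) * fromℕ (2 ℕ.* r) ^ d → r ℕ.^ d ℕ.≤ d ! ℕ.* B →
    ∀ y ρ w Λ → IsRoot d (positivePart (fromℕᵣ (n ℕ.^ d))) (seq y) → IsRoot d (positivePart (fromℕᵣ (suc d !))) (seq ρ) →
    ∀ {b} → 0ℚ ≤ b → (∀ m → 0ℚ ≤ seq w m × seq w m ≤ b × seq w m * seq ρ m ≤ 1ℚ) →
    (∀ m → 0ℚ ≤ seq Λ m × seq Λ m ≤ 1ℚ) →
    fromℕᵣ (suc d) *ᵣ w *ᵣ (Λ +ᵣ fromℚ γ) *ᵣ y ≤ᵣ fromℕᵣ B *ᵣ (fromℕᵣ (2 ℕ.^ d) *ᵣ Λ +ᵣ fromℚ c₀)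
  α-≤ d {n} {A} {r} {B} {c} {c₀} {γ} 0≤γ 0≤c c≤1 3γ≡c Qc≡ Wn≤ A≤ r≤ y ρ w Λ y-root ρ-root {b} 0≤b hb hΛ =
    ≤ᵣ-pointwise (fromℕᵣ (suc d) *ᵣ w *ᵣ (Λ +ᵣ fromℚ γ) *ᵣ y) (fromℕᵣ B *ᵣ (fromℕᵣ (2 ℕ.^ d) *ᵣ Λ +ᵣ fromℚ c₀)) 0
      0≤slack λ m _ → ≤-trans (at (suc m))
        (+-monoʳ-≤ (fromℕ B * (fromℕ (2 ℕ.^ d) * seq Λ (suc m) + c₀)) (*-monoˡ 0≤slack (inv-antitone (ℕ.n≤1+n m))))
    where
    open ≤-Reasoning
    a = fromℕ A ^ d
    0≤a : 0ℚ ≤ a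
    0≤a = 0≤^ (0≤fromℕ A) d
    slack = (1ℚ + 1ℚ) * b * a
    0≤slack : 0ℚ ≤ slack
    0≤slack = 0≤* (0≤* (<⇒≤ 0<2) 0≤b) 0≤a
    1≤f : 1ℚ ≤ fromℕ (d !)
    1≤f = fromℕ-mono {1} {d !} (ℕ.1≤n! d)
    γ≤c : γ ≤ c
    γ≤c = ≤-by (0≤+ 0≤γ 0≤γ) (trans (solve 1 (λ γ → γ :+ (γ :+ γ) := (con 1ℚ :+ (con 1ℚ :+ con 1ℚ)) :* γ) refl γ) 3γ≡c)
    γ≤1 : γ ≤ 1ℚ
    γ≤1 = ≤-trans γ≤c c≤1
    scale : fromℕ (2 ℕ.* r) ^ d ≡ fromℕ (2 ℕ.^ d) * fromℕ (r ℕ.^ d)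
    scale = trans (cong (_^ d) (fromℕ-* 2 r)) (trans (^-distrib-* (fromℕ 2) (fromℕ r) d)
      (sym (cong₂ _*_ (fromℕ-^ 2 d) (fromℕ-^ r d))))
    -- (1 + γ)(l + γ) exceeds l by γ + γ l + γ², three terms of size at most γ; hence c = 3γ.
    product≤ : ∀ {l} → 0ℚ ≤ l → l ≤ 1ℚ → (1ℚ + γ) * (l + γ) ≤ l + c
    product≤ {l} 0≤l l≤1 = ≤-by (0≤+ (0≤* 0≤γ (diff l≤1)) (0≤* 0≤γ (diff γ≤1)))
      (trans (solve 2 (λ l γ → (con 1ℚ :+ γ) :* (l :+ γ) :+ (γ :* (con 1ℚ :+ :- l) :+ γ :* (con 1ℚ :+ :- γ))
                             := l :+ (con 1ℚ :+ (con 1ℚ :+ con 1ℚ)) :* γ) refl l γ) (cong (l +_) 3γ≡c))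
    module _ (m : ℕ) where
      l = seq Λ m
      0≤l : 0ℚ ≤ l
      0≤l = proj₁ (hΛ m)
      l≤1 : l ≤ 1ℚ
      l≤1 = proj₂ (hΛ m)
      0≤ρ+i : 0ℚ ≤ seq ρ m + inv m
      0≤ρ+i = 0≤+ {seq ρ m} {inv m} (isRoot-nonNeg {d} {fromℕᵣ (suc d !)} {seq ρ} ρ-root m) (0≤inv m)
      y-bound : fromℕ (suc d) * fromℕ (d !) * seq y m ≤ (seq ρ m + inv m) * a
      y-bound = subst (λ x → x * seq y m ≤ (seq ρ m + inv m) * a) (fromℕ-* (suc d) (d !))
        (root-product≤ d {suc d !} {n} {A} {seq y m} {seq ρ m + inv m} Wn≤
          (isRoot-nonNeg {d} {fromℕᵣ (n ℕ.^ d)} {seq y} y-root m) 0≤ρ+i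
          (subst (seq y m ^ suc d ≤_) (fromℕ-^ n d) (isRoot-lower {d} {n ℕ.^ d} {seq y} y-root m))
          (isRoot-upper {d} {fromℕᵣ (suc d !)} {seq ρ} ρ-root m))
      at : fromℕ (suc d) * seq w m * (l + γ) * seq y m ≤ fromℕ B * (fromℕ (2 ℕ.^ d) * l + c₀) + slack * inv m
      at = lower-estimate {fromℕ (suc d)} {fromℕ (d !)} {fromℕ B} {fromℕ (2 ℕ.^ d)} {l} {c} {c₀} {γ} {a}
        {fromℕ (r ℕ.^ d)} {seq y m} {seq ρ m} {seq w m} {b} {inv m}
        1≤f (0≤fromℕ (2 ℕ.^ d)) (0≤+ 0≤l 0≤γ) (0≤+ 0≤l 0≤c) 0≤a (0≤fromℕ (r ℕ.^ d)) (proj₁ (hb m)) 0≤b (0≤inv m)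
        y-bound (proj₂ (proj₂ (hb m))) (proj₁ (proj₂ (hb m)))
        (subst (λ x → a ≤ (1ℚ + γ) * x) scale A≤)
        (subst (fromℕ (r ℕ.^ d) ≤_) (fromℕ-* (d !) B) (fromℕ-mono r≤))
        (product≤ 0≤l l≤1) Qc≡ (+-mono-≤ l≤1 γ≤1)

  -- One factor K on the right of `family-size` is cancelled by giving up one cell; the additional
  -- cell in `simplex-length+` keeps B at least r^d/d!.
  family-lower : ∀ e r n → (2 ℕ.* r ℕ.+ 2 ℕ.* suc e ℕ.+ 2) ℕ.^ suc (suc e) ℕ.≤ suc (suc e) ! ℕ.* n →
    ∃[ B ] r ℕ.^ suc e ℕ.≤ suc e ! ℕ.* B × suc (2 ℕ.^ (2 ℕ.^ suc e)) ℕ.^ B ℕ.≤ 𝗉 (suc e) n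
  family-lower e r n fits =
    drop-one (length (simplex (suc e) r)) (𝗉 (suc e) n) (simplex-length+ e r) (Family.family-size (suc e) r n fits)
    where
    K f : ℕ
    K = suc (2 ℕ.^ (2 ℕ.^ suc e))
    f = suc e !
    drop-one : ∀ L P → r ℕ.^ suc e ℕ.+ f ℕ.≤ f ℕ.* L → K ℕ.^ L ℕ.≤ P ℕ.* K → ∃[ B ] r ℕ.^ suc e ℕ.≤ f ℕ.* B × K ℕ.^ B ℕ.≤ P
    drop-one zero    P long size = contradiction (ℕ.≤-trans (ℕ.1≤n! (suc e))
      (ℕ.≤-trans (ℕ.m≤n+m f (r ℕ.^ suc e)) (ℕ.≤-trans long (ℕ.≤-reflexive (ℕ.*-zeroʳ f))))) λ ()
    drop-one (suc B) P long size = B ,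
      ℕ.+-cancelʳ-≤ f (r ℕ.^ suc e) (f ℕ.* B)
        (ℕ.≤-trans long (ℕ.≤-reflexive (trans (ℕ.*-suc f B) (ℕ.+-comm f (f ℕ.* B))))) ,
      ℕ.*-cancelˡ-≤ K (ℕ.≤-trans size (ℕ.≤-reflexive (ℕ.*-comm P K)))

  -- r is the largest radius that fits. Failure at r + 1 gives the last bound, since 2(r+1) + 2d + 2
  -- = 2r + (2d + 4).
  radius : ∀ d R N → (2 ℕ.* R ℕ.+ 2 ℕ.* d ℕ.+ 2) ℕ.^ suc d ℕ.≤ N →
    ∃[ r ] R ℕ.≤ r × (2 ℕ.* r ℕ.+ 2 ℕ.* d ℕ.+ 2) ℕ.^ suc d ℕ.≤ N × N ℕ.≤ (2 ℕ.* r ℕ.+ suc (2 ℕ.* d ℕ.+ 3)) ℕ.^ suc d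
  radius d R N big = r , R≤r , proj₁ found ,
    subst (λ a → N ℕ.≤ a ℕ.^ suc d) (solveℕ 2 (λ r d → # 2 ⊗ (# 1 ⊕ r) ⊕ # 2 ⊗ d ⊕ # 2 ⊜ # 2 ⊗ r ⊕ (# 1 ⊕ (# 2 ⊗ d ⊕ # 3))) refl r d)
      (ℕ.<⇒≤ (ℕ.≰⇒> (proj₂ found)))
    where
    open ℕ.≤-Reasoning
    side : ℕ → ℕ
    side r = 2 ℕ.* r ℕ.+ 2 ℕ.* d ℕ.+ 2
    side-mono : ∀ r s → r ℕ.≤ s → side r ℕ.≤ side s
    side-mono r s r≤s = ℕ.+-monoˡ-≤ 2 (ℕ.+-monoˡ-≤ (2 ℕ.* d) (ℕ.*-monoʳ-≤ 2 r≤s))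
    Fits : ℕ → Set
    Fits r = side r ℕ.^ suc d ℕ.≤ N
    fits? : Decidable Fits
    fits? r = side r ℕ.^ suc d ℕ.≤? N
    r = search fits? N
    too-big : ¬ Fits (suc N)
    too-big fits = ℕ.<-irrefl refl (begin-strict
      N                         <⟨ ℕ.n<1+n N ⟩
      suc N                     ≤⟨ ℕ.m≤m+n (suc N) (suc N ℕ.+ 0) ⟩
      2 ℕ.* suc N               ≤⟨ ℕ.≤-trans (ℕ.m≤m+n (2 ℕ.* suc N) (2 ℕ.* d)) (ℕ.m≤m+n (2 ℕ.* suc N ℕ.+ 2 ℕ.* d) 2) ⟩
      side (suc N)              ≡⟨ ℕ.*-identityʳ (side (suc N)) ⟨
      side (suc N) ℕ.^ 1        ≤⟨ ℕ.^-monoʳ-≤ (side (suc N)) {1} {suc d} (ℕ.s≤s ℕ.z≤n) ⟩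
      side (suc N) ℕ.^ suc d    ≤⟨ fits ⟩
      N                         ∎)
    found : Fits r × ¬ Fits (suc r)
    found = search-spec fits? (ℕ.≤-trans (ℕ.^-monoˡ-≤ (suc d) (side-mono 0 R ℕ.z≤n)) big) N too-big
    R≤r : R ℕ.≤ r
    R≤r = ℕ.≮⇒≥ λ r<R → proj₂ found (ℕ.≤-trans (ℕ.^-monoˡ-≤ (suc d) (side-mono (suc r) R r<R)) big)

  -- Rewriting along these equations unfolds definitions in place; leaving it to
  -- the conversion of _≤ᵣ_ would normalise rational arithmetic.

  β-unfold : ∀ d 1≤d → fromℕᵣ (suc d) *ᵣ root (suc d) (ζ (suc d) (ℕ.s≤s 1≤d)) ≡ β d 1≤d
  β-unfold d 1≤d = refl

  α-unfold : ∀ d δ → fromℕᵣ (suc d) *ᵣ recip (root (suc d) (fromℕᵣ (suc d !))) (root-!-positive d) *ᵣ δ ≡ α d δ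
  α-unfold d δ = refl

  ^⟨⟩-unfold : ∀ d n → root (suc d) (fromℕᵣ (n ℕ.^ d)) ≡ n ^⟨ d / suc d ⟩
  ^⟨⟩-unfold d n = refl

  ^⟨⟩-isRoot : ∀ d n → IsRoot d (positivePart (fromℕᵣ (n ℕ.^ d))) (seq (n ^⟨ d / suc d ⟩))
  ^⟨⟩-isRoot d n = subst (λ y → IsRoot d (positivePart (fromℕᵣ (n ℕ.^ d))) (seq y)) (^⟨⟩-unfold d n)
    (root-isRoot d (fromℕᵣ (n ℕ.^ d)))

  -- Both bounds for all large n.

  log𝗉≤ : ∀ d n 1≤d → 1 ℕ.≤ 𝗉 d (suc n) →
    log (𝗉 d (suc n)) ≤ᵣ β d 1≤d *ᵣ suc n ^⟨ d / suc d ⟩ +ᵣ fromℕᵣ d *ᵣ log (suc n)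
  log𝗉≤ d n 1≤d 1≤𝗉 = subst (λ p → log p ≤ᵣ β d 1≤d *ᵣ (suc n ^⟨ d / suc d ⟩) +ᵣ fromℕᵣ d *ᵣ log (suc n)) 𝗉≡
    (subst (λ b → log (suc (ℕ.pred (𝗉 d (suc n)))) ≤ᵣ b *ᵣ (suc n ^⟨ d / suc d ⟩) +ᵣ fromℕᵣ d *ᵣ log (suc n)) (β-unfold d 1≤d)
      (upper-bound d n 1≤d {ℕ.pred (𝗉 d (suc n))} (sym 𝗉≡) (root (suc d) (ζ (suc d) (ℕ.s≤s 1≤d))) (suc n ^⟨ d / suc d ⟩)
        (root-isRoot d (ζ (suc d) (ℕ.s≤s 1≤d))) (^⟨⟩-isRoot d (suc n))))
    where
    𝗉≡ : suc (ℕ.pred (𝗉 d (suc n))) ≡ 𝗉 d (suc n)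
    𝗉≡ = ℕ.suc-pred (𝗉 d (suc n)) {{ℕ.>-nonZero 1≤𝗉}}

  ≤log𝗉 : ∀ d {n A r B c γ} → 0ℚ ≤ γ → 0ℚ ≤ c → c ≤ 1ℚ → fromℕ 3 * γ ≡ c →
    fromℕ (2 ℕ.^ d) * c ≡ inv (2 ℕ.^ (2 ℕ.^ d)) →
    suc d ! ℕ.* n ℕ.≤ A ℕ.^ suc d → fromℕ A ^ d ≤ (1ℚ + γ) * fromℕ (2 ℕ.* r) ^ d → r ℕ.^ d ℕ.≤ d ! ℕ.* B →
    suc (2 ℕ.^ (2 ℕ.^ d)) ℕ.^ B ℕ.≤ 𝗉 d n →
    α d (log 2 +ᵣ fromℚ γ) *ᵣ n ^⟨ d / suc d ⟩ ≤ᵣ log (𝗉 d n)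
  ≤log𝗉 d {n} {A} {r} {B} {c} {γ} 0≤γ 0≤c c≤1 3γ≡c Qc≡ Wn≤ A≤ r≤ K^B≤ =
    ≤ᵣ-trans (α d (log 2 +ᵣ fromℚ γ) *ᵣ (n ^⟨ d / suc d ⟩)) (fromℕᵣ B *ᵣ (fromℕᵣ (2 ℕ.^ d) *ᵣ log 2 +ᵣ fromℚ (inv (2 ℕ.^ (2 ℕ.^ d))))) (log (𝗉 d n))
      (subst (λ a → a *ᵣ (n ^⟨ d / suc d ⟩) ≤ᵣ (fromℕᵣ B *ᵣ (fromℕᵣ (2 ℕ.^ d) *ᵣ log 2 +ᵣ fromℚ (inv (2 ℕ.^ (2 ℕ.^ d)))))) (α-unfold d (log 2 +ᵣ fromℚ γ))
        (α-≤ d {n} {A} {r} {B} {c} {inv (2 ℕ.^ (2 ℕ.^ d))} {γ} 0≤γ 0≤c c≤1 3γ≡c Qc≡ Wn≤ A≤ r≤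
          (n ^⟨ d / suc d ⟩) (root (suc d) (fromℕᵣ (suc d !))) (recip (root (suc d) (fromℕᵣ (suc d !))) (root-!-positive d)) (log 2) (^⟨⟩-isRoot d n) (root-isRoot d (fromℕᵣ (suc d !)))
          (proj₁ (proj₂ w-bounds)) (proj₂ (proj₂ w-bounds)) (λ m → 0≤log 2 m , log2≤1 m)))
      (log-family {𝗉 d n} {B} (2 ℕ.^ d) K^B≤)
    where
    w-bounds = recip-bounds (root (suc d) (fromℕᵣ (suc d !))) (root-!-positive d)

  -- The threshold on n makes R itself fit, so the radius found is at least R and the error estimate
  -- `hR` applies to it. The threshold is positive, which excludes n = 0.
  bounds-at : ∀ e (1≤d : 1 ℕ.≤ suc e) {c γ} → 0ℚ ≤ γ → 0ℚ ≤ c → c ≤ 1ℚ → fromℕ 3 * γ ≡ c →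
    fromℕ (2 ℕ.^ suc e) * c ≡ inv (2 ℕ.^ (2 ℕ.^ suc e)) →
    ∀ R → (∀ r → R ℕ.≤ r → fromℕ (2 ℕ.* r ℕ.+ suc (2 ℕ.* suc e ℕ.+ 3)) ^ suc e ≤ (1ℚ + γ) * fromℕ (2 ℕ.* r) ^ suc e) →
    ∀ n → (2 ℕ.* R ℕ.+ 2 ℕ.* suc e ℕ.+ 2) ℕ.^ suc (suc e) ℕ.≤ n →
    α (suc e) (log 2 +ᵣ fromℚ γ) *ᵣ n ^⟨ suc e / suc (suc e) ⟩ ≤ᵣ log (𝗉 (suc e) n) ×
    log (𝗉 (suc e) n) ≤ᵣ β (suc e) 1≤d *ᵣ n ^⟨ suc e / suc (suc e) ⟩ +ᵣ fromℕᵣ (suc e) *ᵣ log n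
  bounds-at e 1≤d {c} {γ} 0≤γ 0≤c c≤1 3γ≡c Qc≡ R hR zero    big = contradiction big (ℕ.<⇒≱ (ℕ.m^n>0 side (suc (suc e))))
    where
    side = 2 ℕ.* R ℕ.+ 2 ℕ.* suc e ℕ.+ 2
    instance
      side≢0 : ℕ.NonZero side
      side≢0 = ℕ.>-nonZero (ℕ.≤-trans (ℕ.s≤s ℕ.z≤n) (ℕ.m≤n+m 2 (2 ℕ.* R ℕ.+ 2 ℕ.* suc e)))
  bounds-at e 1≤d {c} {γ} 0≤γ 0≤c c≤1 3γ≡c Qc≡ R hR (suc n) big =
    let r , R≤r , fits , Wn≤ = radius (suc e) R (suc (suc e) ! ℕ.* suc n) (ℕ.≤-trans big (ℕ.m≤n*m (suc n) (suc (suc e) !)))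
        B , r≤ , K^B≤ = family-lower e r (suc n) fits
    in ≤log𝗉 (suc e) {suc n} {2 ℕ.* r ℕ.+ suc (2 ℕ.* suc e ℕ.+ 3)} {r} {B} {c} {γ} 0≤γ 0≤c c≤1 3γ≡c Qc≡ Wn≤ (hR r R≤r) r≤ K^B≤ ,
       -- The family of the lower bound also shows that the number of partitions is positive, as the
       -- upper bound on its logarithm requires.
       log𝗉≤ (suc e) n 1≤d (ℕ.≤-trans (ℕ.m^n>0 (suc (2 ℕ.^ (2 ℕ.^ suc e))) B) K^B≤)
    where
    instance
      W≢0 : ℕ.NonZero (suc (suc e) !)
      W≢0 = suc (suc e) ℕ.!≢0

  -- The extra filling of a cube gains log (1 + 2^(-2^d)) ≥ c₀ = 1/(2^(2^d) + 1), that
  -- is c = c₀/2^d per position; γ = c/3 leaves room for the error in the radius.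

  gain : ∀ d → ∃[ c ] ∃[ γ ] 0ℚ ≤ c × c ≤ 1ℚ × 0ℚ < γ × fromℕ 3 * γ ≡ c × fromℕ (2 ℕ.^ d) * c ≡ inv (2 ℕ.^ (2 ℕ.^ d))
  gain d =
    let c , 0<c , Qc≡ = divide {fromℕ Q} {inv (2 ℕ.^ Q)} (<-≤-trans 0<1 1≤Q) (0<inv (2 ℕ.^ Q))
        γ , 0<γ , 3γ≡c = divide {fromℕ 3} {c} (0<fromℕ 2) 0<c
        c≤Qc = subst (_≤ fromℕ Q * c) (*-identityˡ c) (*-monoʳ (<⇒≤ 0<c) 1≤Q)
    in c , γ , <⇒≤ 0<c , ≤-trans c≤Qc (≤-trans (≤-reflexive Qc≡) (inv≤1 (2 ℕ.^ Q))) , 0<γ , 3γ≡c , Qc≡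
    where
    Q = 2 ℕ.^ d
    1≤Q : 1ℚ ≤ fromℕ Q
    1≤Q = fromℕ-mono {1} {Q} (ℕ.m^n>0 2 d)

  eventually-bounds : ∀ e (1≤d : 1 ℕ.≤ suc e) {c γ} → 0ℚ ≤ c → c ≤ 1ℚ → 0ℚ < γ → fromℕ 3 * γ ≡ c →
    fromℕ (2 ℕ.^ suc e) * c ≡ inv (2 ℕ.^ (2 ℕ.^ suc e)) →
    ∃[ N ] ∀ n → N ℕ.≤ n →
      α (suc e) (log 2 +ᵣ fromℚ γ) *ᵣ n ^⟨ suc e / suc (suc e) ⟩ ≤ᵣ log (𝗉 (suc e) n) ×
      log (𝗉 (suc e) n) ≤ᵣ β (suc e) 1≤d *ᵣ n ^⟨ suc e / suc (suc e) ⟩ +ᵣ fromℕᵣ (suc e) *ᵣ log n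
  eventually-bounds e 1≤d {c} {γ} 0≤c c≤1 0<γ 3γ≡c Qc≡ =
    let R , hR = shifted-power≤ (suc e) (2 ℕ.* suc e ℕ.+ 3) 0<γ γ≤1
    in (2 ℕ.* R ℕ.+ 2 ℕ.* suc e ℕ.+ 2) ℕ.^ suc (suc e) , bounds-at e 1≤d (<⇒≤ 0<γ) 0≤c c≤1 3γ≡c Qc≡ R hR
    where
    γ≤1 : γ ≤ 1ℚ
    γ≤1 = ≤-trans (subst (_≤ fromℕ 3 * γ) (*-identityˡ γ) (*-monoʳ (<⇒≤ 0<γ) (1≤fromℕ 2)))
            (≤-trans (≤-reflexive 3γ≡c) c≤1)

  <ᵣ-+ : ∀ x {γ} → 0ℚ < γ → x <ᵣ x +ᵣ fromℚ γ
  <ᵣ-+ x {γ} 0<γ = γ , 0<γ , 0 , λ _ _ → ≤-refl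

open import Data.Nat.Base using (ℕ; suc; _≤_)
open import Data.Product.Base using (∃-syntax; _×_; _,_)
open import Defs using (log; 𝗉; α; β; fromℕᵣ; _<ᵣ_; _≤ᵣ_; _+ᵣ_; _*ᵣ_; _^⟨_/_⟩; fromℚ)
open Analysis using (gain; eventually-bounds; <ᵣ-+)

theorem1p1 : (d : ℕ) (1≤d : 1 ≤ d) →
    ∃[ δ ] log 2 <ᵣ δ ×
    (∃[ N ] ∀ (n : ℕ) → N ≤ n →
    α d δ *ᵣ n ^⟨ d / suc d ⟩ ≤ᵣ log (𝗉 d n) ×
    log (𝗉 d n) ≤ᵣ β d 1≤d *ᵣ n ^⟨ d / suc d ⟩ +ᵣ fromℕᵣ d *ᵣ log n)
theorem1p1 (suc e) 1≤d =
  let c , γ , 0≤c , c≤1 , 0<γ , 3γ≡c , Qc≡ = gain (suc e)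
  in log 2 +ᵣ fromℚ γ , <ᵣ-+ (log 2) 0<γ , eventually-bounds e 1≤d 0≤c c≤1 0<γ 3γ≡c Qc≡
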